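{- Let $r,n$ be positive integers and $h\in\{0,1,\dots,r-1\}$. Let $k,b$ be integers with $1\le k\le n-1$ and $k\le b\le n$. Then the following identities hold (in the field of rational functions in $q$). (i) If $k$ is odd, then $$\sum_{\pi\in H_{r,n}(b-k+1\,:\,b)}\chi_{ -1,h}(\pi)q^{\mathrm{fmaj}(\pi)}=\frac{[r]_{\zeta^h q}[2r]_{ -\zeta^h q}\cdots[nr]_{(-1)^{n-1}\zeta^h q}}{[1]_{\zeta^h q}[2]_{ -\zeta^h q}\cdots[k]_{(-1)^{k-1}\zeta^h q}}.$$ (ii) If $k$ is even and $n-b\equiv 0\pmod 2$, then $$\sum_{\pi\in H_{r,n}(b-k+1\,:\,b)}\chi_{ -1,h}(\pi)q^{\mathrm{fmaj}(\pi)}=\frac{[r]_{\zeta^h q}[2r]_{ -\zeta^h q}\cdots[nr]_{(-1)^{n-1}\zeta^h q}}{[1]_{\zeta^h q}[2]_{ -\zeta^h q}\cdots[k+1]_{(-1)^{k}\zeta^h q}}\cdot[k+1]_{(-1)^n\zeta^h q}.$$ (iii) If $k$ is even and $n-b\equiv 1\pmod 2$, then $$\sum_{\pi\in H_{r,n}(b-k+1\,:\,b)}\chi_{ -1,h}(\pi)q^{\mathrm{fmaj}(\pi)}=\frac{[r]_{\zeta^h q}[2r]_{ -\zeta^h q}\cdots[nr]_{(-1)^{n-1}\zeta^h q}}{[1]_{\zeta^h q}[2]_{ -\zeta^h q}\cdots[k+1]_{(-1)^{k}\zeta^h q}}\,\Big(2-[k+1]_{(-1)^n\zeta^h q}\Big).$$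 In these formulas the $i$th factor of each numerator is $[ir]_{(-1)^{i-1}\zeta^h q}$ and the $i$th factor of each denominator is $[i]_{(-1)^{i-1}\zeta^h q}$.
   Context: Here $q$ is an indeterminate, $\zeta\in\mathbb{C}$ is a fixed primitive $r$th root of unity, and $[m]_x:=1+x+\cdots+x^{m-1}$ for an integer $m\ge 0$. $G_{r,n}=\mathbb{Z}_r\wr S_n$ is the group of colored permutations: its elements are $\pi=(\pi_1,\dots,\pi_n)=(\sigma_1^{z_1},\dots,\sigma_n^{z_n})$ with $\sigma=(\sigma_1,\dots,\sigma_n)\in S_n$ (one-line notation) and colors $z_i\in\{0,\dots,r-1\}$. Write $|\pi|=\sigma$ and $\mathrm{col}(\pi)=z_1+\cdots+z_n$ (sum of integers). A colored integer of color $0$ is written without exponent. For $\sigma\in S_n$, $\mathrm{inv}(\sigma)=\#\{i<j:\sigma_i>\sigma_j\}$. The one-dimensional character $\chi_{\epsilon,h}$ ($\epsilon\in\{1,-1\}$) is $\chi_{\epsilon,h}(\pi)=\epsilon^{\mathrm{inv}(|\pi|)}\zeta^{h\cdot\mathrm{col}(\pi)}$. Colored integers are compared in the linear order $$1^{r-1}<\cdots<n^{r-1}<\cdots<1^1<\cdots<n^1<1<\cdots<n.$$ With this order, $\mathrm{maj}_F(\pi)=\sum_{1\le i\le n-1,\ \pi_i>\pi_{i+1}}i$ and $\mathrm{fmaj}(\pi)=r\cdot\mathrm{maj}_F(\pi)+\mathrm{col}(\pi)$. For integers $1\le a\le c\le n$, $H_{r,n}(a:c)$ is the set of $\pi\in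 G_{r,n}$ such that the permutation $|\pi|=(\sigma_1,\dots,\sigma_n)$ contains $(a,a+1,\dots,c)$ as a (not necessarily contiguous) subsequence; the colors are arbitrary. -}

module Defs where

open import Level using (_⊔_)
open import Algebra.Apartness.Bundles using (HeytingField)
open import Algebra.Bundles using (CommutativeRing; Semiring)
open import Algebra.Bundles.Raw using (RawRing)
import Algebra.Apartness.Properties.HeytingCommutativeRing as HeytingProperties
import Algebra.Definitions.RawSemiring as RawSemiringDefinitions
open import Data.Fin.Base as Fin using (Fin; toℕ)
import Data.Fin.Properties as Fin
open import Data.List.Base as List
  using (List; []; _∷_; allFin; applyUpTo; cartesianProduct; cartesianProductWith; filter)
import Data.List.Relation.Binary.Sublist.DecPropositional as DecSublist
open import Data.Nat.Base as ℕ using (ℕ; zero; suc; _<_)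
import Data.Nat.Properties as ℕ
open import Data.Product.Base using (_×_; _,_; proj₁; proj₂; ∃)
open import Data.Sum.Base using (_⊎_)
open import Data.Vec.Base as Vec using (Vec; []; _∷_; count; toList)
open import Data.Vec.Relation.Unary.Unique.Propositional using (Unique)
import Data.Vec.Relation.Unary.AllPairs as AllPairs
open import Data.Bool.Base using (if_then_else_)
open import Function.Base using (_∘_)
open import Relation.Binary.Core using (Rel)
import Relation.Binary.Definitions as B
open import Relation.Binary.PropositionalEquality.Core using (_≡_)
import Relation.Binary.Reasoning.Setoid as SetoidReasoning
open import Relation.Nullary.Decidable using (does; ¬?; _⊎-dec_; _×-dec_)
open import Relation.Unary using (Decidable)

open DecSublist ℕ._≟_ using (_⊆_; _⊆?_)

-- The pair (i , z) is the colored integer (i + 1)ᶻ, since Fin n starts at 0.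
ColoredInt : ℕ → ℕ → Set
ColoredInt r n = Fin n × Fin r

-- 1ʳ⁻¹ ≺ ⋯ ≺ nʳ⁻¹ ≺ ⋯ ≺ 1¹ ≺ ⋯ ≺ n¹ ≺ 1 ≺ ⋯ ≺ n
infix 4 _≺_ _≺?_

_≺_ : ∀ {r n} → Rel (ColoredInt r n) _
(i , z) ≺ (j , w) = (w Fin.< z) ⊎ (z ≡ w × i Fin.< j)

_≺?_ : ∀ {r n} → B.Decidable (_≺_ {r} {n})
(i , z) ≺? (j , w) = (w Fin.<? z) ⊎-dec ((z Fin.≟ w) ×-dec (i Fin.<? j))

ColoredWord : ℕ → ℕ → Set
ColoredWord r n = Vec (ColoredInt r n) n

-- One-line notation of the underlying permutation, with entries in 1, …, n.
∣_∣ : ∀ {r n m} → Vec (ColoredInt r n) m → Vec ℕ m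
∣ π ∣ = Vec.map (suc ∘ toℕ ∘ proj₁) π

-- A word of length n over n letters is a permutation iff its entries are
-- pairwise distinct.
IsColoredPermutation : ∀ {r n} → ColoredWord r n → Set
IsColoredPermutation π = Unique ∣ π ∣

isColoredPermutation? : ∀ {r n} → Decidable (IsColoredPermutation {r} {n})
isColoredPermutation? π = AllPairs.allPairs? (λ x y → ¬? (x ℕ.≟ y)) ∣ π ∣

Contains : ∀ {r n} → ℕ → ℕ → ColoredWord r n → Set
Contains a c π = applyUpTo (a ℕ.+_) (suc c ℕ.∸ a) ⊆ toList ∣ π ∣

contains? : ∀ {r n} a c → Decidable (Contains {r} {n} a c)
contains? a c π = applyUpTo (a ℕ.+_) (suc c ℕ.∸ a) ⊆? toList ∣ π ∣

vectors : ∀ {A : Set} → List A → ∀ m → List (Vec A m)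
vectors as zero    = [] ∷ []
vectors as (suc m) = cartesianProductWith _∷_ as (vectors as m)

-- The finite sets G_{r,n} and H_{r,n}(a : c), as lists without repetition.
G : ∀ r n → List (ColoredWord r n)
G r n = filter isColoredPermutation? (vectors (cartesianProduct (allFin n) (allFin r)) n)

H : ∀ r n → ℕ → ℕ → List (ColoredWord r n)
H r n a c = filter (contains? a c) (G r n)

inv : ∀ {m} → Vec ℕ m → ℕ
inv []      = 0
inv (x ∷ σ) = count (ℕ._<? x) σ ℕ.+ inv σ

col : ∀ {r n m} → Vec (ColoredInt r n) m → ℕ
col π = Vec.sum (Vec.map (toℕ ∘ proj₂) π)

-- The first argument is the position of the first entry of the word.
majFrom : ∀ {r n m} → ℕ → Vec (ColoredInt r n) m → ℕ
majFrom i []          = 0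
majFrom i (x ∷ [])    = 0
majFrom i (x ∷ y ∷ π) = (if does (y ≺? x) then i else 0) ℕ.+ majFrom (suc i) (y ∷ π)

majF : ∀ {r n} → ColoredWord r n → ℕ
majF π = majFrom 1 π

fmaj : ∀ {r n} → ColoredWord r n → ℕ
fmaj {r} π = r ℕ.* majF π ℕ.+ col π

-- 𝕂 stands in for ℂ, of which only the field structure matters; x # y is x ≠ y
-- in its positive form.
module RationalFunctions {c ℓ₁ ℓ₂} (𝕂 : HeytingField c ℓ₁ ℓ₂) where

  private
    module K = HeytingField 𝕂
    open HeytingProperties K.heytingCommutativeRing using (1#0; #-congʳ)

    commutativeRing : CommutativeRing c ℓ₁
    commutativeRing = record { isCommutativeRing = K.isCommutativeRing }

    module KPow = RawSemiringDefinitions (Semiring.rawSemiring (CommutativeRing.semiring commutativeRing))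

  IsPrimitiveRoot : ℕ → K.Carrier → Set (ℓ₁ ⊔ ℓ₂)
  IsPrimitiveRoot r ζ =
    (ζ KPow.^ r) K.≈ K.1# × (∀ j → 0 < j → j < r → (ζ KPow.^ j) K.# K.1#)

  -- The list a₀ ∷ a₁ ∷ ⋯ ∷ [] is a₀ + a₁ q + ⋯; trailing zeros are allowed, so
  -- equality is equality of all coefficients.
  Poly : Set c
  Poly = List K.Carrier

  coeff : Poly → ℕ → K.Carrier
  coeff []      _       = K.0#
  coeff (a ∷ p) zero    = a
  coeff (a ∷ p) (suc i) = coeff p i

  private
    infixl 6 _⊕_
    infixl 7 _⊛_

    _⊕_ : Poly → Poly → Poly
    []      ⊕ p       = p
    (a ∷ p) ⊕ []      = a ∷ p
    (a ∷ p) ⊕ (b ∷ s) = (a K.+ b) ∷ (p ⊕ s)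

    _⊛_ : Poly → Poly → Poly
    []      ⊛ s = []
    (a ∷ p) ⊛ s = List.map (a K.*_) s ⊕ (K.0# ∷ (p ⊛ s))

  polyRawRing : RawRing c ℓ₁
  polyRawRing = record
    { Carrier = Poly
    ; _≈_     = λ p s → ∀ i → coeff p i K.≈ coeff s i
    ; _+_     = _⊕_
    ; _*_     = _⊛_
    ; -_      = List.map (λ a → K.- a)
    ; 0#      = []
    ; 1#      = K.1# ∷ []
    }

  open RawRing polyRawRing public using (_≈_; _+_; _*_; -_; 0#; 1#; rawSemiring)
  open RawSemiringDefinitions rawSemiring public using (_^_; sum; product)

  const : K.Carrier → Poly
  const a = a ∷ []

  q : Poly
  q = K.0# ∷ K.1# ∷ []

  Nonzero : Poly → Set ℓ₂
  Nonzero p = ∃ λ i → coeff p i K.# K.0#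

  -- An element of 𝕂(q); two fractions are equal when they agree after
  -- cross-multiplication.
  record RationalFunction : Set (c ⊔ ℓ₂) where
    constructor fraction
    field
      num         : Poly
      den         : Poly
      den-nonzero : Nonzero den

  open RationalFunction public

  infix  4 _≃_
  infixl 7 _·_

  _≃_ : Rel RationalFunction ℓ₁
  f ≃ g = num f * den g ≈ num g * den f

  fromPoly : Poly → RationalFunction
  fromPoly p = fraction p 1# (0 , 1#0)

  _·_ : RationalFunction → Poly → RationalFunction
  f · p = fraction (num f * p) (den f) (den-nonzero f)

  -- [ m ]⟨ x ⟩ = 1 + x + ⋯ + xᵐ⁻¹
  [_]⟨_⟩ : ℕ → Poly → Poly
  [ m ]⟨ x ⟩ = sum {m} (λ i → x ^ toℕ i)

  -- (-1)ᵉ ζʰ q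
  ±ζq : K.Carrier → ℕ → ℕ → Poly
  ±ζq ζ h e = const ((K.- K.1#) KPow.^ e K.* ζ KPow.^ h) * q

  χ : ∀ {r n} → K.Carrier → K.Carrier → ℕ → ColoredWord r n → K.Carrier
  χ ζ ε h π = ε KPow.^ inv ∣ π ∣ K.* ζ KPow.^ (h ℕ.* col π)

  signedMahonian : ∀ {r n} → K.Carrier → ℕ → List (ColoredWord r n) → Poly
  signedMahonian ζ h πs =
    List.foldr _+_ 0# (List.map (λ π → const (χ ζ (K.- K.1#) h π) * q ^ fmaj π) πs)

  -- For j : Fin n the index i = j + 1 runs over 1, …, n, and i - 1 = toℕ j.
  numerator : K.Carrier → ℕ → ℕ → ℕ → Poly
  numerator ζ h r n = product {n} λ j → [ suc (toℕ j) ℕ.* r ]⟨ ±ζq ζ h (toℕ j) ⟩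

  denominator : K.Carrier → ℕ → ℕ → Poly
  denominator ζ h k = product {k} λ j → [ suc (toℕ j) ]⟨ ±ζq ζ h (toℕ j) ⟩

  private
    module R = CommutativeRing commutativeRing
    open SetoidReasoning R.setoid

    coeff₀ : Poly → K.Carrier
    coeff₀ p = coeff p 0

    coeff₀-+ : ∀ p s → coeff₀ (p + s) R.≈ coeff₀ p R.+ coeff₀ s
    coeff₀-+ []      s       = R.sym (R.+-identityˡ _)
    coeff₀-+ (a ∷ p) []      = R.sym (R.+-identityʳ _)
    coeff₀-+ (a ∷ p) (b ∷ s) = R.refl

    coeff₀-map : ∀ a s → coeff₀ (List.map (a R.*_) s) R.≈ a R.* coeff₀ s
    coeff₀-map a []      = R.sym (R.zeroʳ a)
    coeff₀-map a (b ∷ s) = R.refl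

    coeff₀-* : ∀ p s → coeff₀ (p * s) R.≈ coeff₀ p R.* coeff₀ s
    coeff₀-* []      s = R.sym (R.zeroˡ _)
    coeff₀-* (a ∷ p) s = begin
      coeff₀ (List.map (a R.*_) s + (R.0# ∷ (p * s)))  ≈⟨ coeff₀-+ (List.map (a R.*_) s) _ ⟩
      coeff₀ (List.map (a R.*_) s) R.+ R.0#            ≈⟨ R.+-identityʳ _ ⟩
      coeff₀ (List.map (a R.*_) s)                     ≈⟨ coeff₀-map a s ⟩
      a R.* coeff₀ s                                   ∎

    coeff₀-sum : ∀ m (f : Fin m → Poly) → (∀ i → coeff₀ (f i) R.≈ R.0#) →
                 coeff₀ (sum f) R.≈ R.0#
    coeff₀-sum zero    f f≈0 = R.refl
    coeff₀-sum (suc m) f f≈0 = begin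
      coeff₀ (sum f)                                         ≈⟨ coeff₀-+ (f Fin.zero) _ ⟩
      coeff₀ (f Fin.zero) R.+ coeff₀ (sum (f ∘ Fin.suc))     ≈⟨ R.+-cong (f≈0 Fin.zero) (coeff₀-sum m (f ∘ Fin.suc) (f≈0 ∘ Fin.suc)) ⟩
      R.0# R.+ R.0#                                          ≈⟨ R.+-identityʳ _ ⟩
      R.0#                                                   ∎

    coeff₀-product : ∀ m (f : Fin m → Poly) → (∀ i → coeff₀ (f i) R.≈ R.1#) →
                     coeff₀ (product f) R.≈ R.1#
    coeff₀-product zero    f f≈1 = R.refl
    coeff₀-product (suc m) f f≈1 = begin
      coeff₀ (product f)                                     ≈⟨ coeff₀-* (f Fin.zero) _ ⟩
      coeff₀ (f Fin.zero) R.* coeff₀ (product (f ∘ Fin.suc)) ≈⟨ R.*-cong (f≈1 Fin.zero) (coeff₀-product m (f ∘ Fin.suc) (f≈1 ∘ Fin.suc)) ⟩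
      R.1# R.* R.1#                                          ≈⟨ R.*-identityʳ _ ⟩
      R.1#                                                   ∎

    coeff₀-[] : ∀ m x → coeff₀ x R.≈ R.0# → coeff₀ [ suc m ]⟨ x ⟩ R.≈ R.1#
    coeff₀-[] m x x≈0 = begin
      coeff₀ [ suc m ]⟨ x ⟩                          ≈⟨ coeff₀-+ 1# tail ⟩
      R.1# R.+ coeff₀ tail                           ≈⟨ R.+-congˡ (coeff₀-sum m _ power≈0) ⟩
      R.1# R.+ R.0#                                  ≈⟨ R.+-identityʳ _ ⟩
      R.1#                                           ∎
      where
      tail : Poly
      tail = sum {m} (λ i → x ^ suc (toℕ i))

      power≈0 : ∀ i → coeff₀ (x ^ suc (toℕ i)) R.≈ R.0#
      power≈0 i = R.trans (coeff₀-* x (x ^ toℕ i)) (R.trans (R.*-congʳ x≈0) (R.zeroˡ _))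

    coeff₀-±ζq : ∀ ζ h e → coeff₀ (±ζq ζ h e) R.≈ R.0#
    coeff₀-±ζq ζ h e = R.trans (coeff₀-* (const a) q) (R.zeroʳ a)
      where
      a : K.Carrier
      a = (K.- K.1#) KPow.^ e K.* ζ KPow.^ h

  denominator-nonzero : ∀ ζ h k → Nonzero (denominator ζ h k)
  denominator-nonzero ζ h k = 0 , #-congʳ (R.sym constantTerm) 1#0
    where
    constantTerm : coeff₀ (denominator ζ h k) R.≈ R.1#
    constantTerm = coeff₀-product k _ λ j →
      coeff₀-[] (toℕ j) _ (coeff₀-±ζq ζ h (toℕ j))

  -- [r]_{ζʰq} [2r]_{-ζʰq} ⋯ [nr]_{(-1)ⁿ⁻¹ζʰq} / [1]_{ζʰq} [2]_{-ζʰq} ⋯ [k]_{(-1)ᵏ⁻¹ζʰq}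
  quotient : K.Carrier → ℕ → ℕ → ℕ → ℕ → RationalFunction
  quotient ζ h r n k =
    fraction (numerator ζ h r n) (denominator ζ h k) (denominator-nonzero ζ h k)

{-# OPTIONS --safe #-}

-- Put x = ζʰ q. Since ζʳ = 1, the summand of π is (-1)^inv x^fmaj. As in the theory of P-partitions, the sum
-- over H, divided by the product of the 1 - x^(r i) for i ≤ n, is the sum of ± x^(f(1) + ⋯ + f(n)) over all
-- f : {1, …, n} → ℕ which are weakly decreasing on the block b - k + 1, …, b, where the sign is the parity of
-- #{i < j ∣ f(i) < f(j)}; in particular it no longer depends on r. Exchanging the values at two adjacent
-- labels outside the block cancels everything but the f which agree there, so all but at most one label on
-- either side of the block contribute factors 1 / (1 - x²), and four explicit families of series remain.
-- No infinite sum is needed: F is defined by its closed form, and level≈F verifies the recursion obtained by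
-- splitting off the labels with f = 0. Reading words from right to left leads to the same recursion. The
-- computation takes place in the ring of power series, where the denominators are invertible.
module Submission where

open import Defs
open import Algebra.Apartness.Bundles using (HeytingField)
open import Algebra.Bundles using (CommutativeRing; Semiring)
open import Algebra.Bundles.Raw using (RawRing)
import Algebra.Definitions.RawSemiring as RawSemiringDefinitions
import Algebra.Properties.AbelianGroup as AbelianGroupProperties
import Algebra.Properties.CommutativeSemigroup as CommutativeSemigroupProperties
import Algebra.Properties.CommutativeSemiring.Exp as CommutativeExp
import Algebra.Properties.Monoid.Sum as MonoidSum
import Algebra.Properties.Ring as RingProperties
import Algebra.Properties.Semiring.Exp as Exp
import Algebra.Properties.Semiring.Mult as SemiringMult
import Algebra.Properties.Semiring.Sum as Sum
import Algebra.Solver.Ring as RingSolver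
open import Algebra.Solver.Ring.AlmostCommutativeRing
  using (fromCommutativeRing; _-Raw-AlmostCommutative⟶_; Induced-equivalence)
open import Data.Bool.Base using (Bool; true; false; not; _∧_; _∨_; if_then_else_)
open import Data.Empty using (⊥-elim)
open import Data.Fin.Base as Fin using (Fin; toℕ)
import Data.Fin.Properties as Fin
open import Data.List.Base as List
  using (List; []; _∷_; _++_; map; filter; allFin; applyUpTo; tabulate; cartesianProduct; cartesianProductWith)
import Data.List.Relation.Binary.Sublist.DecPropositional as DecSublist
open import Data.Maybe.Base using (just; nothing)
open import Data.Nat.Base as ℕ using (ℕ; zero; suc; _≤_; _<_; _∸_; _%_; z≤n; s≤s)
import Data.Nat.Properties as ℕ
open import Data.Nat.Tactic.RingSolver using (solve-∀)
open import Data.Product.Base using (_×_; _,_; proj₁; proj₂; ∃; ∃₂)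
open import Data.Product.Properties using (≡-dec)
open import Data.Vec.Base as Vec using (Vec; []; _∷_; count; toList)
open import Data.Vec.Relation.Unary.All using (All; []; _∷_)
open import Data.Vec.Relation.Unary.AllPairs as AllPairs using ([]; _∷_)
open import Data.Vec.Relation.Unary.Any using (Any; here; there)
open import Data.Vec.Relation.Unary.Unique.Propositional using (Unique)
open import Function.Base using (_∘_; id)
open import Function.Bundles using (mk⇔)
open import Relation.Binary.Definitions using (WeaklyDecidable; tri<; tri≈; tri>)
open import Relation.Binary.PropositionalEquality using (module ≡-Reasoning)
open import Relation.Binary.PropositionalEquality.Core as ≡ using (_≡_; _≢_)
import Relation.Binary.Reasoning.Setoid as SetoidReasoning
open import Relation.Nullary.Decidable using (Dec; does; yes; no; ¬?; dec-true; dec-false; does-⇔)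
open import Relation.Nullary.Negation.Core using (¬_; contradiction)
open import Relation.Unary using (Decidable)

open DecSublist ℕ._≟_ using (_⊆_; _⊆?_; []; _∷_; _∷ʳ_; ⊆-trans; minimum)

-- On the side of words the obstacle is that a descent depends on the letter read last and on its
-- color. A partial word therefore carries a pointer to that letter, and `Claim` says that, up to
-- known factors, the sum over its completions is a partial sum of the generating function, cut off
-- at the pointer. Summing over the next letter by increasing label, once per color, makes such
-- partial sums telescope. A descent multiplies by `t ^ r`, the same power of `t` that one round
-- through all `r` colors produces, so the rounds fit together and leave only a factor `1 - t ^ r`,
-- which goes into `Y`. The recursions of `T`, `T′` and `V` are the recursion of `level`, solved for
-- the term with the larger block and divided by a common `D`. The signs inside the q-integers
-- disappear because (-1)^(j (j + 1)) = 1; multiplied by `Z`, a product of signed q-integers becomes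
-- a product of factors 1 - x^i, and the three identities reduce to evaluating `Z` times `F`.
-- Passing to series loses nothing, since equality of polynomials is equality of all coefficients.

-- Ring solving with integer coefficients

-- The pair (a , b) stands for the integer a - b; one of the entries is kept zero.
cancel : ℕ → ℕ → ℕ × ℕ
cancel (suc a) (suc b) = cancel a b
cancel a       b       = a , b

differences : RawRing _ _
differences = record
  { Carrier = ℕ × ℕ
  ; _≈_     = _≡_
  ; _+_     = λ (a , b) (c , d) → cancel (a ℕ.+ c) (b ℕ.+ d)
  ; _*_     = λ (a , b) (c , d) → cancel (a ℕ.* c ℕ.+ b ℕ.* d) (a ℕ.* d ℕ.+ b ℕ.* c)
  ; -_      = λ (a , b) → b , a
  ; 0#      = 0 , 0
  ; 1#      = 1 , 0
  }

-- Normalization has to recognize equal coefficients, which cannot be decided in an abstract ring.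
-- Integers serve as coefficients instead; as `cancel` keeps the pairs reduced, equality of integers
-- is equality of pairs.
module IntegerSolver {c ℓ} (R : CommutativeRing c ℓ) where

  open CommutativeRing R
  open RawRing differences using () renaming (_+_ to _⊞_; _*_ to _⊠_; -_ to ⊟_)
  open SetoidReasoning setoid
  open SemiringMult semiring renaming (_×_ to _×′_)
  open RingProperties ring
  open AbelianGroupProperties +-abelianGroup using (⁻¹-∙-comm)
  open CommutativeSemigroupProperties +-commutativeSemigroup using (interchange)

  private
    ι : ℕ → Carrier
    ι n = n ×′ 1#

    δ : ℕ × ℕ → Carrier
    δ (a , b) = ι a + - ι b

    -- 0 and 1 are singled out so that solver goals may mention 0# and 1#.
    ⟦_⟧ᵈ : ℕ × ℕ → Carrier
    ⟦ 0 , 0 ⟧ᵈ = 0#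
    ⟦ 1 , 0 ⟧ᵈ = 1#
    ⟦ d     ⟧ᵈ = δ d

    ⟦⟧≈δ : ∀ d → ⟦ d ⟧ᵈ ≈ δ d
    ⟦⟧≈δ (0           , 0)     = sym (-‿inverseʳ _)
    ⟦⟧≈δ (1           , 0)     = sym (trans (+-cong (+-identityʳ _) -0#≈0#) (+-identityʳ _))
    ⟦⟧≈δ (suc (suc _) , 0)     = refl
    ⟦⟧≈δ (0           , suc _) = refl
    ⟦⟧≈δ (1           , suc _) = refl
    ⟦⟧≈δ (suc (suc _) , suc _) = refl

    difference-+ : ∀ w x y z → (w + y) + - (x + z) ≈ (w + - x) + (y + - z)
    difference-+ w x y z = trans (+-congˡ (sym (⁻¹-∙-comm x z))) (interchange w y (- x) (- z))

    difference-* : ∀ w x y z →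
      (w * y + x * z) + - (w * z + x * y) ≈ (w + - x) * (y + - z)
    difference-* w x y z = sym (begin
      (w + - x) * (y + - z)                              ≈⟨ distribʳ _ w (- x) ⟩
      w * (y + - z) + - x * (y + - z)                    ≈⟨ +-cong (distribˡ w y (- z)) (sym (-‿distribˡ-* x _)) ⟩
      (w * y + w * - z) + - (x * (y + - z))
        ≈⟨ +-cong (+-congˡ (sym (-‿distribʳ-* w z))) (-‿cong (distribˡ x y (- z))) ⟩
      (w * y + - (w * z)) + - (x * y + x * - z)          ≈⟨ +-congˡ (-‿cong (+-congˡ (sym (-‿distribʳ-* x z)))) ⟩
      (w * y + - (w * z)) + - (x * y + - (x * z))        ≈⟨ +-congˡ (-‿cong (+-comm _ _)) ⟩
      (w * y + - (w * z)) + - (- (x * z) + x * y)        ≈⟨ +-congˡ (sym (⁻¹-∙-comm _ _)) ⟩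
      (w * y + - (w * z)) + (- - (x * z) + - (x * y))    ≈⟨ +-congˡ (+-congʳ (-‿involutive _)) ⟩
      (w * y + - (w * z)) + (x * z + - (x * y))          ≈⟨ sym (difference-+ _ _ _ _) ⟩
      (w * y + x * z) + - (w * z + x * y)                ∎)

    δ-cancel : ∀ a b → δ (cancel a b) ≈ δ (a , b)
    δ-cancel (suc a) (suc b) = begin
      δ (cancel a b)                     ≈⟨ δ-cancel a b ⟩
      δ (a , b)                          ≈⟨ +-identityˡ _ ⟨
      0# + δ (a , b)                     ≈⟨ +-congʳ (-‿inverseʳ 1#) ⟨
      (1# + - 1#) + (ι a + - ι b)        ≈⟨ difference-+ _ _ _ _ ⟨
      (1# + ι a) + - (1# + ι b)          ∎
    δ-cancel (suc a) zero    = refl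
    δ-cancel zero    (suc b) = refl
    δ-cancel zero    zero    = refl

    homomorphism : differences -Raw-AlmostCommutative⟶ fromCommutativeRing R
    homomorphism = record
      { ⟦_⟧    = ⟦_⟧ᵈ
      ; +-homo = λ d e → trans (⟦⟧≈δ (d ⊞ e)) (trans (δ-+ d e) (sym (+-cong (⟦⟧≈δ d) (⟦⟧≈δ e))))
      ; *-homo = λ d e → trans (⟦⟧≈δ (d ⊠ e)) (trans (δ-* d e) (sym (*-cong (⟦⟧≈δ d) (⟦⟧≈δ e))))
      ; -‿homo = λ d → trans (⟦⟧≈δ (⊟ d)) (trans (δ-‿ d) (sym (-‿cong (⟦⟧≈δ d))))
      ; 0-homo = refl
      ; 1-homo = refl
      }
      where
      ι-+* : ∀ a c b d → ι (a ℕ.* c ℕ.+ b ℕ.* d) ≈ ι a * ι c + ι b * ι d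
      ι-+* a c b d = trans (×-homo-+ 1# (a ℕ.* c) (b ℕ.* d)) (+-cong (×1-homo-* a c) (×1-homo-* b d))

      δ-+ : ∀ d e → δ (d ⊞ e) ≈ δ d + δ e
      δ-+ (a , b) (c , d) =
        trans (δ-cancel (a ℕ.+ c) (b ℕ.+ d))
          (trans (+-cong (×-homo-+ 1# a c) (-‿cong (×-homo-+ 1# b d))) (difference-+ _ _ _ _))

      δ-* : ∀ d e → δ (d ⊠ e) ≈ δ d * δ e
      δ-* (a , b) (c , d) =
        trans (δ-cancel (a ℕ.* c ℕ.+ b ℕ.* d) (a ℕ.* d ℕ.+ b ℕ.* c))
          (trans (+-cong (ι-+* a c b d) (-‿cong (ι-+* a d b c))) (difference-* _ _ _ _))

      δ-‿ : ∀ d → δ (⊟ d) ≈ - δ d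
      δ-‿ (a , b) =
        trans (+-comm _ _) (trans (+-congˡ (sym (-‿involutive _))) (⁻¹-∙-comm _ _))

    weaklyDecidable : WeaklyDecidable (Induced-equivalence homomorphism)
    weaklyDecidable d e with ≡-dec ℕ._≟_ ℕ._≟_ d e
    ... | no  _  = nothing
    ... | yes eq = just (reflexive (≡.cong ⟦_⟧ᵈ eq))

  open RingSolver differences (fromCommutativeRing R) homomorphism weaklyDecidable public
    using (solve; _:=_; _:+_; _:*_; :-_; _:-_; con)
    renaming (Polynomial to Expr)

  :0 :1 : ∀ {n} → Expr n
  :0 = con (0 , 0)
  :1 = con (1 , 0)

-- Signs, and the generating function `F` with its recursion

module Signs {c ℓ} (A : CommutativeRing c ℓ) where

  open CommutativeRing A
  open IntegerSolver A
  open SetoidReasoning setoid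
  open RawSemiringDefinitions (Semiring.rawSemiring semiring) using (_^_)

  sg : ℕ → Carrier
  sg n = (- 1#) ^ n

  sg² : ∀ n → sg n * sg n ≈ 1#
  sg² zero    = *-identityˡ 1#
  sg² (suc n) = begin
    (- 1# * sg n) * (- 1# * sg n)  ≈⟨ solve 1 (λ s → (:- :1 :* s) :* (:- :1 :* s) := s :* s) refl (sg n) ⟩
    sg n * sg n                    ≈⟨ sg² n ⟩
    1#                             ∎

  sg-+ : ∀ m n → sg (m ℕ.+ n) ≈ sg m * sg n
  sg-+ zero    n = sym (*-identityˡ _)
  sg-+ (suc m) n = trans (*-congˡ (sg-+ m n)) (sym (*-assoc _ _ _))

-- v j is the inverse of 1 - xʲ⁺¹.
Reciprocals : ∀ {c ℓ} (A : CommutativeRing c ℓ) → CommutativeRing.Carrier A → (ℕ → CommutativeRing.Carrier A) → Set ℓ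
Reciprocals A x v = ∀ j → (1# - x ^ suc j) * v j ≈ 1#
  where
  open CommutativeRing A
  open RawSemiringDefinitions (Semiring.rawSemiring semiring) using (_^_)

module LevelSum {c ℓ} (A : CommutativeRing c ℓ)
  (x : CommutativeRing.Carrier A) (v : ℕ → CommutativeRing.Carrier A) (v-inverse : Reciprocals A x v) where

  open CommutativeRing A hiding (zero)
  open RawSemiringDefinitions (Semiring.rawSemiring semiring) using (_^_)
  open IntegerSolver A
  open Signs A
  open SetoidReasoning setoid

  -- D k is 1 / (1 - x) ⋯ (1 - xᵏ); the other three are the numerators of the basic cases of F over D.
  D T T′ V : ℕ → Carrier
  D zero     = 1#
  D (suc k)  = v k * D k
  T zero     = 1#
  T (suc k)  = T k + sg (suc k) * x ^ suc k
  T′ zero    = 1#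
  T′ (suc k) = 1# + 1# - x ^ suc k - T′ k
  V zero     = 1# - x
  V (suc k)  = T (suc k) + (1# - x ^ suc (suc k)) * T k - V k - sg (suc k) * x ^ suc (suc k) * T′ (suc k)

  -- The generating function Σ ± x^(Σ f) over all f from a set of labels to ℕ which are weakly decreasing on
  -- a block of k consecutive labels; there are a labels above and b labels below the block, and the sign is
  -- the parity of #{i < j ∣ f i < f j}. Swapping the values of two adjacent labels outside the block cancels
  -- all f with distinct values there, hence the factors v 1 = 1 / (1 - x²).
  F : ℕ → ℕ → ℕ → Carrier
  F 0             k 0             = D k
  F 0             k 1             = D (suc k) * T k
  F 1             k 0             = D (suc k) * T′ k
  F 1             k 1             = D (suc (suc k)) * V k
  F 0             k (suc (suc b)) = v 1 * F 0 k b
  F 1             k (suc (suc b)) = v 1 * F 1 k b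
  F (suc (suc a)) k b             = v 1 * F a k b

  -- F, with the labels f sends to 0 being chosen from the largest label downwards. Above, in and below the
  -- block, a, j and b labels are already known to have f > 0, and r, k and l labels are undecided.
  level : (a r j k b l : ℕ) → Carrier
  level a (suc r) j       k       b l       =
    level (suc a) r j k b l + sg (a ℕ.+ b ℕ.+ j) * level a r j k b l
  level a zero    zero    (suc k) b l       =
    level a 0 1 k b l + sg (a ℕ.+ b ℕ.+ 0) * level a 0 0 k b l
  level a zero    (suc j) (suc k) b l       = level a 0 (suc (suc j)) k b l
  level a zero    j       zero    b (suc l) =
    level a 0 j 0 (suc b) l + sg (a ℕ.+ b ℕ.+ j) * level a 0 j 0 b l
  level a zero    j       zero    b zero    = x ^ (a ℕ.+ b ℕ.+ j) * F a j b

  F-b : ∀ a k b → F a k (suc (suc b)) ≈ v 1 * F a k b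
  F-b 0             k b = refl
  F-b 1             k b = refl
  F-b (suc (suc a)) k b = *-congˡ (F-b a k b)

  private
    -- The common step of the inductions on `level`: a scalar passes through a branching when both
    -- branches scale by it and the sign does not change.
    factor : ∀ s A B c A′ B′ → A′ ≈ c * A → B′ ≈ c * B → ∀ s′ → s′ ≈ s → A′ + s′ * B′ ≈ c * (A + s * B)
    factor s A B c A′ B′ p q s′ e = begin
      A′ + s′ * B′           ≈⟨ +-cong p (*-cong e q) ⟩
      c * A + s * (c * B)    ≈⟨ solve 4 (λ s A B c → c :* A :+ s :* (c :* B) := c :* (A :+ s :* B)) refl s A B c ⟩
      c * (A + s * B)        ∎

    sg-2 : ∀ n → sg (suc (suc n)) ≈ sg n
    sg-2 n = solve 1 (λ s → :- :1 :* (:- :1 :* s) := s) refl (sg n)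

    pull² : ∀ X f → x * (x * X) * (v 1 * f) ≈ x * x * v 1 * (X * f)
    pull² X f = solve 4 (λ x X w f → (x :* (x :* X)) :* (w :* f) := x :* x :* w :* (X :* f)) refl x X (v 1) f

    sg-suc : ∀ a b j → sg (a ℕ.+ suc b ℕ.+ j) ≈ - 1# * sg (a ℕ.+ b ℕ.+ j)
    sg-suc a b j = reflexive (≡.cong (λ t → sg (t ℕ.+ j)) (ℕ.+-suc a b))

    sg-b : ∀ a b j → sg (a ℕ.+ suc (suc b) ℕ.+ j) ≈ sg (a ℕ.+ b ℕ.+ j)
    sg-b a b j = trans (reflexive (≡.cong (λ t → sg (t ℕ.+ j))
        (≡.trans (ℕ.+-suc a (suc b)) (≡.cong suc (ℕ.+-suc a b))))) (sg-2 (a ℕ.+ b ℕ.+ j))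

    x-b : ∀ a b j → x ^ (a ℕ.+ suc (suc b) ℕ.+ j) ≈ x * (x * x ^ (a ℕ.+ b ℕ.+ j))
    x-b a b j = reflexive (≡.cong (λ t → x ^ (t ℕ.+ j)) (≡.trans (ℕ.+-suc a (suc b)) (≡.cong suc (ℕ.+-suc a b))))

  -- Two more positive labels above the block change no sign parity. At the end of the recursion
  -- they contribute `x * x` to the power and `v 1` through the clause of `F`.
  level-a : ∀ a r j k b l → level (suc (suc a)) r j k b l ≈ x * x * v 1 * level a r j k b l
  level-a a (suc r) j k b l =
    factor _ _ _ _ _ _ (level-a (suc a) r j k b l) (level-a a r j k b l) _ (sg-2 (a ℕ.+ b ℕ.+ j))
  level-a a zero zero (suc k) b l =
    factor _ _ _ _ _ _ (level-a a 0 1 k b l) (level-a a 0 0 k b l) _ (sg-2 (a ℕ.+ b ℕ.+ 0))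
  level-a a zero (suc j) (suc k) b l = level-a a 0 (suc (suc j)) k b l
  level-a a zero zero zero b (suc l) =
    factor _ _ _ _ _ _ (level-a a 0 0 0 (suc b) l) (level-a a 0 0 0 b l) _ (sg-2 (a ℕ.+ b ℕ.+ 0))
  level-a a zero (suc j) zero b (suc l) =
    factor _ _ _ _ _ _ (level-a a 0 (suc j) 0 (suc b) l) (level-a a 0 (suc j) 0 b l) _ (sg-2 (a ℕ.+ b ℕ.+ suc j))
  level-a a zero zero zero b zero =
    pull² (x ^ (a ℕ.+ b ℕ.+ 0)) (F a 0 b)
  level-a a zero (suc j) zero b zero =
    pull² (x ^ (a ℕ.+ b ℕ.+ suc j)) (F a (suc j) b)

  level-b : ∀ a j b l → level a 0 j 0 (suc (suc b)) l ≈ x * x * v 1 * level a 0 j 0 b l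
  level-b a zero b (suc l) =
    factor _ _ _ _ _ _ (level-b a 0 (suc b) l) (level-b a 0 b l) _ (sg-b a b 0)
  level-b a (suc j) b (suc l) =
    factor _ _ _ _ _ _ (level-b a (suc j) (suc b) l) (level-b a (suc j) b l) _ (sg-b a b (suc j))
  level-b a zero b zero =
    trans (*-cong (x-b a b 0) (F-b a 0 b)) (pull² (x ^ (a ℕ.+ b ℕ.+ 0)) (F a 0 b))
  level-b a (suc j) b zero =
    trans (*-cong (x-b a b (suc j)) (F-b a (suc j) b)) (pull² (x ^ (a ℕ.+ b ℕ.+ suc j)) (F a (suc j) b))

  private
    κ-step : 1# + x * x * v 1 ≈ v 1
    κ-step = begin
      1# + x * x * v 1                             ≈⟨ +-congʳ (v-inverse 1) ⟨
      (1# - x * (x * 1#)) * v 1 + x * x * v 1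
        ≈⟨ solve 2 (λ x w → (:1 :- x :* (x :* :1)) :* w :+ x :* x :* w := w) refl x (v 1) ⟩
      v 1                                          ∎

    -- Two adjacent labels outside the block: `A` has both positive, `C` both zero, and the two
    -- mixed cases give `B` with opposite signs and cancel. The rest is 1 + x² / (1 - x²) = 1 / (1 -
    -- x²).
    pair : ∀ s A B C → s * s ≈ 1# → A ≈ x * x * v 1 * C →
           (A + - 1# * s * B) + s * (B + s * C) ≈ v 1 * C
    pair s A B C s² p = begin
      (A + - 1# * s * B) + s * (B + s * C)
        ≈⟨ solve 4 (λ s A B C → (A :+ :- :1 :* s :* B) :+ s :* (B :+ s :* C) := A :+ s :* s :* C) refl s A B C ⟩
      A + s * s * C                         ≈⟨ +-cong p (*-congʳ s²) ⟩
      x * x * v 1 * C + 1# * C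
        ≈⟨ solve 3 (λ w C o → w :* C :+ o :* C := (o :+ w) :* C) refl (x * x * v 1) C 1# ⟩
      (1# + x * x * v 1) * C                ≈⟨ *-congʳ κ-step ⟩
      v 1 * C                               ∎

  level-r : ∀ a r j k b l → level a (suc (suc r)) j k b l ≈ v 1 * level a r j k b l
  level-r a r j k b l = pair (sg (a ℕ.+ b ℕ.+ j)) _ _ _ (sg² (a ℕ.+ b ℕ.+ j)) (level-a a r j k b l)

  level-l : ∀ a r j k b l → level a r j k b (suc (suc l)) ≈ v 1 * level a r j k b l
  level-l a (suc r) j k b l =
    factor _ _ _ _ _ _ (level-l (suc a) r j k b l) (level-l a r j k b l) _ refl
  level-l a zero zero (suc k) b l =
    factor _ _ _ _ _ _ (level-l a 0 1 k b l) (level-l a 0 0 k b l) _ refl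
  level-l a zero (suc j) (suc k) b l = level-l a 0 (suc (suc j)) k b l
  level-l a zero zero zero b l =
    trans (+-congʳ (+-congˡ (*-congʳ (sg-suc a b 0))))
        (pair (sg (a ℕ.+ b ℕ.+ 0)) _ _ _ (sg² (a ℕ.+ b ℕ.+ 0)) (level-b a 0 b l))
  level-l a zero (suc j) zero b l =
    trans (+-congʳ (+-congˡ (*-congʳ (sg-suc a b (suc j)))))
        (pair (sg (a ℕ.+ b ℕ.+ suc j)) _ _ _ (sg² (a ℕ.+ b ℕ.+ suc j)) (level-b a (suc j) b l))

  -- Once a label of the block is positive, monotonicity forces all smaller labels of the block to
  -- be positive, so there is no branching.
  level-block : ∀ a j k b l → level a 0 (suc j) k b l ≡ level a 0 (k ℕ.+ suc j) 0 b l
  level-block a j zero    b l = ≡.refl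
  level-block a j (suc k) b l =
    ≡.trans (level-block a (suc j) k b l) (≡.cong (λ t → level a 0 t 0 b l) (ℕ.+-suc k (suc j)))

  level-block₁ : ∀ a k b l → level a 0 1 k b l ≡ level a 0 (suc k) 0 b l
  level-block₁ a k b l = ≡.trans (level-block a 0 k b l) (≡.cong (λ t → level a 0 t 0 b l) (ℕ.+-comm k 1))

  D-step : ∀ k → D k ≈ (1# - x ^ suc k) * D (suc k)
  D-step k = begin
    D k                                ≈⟨ *-identityˡ _ ⟨
    1# * D k                           ≈⟨ *-congʳ (v-inverse k) ⟨
    (1# - x ^ suc k) * v k * D k       ≈⟨ *-assoc _ _ _ ⟩
    (1# - x ^ suc k) * (v k * D k)     ∎

  private
    -- The base cases are inductions on the size of the block. If its largest label is positive, the
    -- whole block is, and `F` returns for the same block, multiplied by powers of `x`; if it is 0,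
    -- the block gets shorter. Rewriting every `D` by the one of largest index leaves the polynomial
    -- recursions of `T`, `T′` and `V`.
    base₀₀ : ∀ k → level 0 0 0 k 0 0 ≈ D k
    base₀₀ zero    = *-identityˡ 1#
    base₀₀ (suc k) = begin
      level 0 0 1 k 0 0 + 1# * level 0 0 0 k 0 0
        ≈⟨ +-cong (reflexive (level-block₁ 0 k 0 0)) (*-congˡ (trans (base₀₀ k) (D-step k))) ⟩
      X * D (suc k) + 1# * ((1# - X) * D (suc k))
        ≈⟨ solve 2 (λ X D → X :* D :+ :1 :* ((:1 :- X) :* D) := D) refl X (D (suc k)) ⟩
      D (suc k) ∎
      where X = x ^ suc k

    base₀₁ : ∀ k → level 0 0 0 k 0 1 ≈ D (suc k) * T k
    base₀₁ zero    = begin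
      x ^ 1 * (D 1 * 1#) + 1# * (1# * 1#)           ≈⟨ +-congˡ (*-congˡ (*-congˡ (D-step 0))) ⟩
      x ^ 1 * (D 1 * 1#) + 1# * (1# * ((1# - x ^ 1) * D 1))
        ≈⟨ solve 2 (λ X D → X :* (D :* :1) :+ :1 :* (:1 :* ((:1 :- X) :* D)) := D :* :1) refl (x ^ 1) (D 1) ⟩
      D 1 * 1# ∎
    base₀₁ (suc k) = begin
      level 0 0 1 k 0 1 + 1# * level 0 0 0 k 0 1
        ≈⟨ +-cong (reflexive (level-block₁ 0 k 0 1)) (*-congˡ (base₀₁ k)) ⟩
      (x * X * (D (suc (suc k)) * (T k + s * X)) + s * (X * D (suc k))) + 1# * (D (suc k) * T k)
        ≈⟨ +-cong (+-congˡ (*-congˡ (*-congˡ (D-step (suc k))))) (*-congˡ (*-congʳ (D-step (suc k)))) ⟩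
      (x * X * (D₂ * (T k + s * X)) + s * (X * ((1# - x * X) * D₂))) + 1# * (((1# - x * X) * D₂) * T k)
        ≈⟨ solve 5 (λ x X D t s → (x :* X :* (D :* (t :+ s :* X)) :+ s :* (X :* ((:1 :- x :* X) :* D))) :+ :1 :*
            (((:1 :- x :* X) :* D) :* t) := D :* (t :+ s :* X)) refl x X D₂ (T k) s ⟩
      D₂ * (T k + s * X) ∎
      where
      X = x ^ suc k
      s = sg (suc k)
      D₂ = D (suc (suc k))

    -- The one label above the block is already known to be positive, so the share in which it is 0,
    -- namely `D k`, is taken off; `up` adds it back. The same holds for `base₁₁` with
    -- `D (suc k) * T k`.
    base₁₀ : ∀ k → level 1 0 0 k 0 0 ≈ D (suc k) * T′ k - D k
    base₁₀ zero    = begin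
      x ^ 1 * (D 1 * 1#)
        ≈⟨ solve 2 (λ X D → X :* (D :* :1) := D :* :1 :- (:1 :- X) :* D) refl (x ^ 1) (D 1) ⟩
      D 1 * 1# - (1# - x ^ 1) * D 1  ≈⟨ +-congˡ (-‿cong (D-step 0)) ⟨
      D 1 * 1# - 1#                  ∎
    base₁₀ (suc k) = begin
      level 1 0 1 k 0 0 + - 1# * 1# * level 1 0 0 k 0 0
        ≈⟨ +-cong (reflexive (level-block₁ 1 k 0 0)) (*-congˡ (base₁₀ k)) ⟩
      x * X * (D₂ * T₁) + - 1# * 1# * (D (suc k) * T′ k - D k)
        ≈⟨ +-congˡ (*-congˡ (+-cong (*-congʳ (D-step (suc k))) (-‿cong D₀))) ⟩
      x * X * (D₂ * T₁) + - 1# * 1# * (((1# - x * X) * D₂) * T′ k - (1# - X) * ((1# - x * X) * D₂))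
        ≈⟨ solve 4 (λ x X D t → x :* X :* (D :* (:1 :+ :1 :- X :- t)) :+ :- :1 :* :1 :*
            (((:1 :- x :* X) :* D) :* t :- (:1 :- X) :* ((:1 :- x :* X) :* D))
             := D :* (:1 :+ :1 :- X :- t) :- (:1 :- x :* X) :* D) refl x X D₂ (T′ k) ⟩
      D₂ * T₁ - (1# - x * X) * D₂
        ≈⟨ +-congˡ (-‿cong (D-step (suc k))) ⟨
      D₂ * T₁ - D (suc k) ∎
      where
      X = x ^ suc k
      D₂ = D (suc (suc k))
      T₁ = T′ (suc k)
      D₀ : D k ≈ (1# - X) * ((1# - x * X) * D₂)
      D₀ = trans (D-step k) (*-congˡ (D-step (suc k)))

    base₁₁ : ∀ k → level 1 0 0 k 0 1 ≈ D (suc (suc k)) * V k - D (suc k) * T k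
    base₁₁ zero    = begin
      x ^ 2 * (D 2 * (1# - x)) + - 1# * 1# * (x ^ 1 * (D 1 * 1#))
        ≈⟨ +-congˡ (*-congˡ (*-congˡ (*-congʳ (D-step 1)))) ⟩
      x ^ 2 * (D 2 * (1# - x)) + - 1# * 1# * (x ^ 1 * (((1# - x ^ 2) * D 2) * 1#))
        ≈⟨ solve 2 (λ x D → (x :* (x :* :1)) :* (D :* (:1 :- x)) :+ :- :1 :* :1 :*
            ((x :* :1) :* (((:1 :- (x :* (x :* :1))) :* D) :* :1))
             := D :* (:1 :- x) :- (:1 :- (x :* (x :* :1))) :* D :* :1) refl x (D 2) ⟩
      D 2 * (1# - x) - ((1# - x ^ 2) * D 2) * 1#
        ≈⟨ +-congˡ (-‿cong (*-congʳ (D-step 1))) ⟨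
      D 2 * (1# - x) - D 1 * 1# ∎
    base₁₁ (suc k) = begin
      level 1 0 1 k 0 1 + - 1# * 1# * level 1 0 0 k 0 1
        ≈⟨ +-cong (reflexive (level-block₁ 1 k 0 1)) (*-congˡ (base₁₁ k)) ⟩
      (x * Y * (D₃ * V₁) + - 1# * s * (Y * (D₂ * t′))) + - 1# * 1# * (D₂ * V k - D (suc k) * T k)
        ≈⟨ +-cong (+-congˡ (*-congˡ (*-congˡ (*-congʳ (D-step (suc (suc k)))))))
             (*-congˡ (+-cong (*-congʳ (D-step (suc (suc k)))) (-‿cong (*-congʳ D₁)))) ⟩
      (x * Y * (D₃ * V₁) + - 1# * s * (Y * (E * t′))) + - 1# * 1# * (E * V k - ((1# - Y) * E) * T k)
        ≈⟨ solve 8 (λ x Y D t₁ t t′ w s →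
              let v₁ = t₁ :+ (:1 :- Y) :* t :- w :- s :* Y :* t′
                  e  = (:1 :- x :* Y) :* D in
              (x :* Y :* (D :* v₁) :+ :- :1 :* s :* (Y :* (e :* t′))) :+ :- :1 :* :1 :*
                  (e :* w :- ((:1 :- Y) :* e) :* t)
              := D :* v₁ :- e :* t₁) refl x Y D₃ (T (suc k)) (T k) t′ (V k) s ⟩
      D₃ * V₁ - E * T (suc k)
        ≈⟨ +-congˡ (-‿cong (*-congʳ (D-step (suc (suc k))))) ⟨
      D₃ * V₁ - D₂ * T (suc k) ∎
      where
      Y = x ^ suc (suc k)
      s = sg (suc k)
      D₃ = D (suc (suc (suc k)))
      D₂ = D (suc (suc k))
      V₁ = V (suc k)
      t′ = T′ (suc k)
      E = (1# - x * Y) * D₃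
      D₁ : D (suc k) ≈ (1# - Y) * E
      D₁ = trans (D-step (suc k)) (*-congˡ (D-step (suc (suc k))))

    up : ∀ A B C s → A ≈ B - C → s ≈ C → A + 1# * s ≈ B
    up A B C s p e = begin
      A + 1# * s      ≈⟨ +-cong p (*-congˡ e) ⟩
      B - C + 1# * C  ≈⟨ solve 2 (λ B C → B :- C :+ :1 :* C := B) refl B C ⟩
      B               ∎

  level≈F : ∀ r k l → level 0 r 0 k 0 l ≈ F r k l
  level≈F (suc (suc r)) k l             = trans (level-r 0 r 0 k 0 l) (*-congˡ (level≈F r k l))
  level≈F 0             k (suc (suc l)) = trans (level-l 0 0 0 k 0 l) (*-congˡ (level≈F 0 k l))
  level≈F 1             k (suc (suc l)) = trans (level-l 0 1 0 k 0 l) (*-congˡ (level≈F 1 k l))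
  level≈F 0             k 0             = base₀₀ k
  level≈F 0             k 1             = base₀₁ k
  level≈F 1             k 0             = up _ _ _ _ (base₁₀ k) (base₀₀ k)
  level≈F 1             k 1             = up _ _ _ _ (base₁₁ k) (base₀₁ k)

-- Parity, geometric sums and the cancellation of signs

mutual
  data Even : ℕ → Set where
    zero : Even 0
    suc  : ∀ {n} → Odd n → Even (suc n)

  data Odd : ℕ → Set where
    suc : ∀ {n} → Even n → Odd (suc n)

%2≡0⇒even : ∀ n → n % 2 ≡ 0 → Even n
%2≡0⇒even 0             _  = zero
%2≡0⇒even (suc (suc n)) eq = suc (suc (%2≡0⇒even n eq))

%2≡1⇒odd : ∀ n → n % 2 ≡ 1 → Odd n
%2≡1⇒odd 1             _  = suc zero
%2≡1⇒odd (suc (suc n)) eq = suc (suc (%2≡1⇒odd n eq))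

module GeometricSums {c ℓ} (A : CommutativeRing c ℓ) where

  open CommutativeRing A hiding (zero)
  open IntegerSolver A
  open Signs A
  open SetoidReasoning setoid
  open RawSemiringDefinitions (Semiring.rawSemiring semiring) using (_^_; sum; product)
  open Exp semiring using (^-congˡ; ^-assocʳ)
  open CommutativeExp commutativeSemiring using (^-distrib-*)

  sg-even : ∀ {n} → Even n → sg n ≈ 1#
  sg-odd  : ∀ {n} → Odd n → sg n ≈ - 1#
  sg-even zero    = refl
  sg-even (suc o) = trans (*-congˡ (sg-odd o)) (solve 0 (:- :1 :* :- :1 := :1) refl)
  sg-odd  (suc e) = trans (*-congˡ (sg-even e)) (*-identityʳ _)

  -- The exponent j (j + 1) is a product of consecutive numbers, hence even. This is why the base
  -- (-1)^j x of the q-integer [(j + 1) m] leaves an unsigned 1 - x^((j + 1) m) in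
  -- `signed-geo-closed`.
  sg^suc : ∀ j → sg j ^ suc j ≈ 1#
  sg^suc j = trans (^-assocʳ (- 1#) j (suc j)) (consecutive j)
    where
    consecutive : ∀ j → sg (j ℕ.* suc j) ≈ 1#
    consecutive zero    = refl
    consecutive (suc j) = begin
      sg (suc j ℕ.* suc (suc j))               ≡⟨ ≡.cong sg (expand j) ⟩
      sg (j ℕ.* suc j ℕ.+ (suc j ℕ.+ suc j))   ≈⟨ sg-+ (j ℕ.* suc j) _ ⟩
      sg (j ℕ.* suc j) * sg (suc j ℕ.+ suc j)  ≈⟨ *-cong (consecutive j) (trans (sg-+ (suc j) (suc j)) (sg² (suc j))) ⟩
      1# * 1#                                  ≈⟨ *-identityˡ 1# ⟩
      1#                                       ∎
      where
      expand : ∀ j → suc j ℕ.* suc (suc j) ≡ j ℕ.* suc j ℕ.+ (suc j ℕ.+ suc j)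
      expand = solve-∀

  1^ : ∀ n → 1# ^ n ≈ 1#
  1^ zero    = refl
  1^ (suc n) = trans (*-identityˡ _) (1^ n)

  geo : ℕ → Carrier → Carrier
  geo m y = sum {m} (λ i → y ^ toℕ i)

  geo-suc : ∀ m y → geo (suc m) y ≈ 1# + y * geo m y
  geo-suc m y = +-congˡ (sym (Sum.*-distribˡ-sum semiring y (λ i → y ^ toℕ {m} i)))

  geo-last : ∀ m y → geo (suc m) y ≈ geo m y + y ^ m
  geo-last zero    y = trans (+-identityʳ _) (sym (+-identityˡ _))
  geo-last (suc m) y = begin
    geo (suc (suc m)) y           ≈⟨ geo-suc (suc m) y ⟩
    1# + y * geo (suc m) y        ≈⟨ +-congˡ (*-congˡ (geo-last m y)) ⟩
    1# + y * (geo m y + y ^ m)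
      ≈⟨ solve 4 (λ o y g p → o :+ y :* (g :+ p) := (o :+ y :* g) :+ y :* p) refl 1# y (geo m y) (y ^ m) ⟩
    (1# + y * geo m y) + y ^ suc m ≈⟨ +-congʳ (geo-suc m y) ⟨
    geo (suc m) y + y ^ suc m     ∎

  geo-cong : ∀ m {y z} → y ≈ z → geo m y ≈ geo m z
  geo-cong m y≈z = MonoidSum.sum-cong-≋ +-monoid {m} (λ i → ^-congˡ (toℕ i) y≈z)

  geo-closed : ∀ m y → (1# - y) * geo m y ≈ 1# - y ^ m
  geo-closed zero    y = trans (zeroʳ _) (sym (-‿inverseʳ 1#))
  geo-closed (suc m) y = begin
    (1# - y) * geo (suc m) y           ≈⟨ *-congˡ (geo-suc m y) ⟩
    (1# - y) * (1# + y * geo m y)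
      ≈⟨ solve 2 (λ y g → (:1 :- y) :* (:1 :+ y :* g) := (:1 :- y) :+ y :* ((:1 :- y) :* g)) refl y (geo m y) ⟩
    (1# - y) + y * ((1# - y) * geo m y) ≈⟨ +-congˡ (*-congˡ (geo-closed m y)) ⟩
    (1# - y) + y * (1# - y ^ m)        ≈⟨ solve 2 (λ y p → (:1 :- y) :+ y :* (:1 :- p) := :1 :- y :* p) refl y (y ^ m) ⟩
    1# - y ^ suc m                     ∎

  -- Splits off the last factor, where `product` splits off the first, so that induction on the
  -- upper bound exposes the new factor.
  Π< : ℕ → (ℕ → Carrier) → Carrier
  Π< zero    g = 1#
  Π< (suc n) g = g n * Π< n g

  product≈Π< : ∀ n g → product {n} (λ j → g (toℕ j)) ≈ Π< n g
  product≈Π< zero    g = refl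
  product≈Π< (suc n) g = trans (*-congˡ (product≈Π< n (λ j → g (suc j)))) (shift n g)
    where
    shift : ∀ n g → g 0 * Π< n (λ j → g (suc j)) ≈ Π< (suc n) g
    shift zero    g = refl
    shift (suc n) g = begin
      g 0 * (g (suc n) * Π< n _)   ≈⟨ solve 3 (λ a b p → a :* (b :* p) := b :* (a :* p)) refl (g 0) (g (suc n)) _ ⟩
      g (suc n) * (g 0 * Π< n _)   ≈⟨ *-congˡ (shift n g) ⟩
      g (suc n) * Π< (suc n) g     ∎

  Π<-cong : ∀ n {g h} → (∀ j → g j ≈ h j) → Π< n g ≈ Π< n h
  Π<-cong zero    g≈h = refl
  Π<-cong (suc n) g≈h = *-cong (g≈h n) (Π<-cong n g≈h)

  Π<-* : ∀ n g h → Π< n g * Π< n h ≈ Π< n (λ j → g j * h j)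
  Π<-* zero    g h = *-identityˡ 1#
  Π<-* (suc n) g h = begin
    g n * Π< n g * (h n * Π< n h)     ≈⟨ solve 4 (λ a b c d → a :* b :* (c :* d) := a :* c :* (b :* d)) refl _ _ _ _ ⟩
    g n * h n * (Π< n g * Π< n h)     ≈⟨ *-congˡ (Π<-* n g h) ⟩
    g n * h n * Π< n (λ j → g j * h j) ∎

  signed-geo-closed : ∀ x j m → geo (suc j ℕ.* m) (sg j * x) * (1# - sg j * x) ≈ 1# - x ^ (suc j ℕ.* m)
  signed-geo-closed x j m = begin
    geo M y * (1# - y)             ≈⟨ *-comm _ _ ⟩
    (1# - y) * geo M y             ≈⟨ geo-closed M y ⟩
    1# - y ^ M                     ≈⟨ +-congˡ (-‿cong (^-distrib-* (sg j) x M)) ⟩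
    1# - sg j ^ M * x ^ M          ≈⟨ +-congˡ (-‿cong (*-congʳ one)) ⟩
    1# - 1# * x ^ M                ≈⟨ +-congˡ (-‿cong (*-identityˡ _)) ⟩
    1# - x ^ M                     ∎
    where
    M = suc j ℕ.* m
    y = sg j * x
    one : sg j ^ M ≈ 1#
    one = begin
      sg j ^ (suc j ℕ.* m)   ≈⟨ ^-assocʳ (sg j) (suc j) m ⟨
      (sg j ^ suc j) ^ m     ≈⟨ ^-congˡ m (sg^suc j) ⟩
      1# ^ m                 ≈⟨ 1^ m ⟩
      1#                     ∎

-- Closed forms of the basic series

module ClosedForms {c ℓ} (A : CommutativeRing c ℓ)
  (x : CommutativeRing.Carrier A) (v : ℕ → CommutativeRing.Carrier A) (v-inverse : Reciprocals A x v) where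

  open CommutativeRing A hiding (zero)
  open RawSemiringDefinitions (Semiring.rawSemiring semiring) using (_^_; product)
  open IntegerSolver A
  open Signs A
  open GeometricSums A
  open LevelSum A x v v-inverse
  open SetoidReasoning setoid
  open Exp semiring using (^-congˡ)
  open CommutativeExp commutativeSemiring using (^-distrib-*)

  Num : ℕ → ℕ → Carrier
  Num r n = product {n} (λ j → geo (suc (toℕ j) ℕ.* r) (sg (toℕ j) * x))

  Den : ℕ → Carrier
  Den k = product {k} (λ j → geo (suc (toℕ j)) (sg (toℕ j) * x))

  -- `Y` is the signed numerator multiplied by `Z`. The signed sum over `H` will turn out to be `Y`
  -- times `F`, that is, the numerator times `Z` times `F`; what is left to evaluate, `ZF`, does not
  -- involve `r`.
  Y : ℕ → ℕ → Carrier
  Y r n = Π< n (λ j → 1# - x ^ (suc j ℕ.* r))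

  Z : ℕ → Carrier
  Z n = Π< n (λ j → 1# - sg j * x)

  Num-Z : ∀ r n → Num r n * Z n ≈ Y r n
  Num-Z r n = begin
    Num r n * Z n  ≈⟨ *-congʳ (product≈Π< n (λ j → geo (suc j ℕ.* r) (sg j * x))) ⟩
    Π< n _ * Z n   ≈⟨ Π<-* n _ _ ⟩
    Π< n _         ≈⟨ Π<-cong n (λ j → signed-geo-closed x j r) ⟩
    Y r n          ∎

  Den-suc : ∀ k → Den (suc k) ≈ geo (suc k) (sg k * x) * Den k
  Den-suc k = begin
    Den (suc k)                                  ≈⟨ product≈Π< (suc k) g ⟩
    geo (suc k) (sg k * x) * Π< k g              ≈⟨ *-congˡ (product≈Π< k g) ⟨
    geo (suc k) (sg k * x) * Den k               ∎
    where
    g : ℕ → Carrier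
    g j = geo (suc j) (sg j * x)

  -- The analogue of `Num-Z` for r = 1, with `D` inverting the unsigned product.
  Z-D-Den : ∀ k → Z k * D k * Den k ≈ 1#
  Z-D-Den zero    = solve 0 (:1 :* :1 :* :1 := :1) refl
  Z-D-Den (suc k) = begin
    (1# - y) * Z k * (v k * D k) * Den (suc k)
      ≈⟨ *-congˡ (Den-suc k) ⟩
    (1# - y) * Z k * (v k * D k) * (geo (suc k) y * Den k)
      ≈⟨ solve 6 (λ u z w d g e → u :* z :* (w :* d) :* (g :* e) := (g :* u) :* w :* (z :* d :* e)) refl (1# - y) (Z k)
          (v k) (D k) (geo (suc k) y) (Den k) ⟩
    (geo (suc k) y * (1# - y)) * v k * (Z k * D k * Den k)
      ≈⟨ *-cong (*-congʳ factor) (Z-D-Den k) ⟩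
    (1# - x ^ suc k) * v k * 1#
      ≈⟨ *-identityʳ _ ⟩
    (1# - x ^ suc k) * v k
      ≈⟨ v-inverse k ⟩
    1# ∎
    where
    y = sg k * x
    factor : geo (suc k) y * (1# - y) ≈ 1# - x ^ suc k
    factor = ≡.subst (λ m → geo m y * (1# - y) ≈ 1# - x ^ m) (ℕ.*-identityʳ (suc k)) (signed-geo-closed x k 1)

  -x^ : ∀ n → (- x) ^ n ≈ sg n * x ^ n
  -x^ n = trans (^-congˡ n (solve 1 (λ x → :- x := :- :1 :* x) refl x)) (^-distrib-* (- 1#) x n)

  T≈geo : ∀ k → T k ≈ geo (suc k) (- x)
  T≈geo zero    = sym (+-identityʳ 1#)
  T≈geo (suc k) = begin
    T k + sg (suc k) * x ^ suc k           ≈⟨ +-cong (T≈geo k) (sym (-x^ (suc k))) ⟩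
    geo (suc k) (- x) + (- x) ^ suc k      ≈⟨ geo-last (suc k) (- x) ⟨
    geo (suc (suc k)) (- x)                ∎

  T-closed : ∀ k → (1# + x) * T k ≈ 1# - sg (suc k) * x ^ suc k
  T-closed k = begin
    (1# + x) * T k                        ≈⟨ *-cong (solve 1 (λ x → :1 :+ x := :1 :- :- x) refl x) (T≈geo k) ⟩
    (1# - - x) * geo (suc k) (- x)        ≈⟨ geo-closed (suc k) (- x) ⟩
    1# - (- x) ^ suc k                    ≈⟨ +-congˡ (-‿cong (-x^ (suc k))) ⟩
    1# - sg (suc k) * x ^ suc k           ∎

  private
    1-x : (1# - x) * v 0 ≈ 1#
    1-x = trans (*-congʳ (+-congˡ (-‿cong (sym (*-identityʳ x))))) (v-inverse 0)

    -- As 1 - x is a unit, an equation may be proved after multiplication by it. `V-even` needs this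
    -- because `V-odd` only describes (1 - x) (1 + x) `V`.
    cancel-1-x : ∀ {p s} → (1# - x) * p ≈ (1# - x) * s → p ≈ s
    cancel-1-x {p} {s} eq = begin
      p                        ≈⟨ expand p ⟩
      v 0 * ((1# - x) * p)     ≈⟨ *-congˡ eq ⟩
      v 0 * ((1# - x) * s)     ≈⟨ expand s ⟨
      s                        ∎
      where
      expand : ∀ p → p ≈ v 0 * ((1# - x) * p)
      expand p = begin
        p                        ≈⟨ *-identityˡ p ⟨
        1# * p                   ≈⟨ *-congʳ 1-x ⟨
        (1# - x) * v 0 * p       ≈⟨ solve 3 (λ a b c → a :* b :* c := b :* (a :* c)) refl (1# - x) (v 0) p ⟩
        v 0 * ((1# - x) * p)     ∎

  T-even : ∀ {k} → Even k → (1# + x) * T k ≈ 1# + x ^ suc k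
  T-even {k} e = trans (T-closed k)
    (trans (+-congˡ (-‿cong (*-congʳ (sg-odd (suc e))))) (solve 1 (λ X → :1 :- :- :1 :* X := :1 :+ X) refl (x ^ suc k)))

  T-odd : ∀ {k} → Odd k → (1# + x) * T k ≈ 1# - x ^ suc k
  T-odd {k} o = trans (T-closed k)
    (+-congˡ (-‿cong (trans (*-congʳ (sg-even (suc o))) (*-identityˡ _))))

  -- Each step of `T′` negates the previous value, so that `T′` alternates between `2 - T` and `T`.
  T′-even : ∀ {k} → Even k → T′ k ≈ 1# + 1# - T k
  T′-odd  : ∀ {k} → Odd k → T′ k ≈ T k
  T′-even zero            = solve 0 (:1 := :1 :+ :1 :- :1) refl
  T′-even {suc k} (suc o) = begin
    1# + 1# - X - T′ k            ≈⟨ +-congˡ (-‿cong (T′-odd o)) ⟩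
    1# + 1# - X - T k             ≈⟨ solve 2 (λ X t → :1 :+ :1 :- X :- t := :1 :+ :1 :- (t :+ :1 :* X)) refl X (T k) ⟩
    1# + 1# - (T k + 1# * X)      ≈⟨ +-congˡ (-‿cong (+-congˡ (*-congʳ (sg-even (suc o))))) ⟨
    1# + 1# - (T k + sg (suc k) * X) ∎
    where X = x ^ suc k
  T′-odd {suc k} (suc e) = begin
    1# + 1# - X - T′ k                  ≈⟨ +-congˡ (-‿cong (T′-even e)) ⟩
    1# + 1# - X - (1# + 1# - T k)
      ≈⟨ solve 2 (λ X t → :1 :+ :1 :- X :- (:1 :+ :1 :- t) := t :+ :- :1 :* X) refl X (T k) ⟩
    T k + - 1# * X                      ≈⟨ +-congˡ (*-congʳ (sg-odd (suc e))) ⟨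
    T k + sg (suc k) * X                ∎
    where X = x ^ suc k

  -- The recursion of `V` leads from each parity to the other. For odd k everything factors; for
  -- even k a factor 2 - [k + 1] survives, which together with `T′-even` is the origin of the
  -- exceptional factor in the third identity.
  V-even : ∀ {k} → Even k → (1# + x) * V k ≈ (1# - x ^ suc (suc k)) * (1# + 1# - geo (suc k) x)
  V-odd  : ∀ {k} → Odd k → (1# - x) * ((1# + x) * V k) ≈ (1# - x ^ suc k) * (1# - x ^ suc (suc k))
  V-even zero = solve 1 (λ x → (:1 :+ x) :* (:1 :- x) := (:1 :- x :* (x :* :1)) :* (:1 :+ :1 :- (:1 :+ :0))) refl x
  V-even {suc k} (suc o) = cancel-1-x (begin
    (1# - x) * ((1# + x) * V (suc k))
      ≈⟨ *-congˡ (*-congˡ (+-cong refl (-‿cong (*-cong (*-congʳ (sg-even (suc o))) (T′-even (suc o)))))) ⟩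
    (1# - x) * ((1# + x) * (T (suc k) + (1# - X) * T k - V k - 1# * X * (1# + 1# - T (suc k))))
      ≈⟨ solve 5 (λ x X t₁ t w → (:1 :- x) :* ((:1 :+ x) :* (t₁ :+ (:1 :- X) :* t :- w :- :1 :* X :* (:1 :+ :1 :- t₁)))
           := (:1 :- x) :* ((:1 :+ X) :* ((:1 :+ x) :* t₁) :+ (:1 :- X) :* ((:1 :+ x) :* t) :- (:1 :+ x) :* X :*
               (:1 :+ :1)) :- (:1 :- x) :* ((:1 :+ x) :* w)) refl x X (T (suc k)) (T k) (V k) ⟩
    (1# - x) * ((1# + X) * ((1# + x) * T (suc k)) + (1# - X) * ((1# + x) * T k) - (1# + x) * X * (1# + 1#)) - (1# - x) *
        ((1# + x) * V k)
      ≈⟨ +-cong (*-congˡ (+-congʳ (+-cong (*-congˡ (T-even (suc o))) (*-congˡ (T-odd o))))) (-‿cong (V-odd o)) ⟩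
    (1# - x) * ((1# + X) * (1# + X) + (1# - X) * (1# - W) - (1# + x) * X * (1# + 1#)) - (1# - W) * (1# - X)
      ≈⟨ solve 2 (λ x W → let X = x :* W in (:1 :- x) :* ((:1 :+ X) :* (:1 :+ X) :+ (:1 :- X) :* (:1 :- W) :- (:1 :+ x) :* X :* (:1 :+ :1)) :- (:1 :- W) :* (:1 :- X)
           := (:1 :- x :* X) :* ((:1 :- x) :* (:1 :+ :1) :- (:1 :- X))) refl x W ⟩
    (1# - x * X) * ((1# - x) * (1# + 1#) - (1# - X))
      ≈⟨ *-congˡ (+-congˡ (-‿cong (geo-closed (suc (suc k)) x))) ⟨
    (1# - x * X) * ((1# - x) * (1# + 1#) - (1# - x) * geo (suc (suc k)) x)
      ≈⟨ solve 3 (λ X x g → (:1 :- X) :* ((:1 :- x) :* (:1 :+ :1) :- (:1 :- x) :* g) := (:1 :- x) :*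
          ((:1 :- X) :* (:1 :+ :1 :- g))) refl (x * X) x (geo (suc (suc k)) x) ⟩
    (1# - x) * ((1# - x * X) * (1# + 1# - geo (suc (suc k)) x)) ∎)
    where
    W = x ^ suc k
    X = x ^ suc (suc k)
  V-odd {suc k} (suc e) = begin
    (1# - x) * ((1# + x) * V (suc k))
      ≈⟨ *-congˡ (*-congˡ (+-cong refl (-‿cong (*-cong (*-congʳ (sg-odd (suc e))) (T′-odd (suc e)))))) ⟩
    (1# - x) * ((1# + x) * (T (suc k) + (1# - X) * T k - V k - - 1# * X * T (suc k)))
      ≈⟨ solve 5 (λ x X t₁ t w → (:1 :- x) :* ((:1 :+ x) :* (t₁ :+ (:1 :- X) :* t :- w :- :- :1 :* X :* t₁))
           := (:1 :- x) :* ((:1 :+ X) :* ((:1 :+ x) :* t₁) :+ (:1 :- X) :* ((:1 :+ x) :* t) :- (:1 :+ x) :* w)) refl x X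
               (T (suc k)) (T k) (V k) ⟩
    (1# - x) * ((1# + X) * ((1# + x) * T (suc k)) + (1# - X) * ((1# + x) * T k) - (1# + x) * V k)
      ≈⟨ *-congˡ (+-cong (+-cong (*-congˡ (T-odd (suc e))) (*-congˡ (T-even e))) (-‿cong (V-even e))) ⟩
    (1# - x) * ((1# + X) * (1# - X) + (1# - X) * (1# + W) - (1# - X) * (1# + 1# - geo (suc k) x))
      ≈⟨ solve 4 (λ x X W g → (:1 :- x) :* ((:1 :+ X) :* (:1 :- X) :+ (:1 :- X) :* (:1 :+ W) :- (:1 :- X) :*
          (:1 :+ :1 :- g))
           := (:1 :- X) :* ((:1 :- x) :* (X :+ W) :+ (:1 :- x) :* g)) refl x X W (geo (suc k) x) ⟩
    (1# - X) * ((1# - x) * (X + W) + (1# - x) * geo (suc k) x)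
      ≈⟨ *-congˡ (+-congˡ (geo-closed (suc k) x)) ⟩
    (1# - X) * ((1# - x) * (X + W) + (1# - W))
      ≈⟨ solve 2 (λ x W → let X = x :* W in (:1 :- X) :* ((:1 :- x) :* (X :+ W) :+ (:1 :- W)) := (:1 :- X) :* (:1 :- x :* X)) refl x W ⟩
    (1# - X) * (1# - x * X) ∎
    where
    W = x ^ suc k
    X = x ^ suc (suc k)

  private
    -- Consecutive factors of `Z` carry opposite signs, so two of them multiply to 1 - x².
    Z-2 : ∀ n → Z (suc (suc n)) ≈ (1# - x ^ 2) * Z n
    Z-2 n = begin
      (1# - - 1# * sg n * x) * ((1# - sg n * x) * Z n)
        ≈⟨ solve 3 (λ s x z → (:1 :- :- :1 :* s :* x) :* ((:1 :- s :* x) :* z) := (:1 :- s :* s :* (x :* (x :* :1))) :*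
            z) refl (sg n) x (Z n) ⟩
      (1# - sg n * sg n * x ^ 2) * Z n
        ≈⟨ *-congʳ (+-congˡ (-‿cong (trans (*-congʳ (sg² n)) (*-identityˡ _)))) ⟩
      (1# - x ^ 2) * Z n ∎

  ZF : ℕ → ℕ → ℕ → Carrier
  ZF a k b = Z (a ℕ.+ b ℕ.+ k) * F a k b

  private
    -- The factor `v 1` that `F` acquires from a pair of outer labels is cancelled by the two
    -- additional factors of `Z`. Hence `ZF` depends on `a` and `b` only through their parities.
    absorb : ∀ n f → Z (suc (suc n)) * (v 1 * f) ≈ Z n * f
    absorb n f = begin
      Z (suc (suc n)) * (v 1 * f)       ≈⟨ *-congʳ (Z-2 n) ⟩
      (1# - x ^ 2) * Z n * (v 1 * f)
        ≈⟨ solve 4 (λ u z w f → u :* z :* (w :* f) := (u :* w) :* (z :* f)) refl (1# - x ^ 2) (Z n) (v 1) f ⟩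
      (1# - x ^ 2) * v 1 * (Z n * f)    ≈⟨ *-congʳ (v-inverse 1) ⟩
      1# * (Z n * f)                    ≈⟨ *-identityˡ _ ⟩
      Z n * f                           ∎

  ZF-a : ∀ a k b → ZF (suc (suc a)) k b ≈ ZF a k b
  ZF-a a k b = absorb (a ℕ.+ b ℕ.+ k) (F a k b)

  ZF-odd : ∀ {k} → Odd k → ∀ a b → ZF a k b * Den k ≈ 1#
  ZF-odd {k} o (suc (suc a)) b = trans (*-congʳ (ZF-a a k b)) (ZF-odd o a b)
  ZF-odd {k} o 0 (suc (suc b)) = trans (*-congʳ (absorb (b ℕ.+ k) (F 0 k b))) (ZF-odd o 0 b)
  ZF-odd {k} o 1 (suc (suc b)) = trans (*-congʳ (absorb (suc b ℕ.+ k) (F 1 k b))) (ZF-odd o 1 b)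
  ZF-odd {k} o 0 0 = Z-D-Den k
  ZF-odd {k} o 0 1 = begin
    (1# - sg k * x) * Z k * (D (suc k) * T k) * Den k
      ≈⟨ *-congʳ (*-congʳ (*-congʳ (+-congˡ (-‿cong (*-congʳ (sg-odd o)))))) ⟩
    (1# - - 1# * x) * Z k * (D (suc k) * T k) * Den k
      ≈⟨ solve 5 (λ x z d t e → (:1 :- :- :1 :* x) :* z :* (d :* t) :* e := z :* ((:1 :+ x) :* t :* d) :* e) refl x
          (Z k) (D (suc k)) (T k) (Den k) ⟩
    Z k * ((1# + x) * T k * D (suc k)) * Den k
      ≈⟨ *-congʳ (*-congˡ (*-congʳ (T-odd o))) ⟩
    Z k * ((1# - x ^ suc k) * D (suc k)) * Den k
      ≈⟨ *-congʳ (*-congˡ (D-step k)) ⟨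
    Z k * D k * Den k
      ≈⟨ Z-D-Den k ⟩
    1# ∎
  -- For odd k one label above and one label below the block give the same series, and `Z` sees only
  -- the number of labels.
  ZF-odd {k} o 1 0 = trans (*-congʳ (*-congˡ (*-congˡ (T′-odd o)))) (ZF-odd o 0 1)
  ZF-odd {k} o 1 1 = begin
    Z (suc (suc k)) * (D (suc (suc k)) * V k) * Den k
      ≈⟨ *-congʳ (*-congʳ (Z-2 k)) ⟩
    (1# - x ^ 2) * Z k * (D₂ * V k) * Den k
      ≈⟨ solve 5 (λ x z d w e → (:1 :- x :* (x :* :1)) :* z :* (d :* w) :* e := z :*
          ((:1 :- x) :* ((:1 :+ x) :* w) :* d) :* e) refl x (Z k) D₂ (V k) (Den k) ⟩
    Z k * ((1# - x) * ((1# + x) * V k) * D₂) * Den k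
      ≈⟨ *-congʳ (*-congˡ (*-congʳ (V-odd o))) ⟩
    Z k * ((1# - x ^ suc k) * (1# - x ^ suc (suc k)) * D₂) * Den k
      ≈⟨ *-congʳ (*-congˡ (trans (*-assoc _ _ _) (trans (*-congˡ (sym (D-step (suc k)))) (sym (D-step k))))) ⟩
    Z k * D k * Den k
      ≈⟨ Z-D-Den k ⟩
    1# ∎
    where D₂ = D (suc (suc k))

  private
    geo-sg-2 : ∀ k n → geo (suc k) (sg (suc (suc n)) * x) ≈ geo (suc k) (sg n * x)
    geo-sg-2 k n = geo-cong (suc k) (*-congʳ (solve 1 (λ s → :- :1 :* (:- :1 :* s) := s) refl (sg n)))

    geo-odd : ∀ k {n} → Odd n → geo (suc k) (sg n * x) ≈ T k
    geo-odd k {n} o = trans (geo-cong (suc k) (trans (*-congʳ (sg-odd o)) (solve 1 (λ x → :- :1 :* x := :- x) refl x)))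
        (sym (T≈geo k))

    geo-even : ∀ k {n} → Even n → geo (suc k) (sg n * x) ≈ geo (suc k) x
    geo-even k e = geo-cong (suc k) (trans (*-congʳ (sg-even e)) (*-identityˡ x))

    top : ∀ k t → Z (suc k) * (D (suc k) * t) * Den (suc k) ≈ t
    top k t = begin
      Z (suc k) * (D (suc k) * t) * Den (suc k)
        ≈⟨ solve 4 (λ z d t e → z :* (d :* t) :* e := (z :* d :* e) :* t) refl (Z (suc k)) (D (suc k)) t (Den (suc k)) ⟩
      Z (suc k) * D (suc k) * Den (suc k) * t      ≈⟨ *-congʳ (Z-D-Den (suc k)) ⟩
      1# * t                                       ≈⟨ *-identityˡ t ⟩
      t                                            ∎

  ZF-even-even : ∀ {k a} → Even k → Even a → ∀ b →
    ZF a k b * Den (suc k) ≈ geo (suc k) (sg (a ℕ.+ b ℕ.+ k) * x)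
  ZF-even-even {k} {suc (suc a)} e (suc (suc e′)) b =
    trans (*-congʳ (ZF-a a k b)) (trans (ZF-even-even e e′ b) (sym (geo-sg-2 k (a ℕ.+ b ℕ.+ k))))
  ZF-even-even {k} e zero (suc (suc b)) =
    trans (*-congʳ (absorb (b ℕ.+ k) (F 0 k b))) (trans (ZF-even-even e zero b) (sym (geo-sg-2 k (b ℕ.+ k))))
  ZF-even-even {k} e zero 0 = begin
    -- With no outer labels the sign is that of `sg k`, and the last factor of `Den (suc k)` is
    -- already the claimed one.
    Z k * D k * Den (suc k)                              ≈⟨ *-congˡ (Den-suc k) ⟩
    Z k * D k * (geo (suc k) (sg k * x) * Den k)
      ≈⟨ solve 3 (λ z g d → z :* (g :* d) := z :* d :* g) refl (Z k * D k) (geo (suc k) (sg k * x)) (Den k) ⟩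
    Z k * D k * Den k * geo (suc k) (sg k * x)           ≈⟨ *-congʳ (Z-D-Den k) ⟩
    1# * geo (suc k) (sg k * x)                          ≈⟨ *-identityˡ _ ⟩
    geo (suc k) (sg k * x)                               ∎
  ZF-even-even {k} e zero 1 = trans (top k (T k)) (sym (geo-odd k (suc e)))

  ZF-even-odd : ∀ {k a} → Even k → Odd a → ∀ b →
    ZF a k b * Den (suc k) ≈ 1# + 1# - geo (suc k) (sg (a ℕ.+ b ℕ.+ k) * x)
  ZF-even-odd {k} {suc (suc a)} e (suc (suc o)) b =
    trans (*-congʳ (ZF-a a k b)) (trans (ZF-even-odd e o b) (+-congˡ (-‿cong (sym (geo-sg-2 k (a ℕ.+ b ℕ.+ k))))))
  ZF-even-odd {k} e (suc zero) (suc (suc b)) =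
    trans (*-congʳ (absorb (suc b ℕ.+ k) (F 1 k b)))
        (trans (ZF-even-odd e (suc zero) b) (+-congˡ (-‿cong (sym (geo-sg-2 k (suc b ℕ.+ k))))))
  ZF-even-odd {k} e (suc zero) 0 =
    trans (top k (T′ k)) (trans (T′-even e) (+-congˡ (-‿cong (sym (geo-odd k (suc e))))))
  ZF-even-odd {k} e (suc zero) 1 = begin
    (1# - - 1# * sg k * x) * Z (suc k) * (D₂ * V k) * Den (suc k)
      ≈⟨ *-congʳ (*-congʳ (*-congʳ (+-congˡ (-‿cong (*-congʳ (*-congˡ (sg-even e))))))) ⟩
    (1# - - 1# * 1# * x) * Z (suc k) * (D₂ * V k) * Den (suc k)
      ≈⟨ solve 5 (λ x z d w n → (:1 :- :- :1 :* :1 :* x) :* z :* (d :* w) :* n := z :* ((:1 :+ x) :* w :* d) :* n) refl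
          x (Z (suc k)) D₂ (V k) (Den (suc k)) ⟩
    Z (suc k) * ((1# + x) * V k * D₂) * Den (suc k)
      ≈⟨ *-congʳ (*-congˡ (*-congʳ (V-even e))) ⟩
    Z (suc k) * ((1# - x ^ suc (suc k)) * g * D₂) * Den (suc k)
      ≈⟨ *-congʳ (*-congˡ (solve 3 (λ u g d → u :* g :* d := u :* d :* g) refl (1# - x ^ suc (suc k)) g D₂)) ⟩
    Z (suc k) * ((1# - x ^ suc (suc k)) * D₂ * g) * Den (suc k)
      ≈⟨ *-congʳ (*-congˡ (*-congʳ (D-step (suc k)))) ⟨
    Z (suc k) * (D (suc k) * g) * Den (suc k)
      ≈⟨ top k g ⟩
    g ≈⟨ +-congˡ (-‿cong (sym (geo-even k (suc (suc e))))) ⟩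
    1# + 1# - geo (suc k) (sg (suc (suc k)) * x) ∎
    where
    D₂ = D (suc (suc k))
    g = 1# + 1# - geo (suc k) x

-- Finite sums over lists, ranges and words

module FiniteSums {c ℓ} (A : CommutativeRing c ℓ) where

  open CommutativeRing A hiding (zero)
  open SetoidReasoning setoid
  open CommutativeSemigroupProperties +-commutativeSemigroup using (interchange)

  Σ[_] : ∀ {b} {B : Set b} → List B → (B → Carrier) → Carrier
  Σ[ []     ] f = 0#
  Σ[ b ∷ bs ] f = f b + Σ[ bs ] f

  Σ< : ℕ → (ℕ → Carrier) → Carrier
  Σ< zero    g = 0#
  Σ< (suc n) g = Σ< n g + g n

  module _ {b} {B : Set b} where

    Σ-cong : ∀ (bs : List B) {f g} → (∀ b → f b ≈ g b) → Σ[ bs ] f ≈ Σ[ bs ] g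
    Σ-cong []       f≈g = refl
    Σ-cong (b ∷ bs) f≈g = +-cong (f≈g b) (Σ-cong bs f≈g)

    Σ-zero : ∀ (bs : List B) {f} → (∀ b → f b ≈ 0#) → Σ[ bs ] f ≈ 0#
    Σ-zero []       f≈0 = refl
    Σ-zero (b ∷ bs) f≈0 = trans (+-cong (f≈0 b) (Σ-zero bs f≈0)) (+-identityˡ 0#)

    Σ-+ : ∀ (bs : List B) f g → Σ[ bs ] (λ b → f b + g b) ≈ Σ[ bs ] f + Σ[ bs ] g
    Σ-+ []       f g = sym (+-identityˡ 0#)
    Σ-+ (b ∷ bs) f g = trans (+-congˡ (Σ-+ bs f g)) (interchange _ _ _ _)

    Σ-++ : ∀ (as bs : List B) f → Σ[ as ++ bs ] f ≈ Σ[ as ] f + Σ[ bs ] f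
    Σ-++ []       bs f = sym (+-identityˡ _)
    Σ-++ (a ∷ as) bs f = trans (+-congˡ (Σ-++ as bs f)) (sym (+-assoc _ _ _))

    Σ-filter : ∀ {p} {P : B → Set p} (P? : Decidable P) bs f →
               Σ[ filter P? bs ] f ≈ Σ[ bs ] (λ b → if does (P? b) then f b else 0#)
    Σ-filter P? []       f = refl
    Σ-filter P? (b ∷ bs) f with does (P? b)
    ... | true  = +-congˡ (Σ-filter P? bs f)
    ... | false = trans (Σ-filter P? bs f) (sym (+-identityˡ _))

  Σ-map : ∀ {a b} {A : Set a} {B : Set b} (h : A → B) as f → Σ[ map h as ] f ≈ Σ[ as ] (λ a → f (h a))
  Σ-map h []       f = refl
  Σ-map h (a ∷ as) f = +-congˡ (Σ-map h as f)

  Σ-swap : ∀ {a b} {A : Set a} {B : Set b} (as : List A) (bs : List B) (f : A → B → Carrier) →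
           Σ[ as ] (λ a → Σ[ bs ] (f a)) ≈ Σ[ bs ] (λ b → Σ[ as ] (λ a → f a b))
  Σ-swap []       bs f = sym (Σ-zero bs (λ _ → refl))
  Σ-swap (a ∷ as) bs f = trans (+-congˡ (Σ-swap as bs f)) (sym (Σ-+ bs _ _))

  Σ-cartesianProductWith : ∀ {a b c} {A : Set a} {B : Set b} {C : Set c} (h : A → B → C) as bs f →
    Σ[ cartesianProductWith h as bs ] f ≈ Σ[ as ] (λ a → Σ[ bs ] (λ b → f (h a b)))
  Σ-cartesianProductWith h []       bs f = refl
  Σ-cartesianProductWith h (a ∷ as) bs f =
    trans (Σ-++ (map (h a) bs) _ f) (+-cong (Σ-map (h a) bs f) (Σ-cartesianProductWith h as bs f))

  Σ-allFin : ∀ n {f : Fin n → Carrier} {g : ℕ → Carrier} → (∀ i → f i ≈ g (toℕ i)) →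
             Σ[ allFin n ] f ≈ Σ< n g
  Σ-allFin n = tabulated n (λ i → i)
    where
    first : ∀ n (g : ℕ → Carrier) → g 0 + Σ< n (λ i → g (suc i)) ≈ Σ< (suc n) g
    first zero    g = +-comm _ _
    first (suc n) g = trans (sym (+-assoc _ _ _)) (+-congʳ (first n g))

    tabulated : ∀ {b} {B : Set b} n (h : Fin n → B) {f : B → Carrier} {g : ℕ → Carrier} →
                (∀ i → f (h i) ≈ g (toℕ i)) → Σ[ tabulate h ] f ≈ Σ< n g
    tabulated zero    h         eq = refl
    tabulated (suc n) h {g = g} eq = trans
      (+-cong (eq Fin.zero) (tabulated n (λ i → h (Fin.suc i)) (λ i → eq (Fin.suc i))))
      (first n g)

  Σ<-cong : ∀ n {g h} → (∀ i → i < n → g i ≈ h i) → Σ< n g ≈ Σ< n h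
  Σ<-cong zero    eq = refl
  Σ<-cong (suc n) eq = +-cong (Σ<-cong n (λ i i<n → eq i (ℕ.m<n⇒m<1+n i<n))) (eq n ℕ.≤-refl)

  Σ<-*ˡ : ∀ n a g → Σ< n (λ i → a * g i) ≈ a * Σ< n g
  Σ<-*ˡ zero    a g = sym (zeroʳ a)
  Σ<-*ˡ (suc n) a g = trans (+-congʳ (Σ<-*ˡ n a g)) (sym (distribˡ _ _ _))

  Σ<-swap : ∀ m n (f : ℕ → ℕ → Carrier) →
            Σ< m (λ i → Σ< n (f i)) ≈ Σ< n (λ j → Σ< m (λ i → f i j))
  Σ<-swap m zero    f = zeros m
    where
    zeros : ∀ m → Σ< m (λ _ → 0#) ≈ 0#
    zeros zero    = refl
    zeros (suc m) = trans (+-identityʳ _) (zeros m)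
  Σ<-swap m (suc n) f = trans (sums m) (+-congʳ (Σ<-swap m n f))
    where
    sums : ∀ m → Σ< m (λ i → Σ< (suc n) (f i)) ≈ Σ< m (λ i → Σ< n (f i)) + Σ< m (λ i → f i n)
    sums zero    = sym (+-identityˡ 0#)
    sums (suc m) = trans (+-congʳ (sums m)) (interchange _ _ _ _)

  -- All words v of length m are put in front of s, read from right to left.
  Σ-prefix : ∀ {b} {B : Set b} → List B → (∀ {j} → Vec B j → Carrier) → ∀ (m : ℕ) {j} → Vec B j → Carrier
  Σ-prefix bs f zero    s = f s
  Σ-prefix bs f (suc m) s = Σ[ bs ] (λ b → Σ-prefix bs f m (b ∷ s))

  -- In `vectors` the leftmost letter belongs to the outermost sum, in `Σ-prefix` the rightmost one
  -- does. `outermost` carries the sum over the leftmost letter inwards past all the others.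
  Σ-vectors : ∀ {B : Set} (bs : List B) (m : ℕ) (f : ∀ {j} → Vec B j → Carrier) →
              Σ[ vectors bs m ] f ≈ Σ-prefix bs f m []
  Σ-vectors bs zero    f = +-identityʳ _
  Σ-vectors bs (suc m) f = begin
    Σ[ vectors bs (suc m) ] f                                     ≈⟨ Σ-cartesianProductWith _∷_ bs (vectors bs m) f ⟩
    Σ[ bs ] (λ b → Σ[ vectors bs m ] (λ v → f (b ∷ v)))
      ≈⟨ Σ-cong bs (λ b → Σ-vectors bs m (λ v → f (b ∷ v))) ⟩
    Σ[ bs ] (λ b → Σ-prefix bs (λ v → f (b ∷ v)) m [])            ≈⟨ outermost m [] ⟩
    Σ-prefix bs f (suc m) []                                      ∎
    where
    outermost : ∀ (m : ℕ) {j} (s : Vec _ j) →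
      Σ[ bs ] (λ b → Σ-prefix bs (λ v → f (b ∷ v)) m s) ≈ Σ-prefix bs f (suc m) s
    outermost zero    s = refl
    outermost (suc m) s = trans (Σ-swap bs bs (λ b c → Σ-prefix bs (λ v → f (b ∷ v)) m (c ∷ s)))
        (Σ-cong bs (λ c → outermost m (c ∷ s)))

bit : Bool → ℕ
bit b = if b then 1 else 0

cnt : (ℕ → Bool) → ℕ → ℕ
cnt u zero    = 0
cnt u (suc p) = bit (u p) ℕ.+ cnt u p

remove : ℕ → (ℕ → Bool) → ℕ → Bool
remove p u i = if does (i ℕ.≟ p) then false else u i

remove-≡ : ∀ p u → remove p u p ≡ false
remove-≡ p u = ≡.cong (if_then false else u p) (dec-true (p ℕ.≟ p) ≡.refl)

remove-≢ : ∀ {p i} u → i ≢ p → remove p u i ≡ u i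
remove-≢ {p} {i} u i≢p = ≡.cong (if_then false else u i) (dec-false (i ℕ.≟ p) i≢p)

cnt-cong : ∀ {u w} p → (∀ i → i < p → u i ≡ w i) → cnt u p ≡ cnt w p
cnt-cong zero    eq = ≡.refl
cnt-cong (suc p) eq = ≡.cong₂ ℕ._+_ (≡.cong bit (eq p ℕ.≤-refl)) (cnt-cong p (λ i i<p → eq i (ℕ.m<n⇒m<1+n i<p)))

cnt-complement : ∀ u p → cnt (not ∘ u) p ℕ.+ cnt u p ≡ p
cnt-complement u zero    = ≡.refl
cnt-complement u (suc p) with u p
... | true  = ≡.trans (ℕ.+-suc _ _) (≡.cong suc (cnt-complement u p))
... | false = ≡.cong suc (cnt-complement u p)

cnt-remove-not : ∀ {u p} → u p ≡ true → ∀ i →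
  cnt (not ∘ remove p u) i ≡ bit (does (p ℕ.<? i)) ℕ.+ cnt (not ∘ u) i
cnt-remove-not {u} {p} up zero = ≡.refl
cnt-remove-not {u} {p} up (suc i) with ℕ.<-cmp p i
... | tri< p<i p≢i _ = begin
  bit (not (remove p u i)) ℕ.+ cnt (not ∘ remove p u) i
    ≡⟨ ≡.cong₂ (λ t c → bit (not t) ℕ.+ c) (remove-≢ u (p≢i ∘ ≡.sym)) (cnt-remove-not up i) ⟩
  bit (not (u i)) ℕ.+ (bit (does (p ℕ.<? i)) ℕ.+ cnt (not ∘ u) i)
    ≡⟨ ≡.cong (λ t → bit (not (u i)) ℕ.+ (bit t ℕ.+ cnt (not ∘ u) i)) (dec-true (p ℕ.<? i) p<i) ⟩
  bit (not (u i)) ℕ.+ suc (cnt (not ∘ u) i)                        ≡⟨ ℕ.+-suc _ _ ⟩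
  suc (bit (not (u i)) ℕ.+ cnt (not ∘ u) i)
    ≡⟨ ≡.cong (λ t → bit t ℕ.+ (bit (not (u i)) ℕ.+ cnt (not ∘ u) i)) (dec-true (p ℕ.<? suc i) (ℕ.m<n⇒m<1+n p<i)) ⟨
  bit (does (p ℕ.<? suc i)) ℕ.+ (bit (not (u i)) ℕ.+ cnt (not ∘ u) i) ∎
  where open ≡-Reasoning
... | tri≈ _ ≡.refl _ = begin
  bit (not (remove p u p)) ℕ.+ cnt (not ∘ remove p u) p
    ≡⟨ ≡.cong₂ (λ t c → bit (not t) ℕ.+ c) (remove-≡ p u) (cnt-remove-not up p) ⟩
  suc (bit (does (p ℕ.<? p)) ℕ.+ cnt (not ∘ u) p)
    ≡⟨ ≡.cong (λ t → suc (bit t ℕ.+ cnt (not ∘ u) p)) (dec-false (p ℕ.<? p) (ℕ.<-irrefl ≡.refl)) ⟩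
  suc (cnt (not ∘ u) p)
    ≡⟨ ≡.cong (λ t → suc (bit (not t) ℕ.+ cnt (not ∘ u) p)) up ⟨
  suc (bit (not (u p)) ℕ.+ cnt (not ∘ u) p)
    ≡⟨ ≡.cong (λ t → bit t ℕ.+ (bit (not (u p)) ℕ.+ cnt (not ∘ u) p)) (dec-true (p ℕ.<? suc p) ℕ.≤-refl) ⟨
  bit (does (p ℕ.<? suc p)) ℕ.+ (bit (not (u p)) ℕ.+ cnt (not ∘ u) p) ∎
  where open ≡-Reasoning
... | tri> p≮i p≢i i<p = begin
  bit (not (remove p u i)) ℕ.+ cnt (not ∘ remove p u) i
    ≡⟨ ≡.cong₂ (λ t c → bit (not t) ℕ.+ c) (remove-≢ u (p≢i ∘ ≡.sym)) (cnt-remove-not up i) ⟩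
  bit (not (u i)) ℕ.+ (bit (does (p ℕ.<? i)) ℕ.+ cnt (not ∘ u) i)
    ≡⟨ ≡.cong (λ t → bit (not (u i)) ℕ.+ (bit t ℕ.+ cnt (not ∘ u) i)) (dec-false (p ℕ.<? i) p≮i) ⟩
  bit (not (u i)) ℕ.+ cnt (not ∘ u) i
    ≡⟨ ≡.cong (λ t → bit t ℕ.+ (bit (not (u i)) ℕ.+ cnt (not ∘ u) i))
        (dec-false (p ℕ.<? suc i) (λ p<1+i → ℕ.<-irrefl ≡.refl (ℕ.≤-trans p<1+i i<p))) ⟨
  bit (does (p ℕ.<? suc i)) ℕ.+ (bit (not (u i)) ℕ.+ cnt (not ∘ u) i) ∎
  where open ≡-Reasoning

fresh : ℕ → Bool
fresh _ = true

cnt-fresh : ∀ p → cnt (not ∘ fresh) p ≡ 0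
cnt-fresh zero    = ≡.refl
cnt-fresh (suc p) = cnt-fresh p

-- Labels above, in and below the block

data Kind : Set where
  right block left : Kind

Counts : Set
Counts = ℕ × ℕ × ℕ

bump : Kind → Counts → Counts
bump right (a , j , b) = suc a , j , b
bump block (a , j , b) = a , suc j , b
bump left  (a , j , b) = a , j , suc b

total : Counts → ℕ
total (a , j , b) = a ℕ.+ b ℕ.+ j

infixl 6 _⊕_
_⊕_ : Counts → Counts → Counts
(a , j , b) ⊕ (a′ , j′ , b′) = a ℕ.+ a′ , j ℕ.+ j′ , b ℕ.+ b′

total-bump : ∀ κ P → total (bump κ P) ≡ suc (total P)
total-bump right P           = ≡.refl
total-bump block (a , j , b) = ℕ.+-suc (a ℕ.+ b) j
total-bump left  (a , j , b) = ≡.cong (ℕ._+ j) (ℕ.+-suc a b)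

bump-⊕ : ∀ κ P Q → bump κ P ⊕ Q ≡ P ⊕ bump κ Q
bump-⊕ right (a , j , b) (a′ , j′ , b′) = ≡.cong (λ t → t , j ℕ.+ j′ , b ℕ.+ b′) (≡.sym (ℕ.+-suc a a′))
bump-⊕ block (a , j , b) (a′ , j′ , b′) = ≡.cong (λ t → a ℕ.+ a′ , t , b ℕ.+ b′) (≡.sym (ℕ.+-suc j j′))
bump-⊕ left  (a , j , b) (a′ , j′ , b′) = ≡.cong (λ t → a ℕ.+ a′ , j ℕ.+ j′ , t) (≡.sym (ℕ.+-suc b b′))

total-⊕ : ∀ P Q → total (P ⊕ Q) ≡ total P ℕ.+ total Q
total-⊕ (a , j , b) (a′ , j′ , b′) = regroup a j b a′ j′ b′
  where
  regroup : ∀ a j b a′ j′ b′ → (a ℕ.+ a′) ℕ.+ (b ℕ.+ b′) ℕ.+ (j ℕ.+ j′) ≡ (a ℕ.+ b ℕ.+ j) ℕ.+ (a′ ℕ.+ b′ ℕ.+ j′)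
  regroup = solve-∀

∅ : Counts
∅ = 0 , 0 , 0

⊕-∅ : ∀ P → P ⊕ ∅ ≡ P
⊕-∅ (a , j , b) = ≡.cong₂ _,_ (ℕ.+-identityʳ a) (≡.cong₂ _,_ (ℕ.+-identityʳ j) (ℕ.+-identityʳ b))

-- Labels are numbered from 0: the block is a₀, …, a₀ + k - 1, and u tells which labels are unused.
module Labels (a₀ k : ℕ) where

  kind : ℕ → Kind
  kind p = if does (p ℕ.<? a₀) then left else if does (p ℕ.<? a₀ ℕ.+ k) then block else right

  kind-left : ∀ {p} → p < a₀ → kind p ≡ left
  kind-left {p} p<a₀ rewrite dec-true (p ℕ.<? a₀) p<a₀ = ≡.refl

  kind-block : ∀ {p} → a₀ ≤ p → p < a₀ ℕ.+ k → kind p ≡ block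
  kind-block {p} a₀≤p p<c rewrite dec-false (p ℕ.<? a₀) (ℕ.≤⇒≯ a₀≤p) | dec-true (p ℕ.<? a₀ ℕ.+ k) p<c = ≡.refl

  kind-right : ∀ {p} → a₀ ℕ.+ k ≤ p → kind p ≡ right
  kind-right {p} c≤p
    rewrite dec-false (p ℕ.<? a₀) (ℕ.≤⇒≯ (ℕ.≤-trans (ℕ.m≤m+n a₀ k) c≤p)) | dec-false (p ℕ.<? a₀ ℕ.+ k) (ℕ.≤⇒≯ c≤p) =
        ≡.refl

  data KindView (p : ℕ) : Set where
    left  : p < a₀ → kind p ≡ left → KindView p
    block : a₀ ≤ p → p < a₀ ℕ.+ k → kind p ≡ block → KindView p
    right : a₀ ℕ.+ k ≤ p → kind p ≡ right → KindView p

  kindView : ∀ p → KindView p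
  kindView p with p ℕ.<? a₀ | p ℕ.<? a₀ ℕ.+ k
  ... | yes p<a₀ | _       = left p<a₀ (kind-left p<a₀)
  ... | no p≮a₀  | yes p<c = block (ℕ.≮⇒≥ p≮a₀) p<c (kind-block (ℕ.≮⇒≥ p≮a₀) p<c)
  ... | no _     | no p≮c  = right (ℕ.≮⇒≥ p≮c) (kind-right (ℕ.≮⇒≥ p≮c))

  kind≡left : ∀ {p} → kind p ≡ left → p < a₀
  kind≡left {p} eq with kindView p
  ... | left p<a₀ _   = p<a₀
  ... | block _ _ eq′ with () ← ≡.trans (≡.sym eq) eq′
  ... | right _ eq′   with () ← ≡.trans (≡.sym eq) eq′

  kind≡block : ∀ {p} → kind p ≡ block → a₀ ≤ p × p < a₀ ℕ.+ k
  kind≡block {p} eq with kindView p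
  ... | block a₀≤p p<c _ = a₀≤p , p<c
  ... | left _ eq′    with () ← ≡.trans (≡.sym eq) eq′
  ... | right _ eq′   with () ← ≡.trans (≡.sym eq) eq′

  kind≡right : ∀ {p} → kind p ≡ right → a₀ ℕ.+ k ≤ p
  kind≡right {p} eq with kindView p
  ... | right c≤p _   = c≤p
  ... | left _ eq′    with () ← ≡.trans (≡.sym eq) eq′
  ... | block _ _ eq′ with () ← ≡.trans (≡.sym eq) eq′

  bumpIf : Bool → ℕ → Counts → Counts
  bumpIf t p P = if t then bump (kind p) P else P

  remaining : (ℕ → Bool) → ℕ → Counts
  remaining u zero    = ∅
  remaining u (suc p) = bumpIf (u p) p (remaining u p)

  passed : (ℕ → Bool) → ℕ → ℕ → Counts
  passed u p zero    = ∅
  passed u p (suc d) = bumpIf (u p) p (passed u (suc p) d)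

  total-remaining : ∀ u p → total (remaining u p) ≡ cnt u p
  total-remaining u zero    = ≡.refl
  total-remaining u (suc p) with u p
  ... | true  = ≡.trans (total-bump (kind p) (remaining u p)) (≡.cong suc (total-remaining u p))
  ... | false = total-remaining u p

  passed-⊕ : ∀ u p d → passed u p d ⊕ remaining u p ≡ remaining u (d ℕ.+ p)
  passed-⊕ u p zero    = ≡.refl
  passed-⊕ u p (suc d) = ≡.trans (move (u p) ≡.refl)
      (≡.trans (passed-⊕ u (suc p) d) (≡.cong (remaining u) (ℕ.+-suc d p)))
    where
    move : ∀ t → u p ≡ t → bumpIf t p (passed u (suc p) d) ⊕ remaining u p ≡ passed u (suc p) d ⊕ remaining u (suc p)
    move t eq rewrite eq with t
    ... | true  = bump-⊕ (kind p) (passed u (suc p) d) (remaining u p)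
    ... | false = ≡.refl

  total-passed : ∀ u p d → total (passed u p d) ℕ.+ cnt u p ≡ cnt u (d ℕ.+ p)
  total-passed u p d = begin
    total (passed u p d) ℕ.+ cnt u p                    ≡⟨ ≡.cong (total (passed u p d) ℕ.+_) (total-remaining u p) ⟨
    total (passed u p d) ℕ.+ total (remaining u p)      ≡⟨ total-⊕ (passed u p d) (remaining u p) ⟨
    total (passed u p d ⊕ remaining u p)                ≡⟨ ≡.cong total (passed-⊕ u p d) ⟩
    total (remaining u (d ℕ.+ p))                       ≡⟨ total-remaining u (d ℕ.+ p) ⟩
    cnt u (d ℕ.+ p)                                     ∎
    where open ≡-Reasoning

  passed-cong : ∀ {u w} p d → (∀ i → p ≤ i → u i ≡ w i) → passed u p d ≡ passed w p d
  passed-cong p zero    eq = ≡.refl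
  passed-cong p (suc d) eq =
    ≡.cong₂ (λ t → bumpIf t p) (eq p ℕ.≤-refl) (passed-cong (suc p) d (λ i p<i → eq i (ℕ.<⇒≤ p<i)))

  -- With `remaining-block`, this says that a downward scan meets the kinds in the order right,
  -- block, left, which is the order of the clauses of `level`.
  remaining-right : ∀ u p → p ≤ a₀ ℕ.+ k → proj₁ (remaining u p) ≡ 0
  remaining-right u zero    _   = ≡.refl
  remaining-right u (suc p) p<c with u p | kind p in eq
  ... | false | _     = remaining-right u p (ℕ.<⇒≤ p<c)
  ... | true  | left  = remaining-right u p (ℕ.<⇒≤ p<c)
  ... | true  | block = remaining-right u p (ℕ.<⇒≤ p<c)
  ... | true  | right = ⊥-elim (ℕ.<⇒≱ p<c (kind≡right eq))

  remaining-block : ∀ u p → p ≤ a₀ → proj₁ (proj₂ (remaining u p)) ≡ 0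
  remaining-block u zero    _    = ≡.refl
  remaining-block u (suc p) p<a₀ rewrite kind-left p<a₀ with u p
  ... | false = remaining-block u p (ℕ.<⇒≤ p<a₀)
  ... | true  = remaining-block u p (ℕ.<⇒≤ p<a₀)

  passed-block : Counts → ℕ
  passed-block (_ , j , _) = j

  -- `emit` only sees a count of larger block labels, whereas words need actual labels; this lemma
  -- and `block-passed` translate between the two.
  no-block-passed : ∀ u p d → passed-block (passed u p d) ≡ 0 →
                    ∀ q → p ≤ q → q < d ℕ.+ p → kind q ≡ block → u q ≢ true
  no-block-passed u p zero    _  q p≤q q<p κ uq = ℕ.<-irrefl ≡.refl (ℕ.≤-trans q<p p≤q)
  no-block-passed u p (suc d) j≡0 q p≤q q<  κ uq with q ℕ.≟ p
  no-block-passed u p (suc d) j≡0 q p≤q q<  κ uq | yes ≡.refl rewrite uq | κ with () ← j≡0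
  no-block-passed u p (suc d) j≡0 q p≤q q<  κ uq | no q≢p =
    no-block-passed u (suc p) d (unbump (u p) (kind p) j≡0) q (ℕ.≤∧≢⇒< p≤q (q≢p ∘ ≡.sym))
        (≡.subst (q <_) (≡.sym (ℕ.+-suc d p)) q<) κ uq
    where
    unbump : ∀ t κ {P} → passed-block (if t then bump κ P else P) ≡ 0 → passed-block P ≡ 0
    unbump false _     eq = eq
    unbump true  right eq = eq
    unbump true  left  eq = eq

  block-passed : ∀ u p d {j} → passed-block (passed u p d) ≡ suc j →
                 ∃ λ q → p ≤ q × kind q ≡ block × u q ≡ true
  block-passed u p (suc d) eq with u p in up | kind p in κ
  ... | true  | block = p , ℕ.≤-refl , κ , up
  ... | true  | right with (q , p<q , rest) ← block-passed u (suc p) d eq = q , ℕ.<⇒≤ p<q , rest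
  ... | true  | left  with (q , p<q , rest) ← block-passed u (suc p) d eq = q , ℕ.<⇒≤ p<q , rest
  ... | false | _     with (q , p<q , rest) ← block-passed u (suc p) d eq = q , ℕ.<⇒≤ p<q , rest

  remaining-fresh : ∀ d → remaining fresh (d ℕ.+ (a₀ ℕ.+ k)) ≡ (d , k , a₀)
  remaining-fresh (suc d)
    rewrite kind-right (ℕ.m≤n+m (a₀ ℕ.+ k) d) = ≡.cong (bump right) (remaining-fresh d)
  remaining-fresh zero = ≡.trans (≡.cong (remaining fresh) (ℕ.+-comm a₀ k)) (blocks k ℕ.≤-refl)
    where
    lefts : ∀ p → p ≤ a₀ → remaining fresh p ≡ (0 , 0 , p)
    lefts zero    _    = ≡.refl
    lefts (suc p) p<a₀ rewrite kind-left p<a₀ = ≡.cong (bump left) (lefts p (ℕ.<⇒≤ p<a₀))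

    blocks : ∀ l → l ≤ k → remaining fresh (l ℕ.+ a₀) ≡ (0 , l , a₀)
    blocks zero    _   = lefts a₀ ℕ.≤-refl
    blocks (suc l) l<k
      rewrite kind-block (ℕ.m≤n+m a₀ l) (≡.subst (l ℕ.+ a₀ <_) (ℕ.+-comm k a₀) (ℕ.+-monoˡ-< a₀ l<k)) =
      ≡.cong (bump block) (blocks l (ℕ.<⇒≤ l<k))

-- The recursion along a partial word, and its telescoping

module Scan {c ℓ} (A : CommutativeRing c ℓ)
  (x : CommutativeRing.Carrier A) (v : ℕ → CommutativeRing.Carrier A) (v-inverse : Reciprocals A x v)
  (a₀ k : ℕ) where

  open CommutativeRing A hiding (zero)
  open RawSemiringDefinitions (Semiring.rawSemiring semiring) using (_^_)
  open IntegerSolver A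
  open Signs A
  open FiniteSums A
  open LevelSum A x v v-inverse using (F; level; level≈F)
  open Labels a₀ k
  open SetoidReasoning setoid

  F′ weight : Counts → Carrier
  F′ (a , j , b) = F a j b
  weight P       = x ^ total P * F′ P

  -- A letter of the block may only be read after all larger letters of the block.
  emit : Kind → Counts → Carrier → Carrier
  emit block (a , suc j , b) y = 0#
  emit block (a , zero  , b) y = y
  emit right P               y = y
  emit left  P               y = y

  -- level for the labels unused in a partial word: those below p are undecided, P counts the others.
  scan : (ℕ → Bool) → ℕ → Counts → Carrier
  scan u zero    P = weight P
  scan u (suc p) P =
    if u p then scan u p (bump (kind p) P) + emit (kind p) P (sg (total P) * scan u p P) else scan u p P

  scan-true : ∀ u p P → u p ≡ true →
    scan u (suc p) P ≡ scan u p (bump (kind p) P) + emit (kind p) P (sg (total P) * scan u p P)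
  scan-true u p P eq rewrite eq = ≡.refl

  scan-false : ∀ u p P → u p ≡ false → scan u (suc p) P ≡ scan u p P
  scan-false u p P eq rewrite eq = ≡.refl

  scan-cong : ∀ {u w} p P → (∀ i → i < p → u i ≡ w i) → scan u p P ≡ scan w p P
  scan-cong zero P eq = ≡.refl
  scan-cong {u} {w} (suc p) P eq rewrite eq p ℕ.≤-refl =
    ≡.cong₂ (λ y z → if w p then y + emit (kind p) P (sg (total P) * z) else z)
      (scan-cong p (bump (kind p) P) below) (scan-cong p P below)
    where
    below : ∀ i → i < p → u i ≡ w i
    below i i<p = eq i (ℕ.m<n⇒m<1+n i<p)

  level′ : Counts → Counts → Carrier
  level′ (a , j , b) (r , k , l) = level a r j k b l

  private
    -- `level` decides labels in a fixed order, hence the premises that nothing of a higher kind is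
    -- undecided. The cases on `j` match those of `level` and `emit`: below a positive block label
    -- the value 0 is excluded.
    level-step : ∀ κ r k l (S : Counts → Carrier) →
      (∀ P → S P ≈ level′ P (r , k , l)) →
      (κ ≡ left → r ≡ 0 × k ≡ 0) → (κ ≡ block → r ≡ 0) → ∀ P →
      S (bump κ P) + emit κ P (sg (total P) * S P) ≈ level′ P (bump κ (r , k , l))
    level-step right r k l S ih _ _ (a , j , b) = +-cong (ih _) (*-congˡ (ih _))
    level-step block r k l S ih _ r≡0 (a , j , b) with r≡0 ≡.refl
    level-step block r k l S ih _ r≡0 (a , zero  , b) | ≡.refl = +-cong (ih _) (*-congˡ (ih _))
    level-step block r k l S ih _ r≡0 (a , suc j , b) | ≡.refl = trans (+-identityʳ _) (ih _)
    level-step left r k l S ih rk≡0 _ (a , j , b) with rk≡0 ≡.refl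
    level-step left r k l S ih rk≡0 _ (a , zero  , b) | ≡.refl , ≡.refl = +-cong (ih _) (*-congˡ (ih _))
    level-step left r k l S ih rk≡0 _ (a , suc j , b) | ≡.refl , ≡.refl = +-cong (ih _) (*-congˡ (ih _))

  scan≈level : ∀ u p P → scan u p P ≈ level′ P (remaining u p)
  scan≈level u zero    (a , zero  , b) = refl
  scan≈level u zero    (a , suc j , b) = refl
  scan≈level u (suc p) P with u p
  ... | false = scan≈level u p P
  ... | true  = level-step (kind p) _ _ _ (scan u p) (scan≈level u p)
    (λ κ → let p<a₀ = kind≡left κ in
      remaining-right u p (ℕ.≤-trans (ℕ.<⇒≤ p<a₀) (ℕ.m≤m+n a₀ k)) , remaining-block u p (ℕ.<⇒≤ p<a₀))
    (λ κ → remaining-right u p (ℕ.<⇒≤ (proj₂ (kind≡block κ)))) P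

  -- The parity of the pairs of an unused letter and a smaller used one; it relates the inversions counted
  -- among the letters already read to those counted by level among the letters still to come.
  κ : (ℕ → Bool) → ℕ → Carrier
  κ u zero    = 1#
  κ u (suc p) = (if u p then sg (cnt (not ∘ u) p) else 1#) * κ u p

  κ-cong : ∀ {u w} p → (∀ i → i < p → u i ≡ w i) → κ u p ≡ κ w p
  κ-cong zero    eq = ≡.refl
  κ-cong {u} {w} (suc p) eq =
    ≡.cong₂ _*_ (≡.cong₂ (λ t n → if t then sg n else 1#) (eq p ℕ.≤-refl)
        (cnt-cong p (λ i i<p → ≡.cong not (below i i<p))))
      (κ-cong p below)
    where
    below : ∀ i → i < p → u i ≡ w i
    below i i<p = eq i (ℕ.m<n⇒m<1+n i<p)

  private
    κ-remove′ : ∀ u p → u p ≡ true → ∀ d →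
      sg (cnt (not ∘ u) p) * κ (remove p u) (d ℕ.+ suc p) * sg (cnt u (suc p)) ≈ κ u (d ℕ.+ suc p) * sg
          (cnt u (d ℕ.+ suc p))
    κ-remove′ u p up zero = *-congʳ (begin
      sg (cnt (not ∘ u) p) * κ (remove p u) (suc p)
        ≡⟨ ≡.cong₂ (λ t K → sg (cnt (not ∘ u) p) * ((if t then sg (cnt (not ∘ remove p u) p) else 1#) * K))
            (remove-≡ p u)
             (κ-cong p (λ i i<p → remove-≢ u (ℕ.<⇒≢ i<p))) ⟩
      sg (cnt (not ∘ u) p) * (1# * κ u p)
        ≈⟨ *-congˡ (*-identityˡ _) ⟩
      sg (cnt (not ∘ u) p) * κ u p
        ≡⟨ ≡.cong (λ t → (if t then sg (cnt (not ∘ u) p) else 1#) * κ u p) up ⟨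
      κ u (suc p) ∎)
    κ-remove′ u p up (suc d) = begin
      s * ((if remove p u N then sg (cnt (not ∘ remove p u) N) else 1#) * K′) * s₁
        ≡⟨ ≡.cong₂ (λ t m → s * ((if t then sg m else 1#) * K′) * s₁) (remove-≢ u (ℕ.<⇒≢ p<N ∘ ≡.sym)) more ⟩
      s * ((if u N then sg (suc (cnt (not ∘ u) N)) else 1#) * K′) * s₁
        ≈⟨ branch (u N) ⟩
      (if u N then sg (cnt (not ∘ u) N) else 1#) * κ u N * sg (bit (u N) ℕ.+ cnt u N) ∎
      where
      N = d ℕ.+ suc p
      K′ = κ (remove p u) N
      s = sg (cnt (not ∘ u) p)
      s₁ = sg (cnt u (suc p))
      p<N : p < N
      p<N = ℕ.m≤n+m (suc p) d
      more : cnt (not ∘ remove p u) N ≡ suc (cnt (not ∘ u) N)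
      more = ≡.trans (cnt-remove-not up N) (≡.cong (λ t → bit t ℕ.+ cnt (not ∘ u) N) (dec-true (p ℕ.<? N) p<N))
      branch : ∀ t → s * ((if t then sg (suc (cnt (not ∘ u) N)) else 1#) * K′) * s₁
                   ≈ (if t then sg (cnt (not ∘ u) N) else 1#) * κ u N * sg (bit t ℕ.+ cnt u N)
      branch true = begin
        s * (- 1# * sg (cnt (not ∘ u) N) * K′) * s₁
          ≈⟨ solve 4 (λ s y z w → s :* (:- :1 :* y :* z) :* w := :- :1 :* y :* (s :* z :* w)) refl s
              (sg (cnt (not ∘ u) N)) K′ s₁ ⟩
        - 1# * sg (cnt (not ∘ u) N) * (s * K′ * s₁)    ≈⟨ *-congˡ (κ-remove′ u p up d) ⟩
        - 1# * sg (cnt (not ∘ u) N) * (κ u N * sg (cnt u N))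
          ≈⟨ solve 3 (λ y z w → :- :1 :* y :* (z :* w) := y :* z :* (:- :1 :* w)) refl (sg (cnt (not ∘ u) N)) (κ u N)
              (sg (cnt u N)) ⟩
        sg (cnt (not ∘ u) N) * κ u N * (- 1# * sg (cnt u N)) ∎
      branch false = trans (*-congʳ (*-congˡ (*-identityˡ _)))
          (trans (κ-remove′ u p up d) (*-congʳ (sym (*-identityˡ _))))

  κ-remove : ∀ u p d → u p ≡ true →
    sg (cnt (not ∘ u) p) * κ (remove p u) (d ℕ.+ suc p) ≈ κ u (d ℕ.+ suc p) * sg (total (passed u (suc p) d))
  κ-remove u p d up = begin
    y                      ≈⟨ *-identityʳ y ⟨
    y * 1#                 ≈⟨ *-congˡ (sg² (cnt u (suc p))) ⟨
    y * (s₁ * s₁)          ≈⟨ *-assoc _ _ _ ⟨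
    y * s₁ * s₁            ≈⟨ *-congʳ (κ-remove′ u p up d) ⟩
    κ u N * sg (cnt u N) * s₁    ≡⟨ ≡.cong (λ m → κ u N * sg m * s₁) (total-passed u (suc p) d) ⟨
    κ u N * sg (t ℕ.+ cnt u (suc p)) * s₁  ≈⟨ *-congʳ (*-congˡ (sg-+ t (cnt u (suc p)))) ⟩
    κ u N * (sg t * s₁) * s₁
      ≈⟨ solve 3 (λ K t s → K :* (t :* s) :* s := K :* t :* (s :* s)) refl (κ u N) (sg t) s₁ ⟩
    κ u N * sg t * (s₁ * s₁)     ≈⟨ *-congˡ (sg² (cnt u (suc p))) ⟩
    κ u N * sg t * 1#            ≈⟨ *-identityʳ _ ⟩
    κ u N * sg t                 ∎
    where
    N = d ℕ.+ suc p
    y = sg (cnt (not ∘ u) p) * κ (remove p u) N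
    s₁ = sg (cnt u (suc p))
    t = total (passed u (suc p) d)

  κ-fresh : ∀ p → κ fresh p ≈ 1#
  κ-fresh zero    = refl
  κ-fresh (suc p) = trans (*-cong (reflexive (≡.cong sg (cnt-fresh p))) (κ-fresh p)) (*-identityˡ 1#)

  κ-used : ∀ u p → (∀ i → i < p → u i ≡ false) → κ u p ≈ 1#
  κ-used u zero    eq = refl
  κ-used u (suc p) eq rewrite eq p ℕ.≤-refl = trans (*-identityˡ _) (κ-used u p (λ i i<p → eq i (ℕ.m<n⇒m<1+n i<p)))

  module Telescope (n : ℕ) (u : ℕ → Bool) where

    above : ℕ → Counts
    above p = passed u p (n ∸ p)

    ε : ℕ → Carrier
    ε p = scan u p (above p)

    -- The signed contribution of reading the letter p next.
    e : ℕ → Carrier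
    e p = if u p then emit (kind p) (above (suc p)) (sg (total (above (suc p))) * scan u p (above (suc p))) else 0#

    e-used : ∀ p → u p ≡ false → e p ≡ 0#
    e-used p eq rewrite eq = ≡.refl

    F-all : Carrier
    F-all = F′ (remaining u n)

    above-suc : ∀ p → p < n → above p ≡ bumpIf (u p) p (above (suc p))
    above-suc p p<n = ≡.cong (passed u p) (ℕ.+-∸-assoc 1 p<n)

    -- Going from `p` to `suc p` admits exactly the functions whose largest label of value 0 is `p`,
    -- and these correspond to reading `p` next.
    ε-step : ∀ p → p < n → ε (suc p) ≈ ε p + e p
    ε-step p p<n = trans (go (u p) ≡.refl) (+-congʳ (reflexive (≡.cong (scan u p) (≡.sym (above-suc p p<n)))))
      where
      P = above (suc p)
      go : ∀ t → u p ≡ t → scan u (suc p) P ≈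
           scan u p (bumpIf t p P) + (if t then emit (kind p) P (sg (total P) * scan u p P) else 0#)
      go true  eq = reflexive (scan-true u p P eq)
      go false eq = trans (reflexive (scan-false u p P eq)) (sym (+-identityʳ _))

    ε-top : ε n ≈ F-all
    ε-top = begin
      scan u n (passed u n (n ∸ n))   ≡⟨ ≡.cong (λ d → scan u n (passed u n d)) (ℕ.n∸n≡0 n) ⟩
      scan u n ∅                      ≈⟨ scan≈level u n ∅ ⟩
      level′ ∅ (remaining u n)        ≈⟨ level≈F (proj₁ R) (proj₁ (proj₂ R)) (proj₂ (proj₂ R)) ⟩
      F-all                           ∎
      where R = remaining u n

    ε-bottom : ε 0 ≈ x ^ cnt u n * F-all
    ε-bottom = begin
      weight (passed u 0 n)
        ≡⟨ ≡.cong weight (≡.trans (≡.sym (⊕-∅ (passed u 0 n)))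
            (≡.trans (passed-⊕ u 0 n) (≡.cong (remaining u) (ℕ.+-identityʳ n)))) ⟩
      weight (remaining u n)           ≡⟨ ≡.cong (λ m → x ^ m * F-all) (total-remaining u n) ⟩
      x ^ cnt u n * F-all              ∎

    Σe-lower : ∀ p → p ≤ n → ε 0 + Σ< p e ≈ ε p
    Σe-lower zero    _   = +-identityʳ _
    Σe-lower (suc p) p<n = begin
      ε 0 + (Σ< p e + e p)    ≈⟨ +-assoc _ _ _ ⟨
      ε 0 + Σ< p e + e p      ≈⟨ +-congʳ (Σe-lower p (ℕ.<⇒≤ p<n)) ⟩
      ε p + e p               ≈⟨ ε-step p p<n ⟨
      ε (suc p)               ∎

    -- All functions minus those without the value 0; lowering the latter by 1 everywhere gives
    -- `x ^ cnt u n` times the whole series again.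
    Σe-all : Σ< n e ≈ F-all - x ^ cnt u n * F-all
    Σe-all = begin
      Σ< n e                              ≈⟨ solve 2 (λ a s → s := (a :+ s) :- a) refl (ε 0) (Σ< n e) ⟩
      (ε 0 + Σ< n e) - ε 0                ≈⟨ +-cong (trans (Σe-lower n ℕ.≤-refl) ε-top) (-‿cong ε-bottom) ⟩
      F-all - x ^ cnt u n * F-all         ∎

    module Letters (i₀ z₀ : ℕ) (i₀<n : i₀ < n) (u[i₀] : u i₀ ≡ false) (τ : Carrier) where

      -- The order on colored integers in terms of numbers: `(i₀ , z₀)`, the letter read last, is
      -- the smaller one, so that writing `(i , z)` in front of it makes a descent, of weight `τ`.
      precedes : ℕ → ℕ → Bool
      precedes i z = does (z ℕ.<? z₀) ∨ (does (z₀ ℕ.≟ z) ∧ does (i₀ ℕ.<? i))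

      factor : ℕ → ℕ → Carrier
      factor i z = if precedes i z then τ else 1#

      row : ℕ → Carrier
      row z = Σ< n (λ i → factor i z * e i)

      private
        factor-below : ∀ i z → z < z₀ → factor i z ≡ τ
        factor-below i z z<z₀ rewrite dec-true (z ℕ.<? z₀) z<z₀ = ≡.refl

        factor-above : ∀ i z → z₀ < z → factor i z ≡ 1#
        factor-above i z z₀<z
          rewrite dec-false (z ℕ.<? z₀) (ℕ.<⇒≯ z₀<z) | dec-false (z₀ ℕ.≟ z) (ℕ.<⇒≢ z₀<z) = ≡.refl

        factor-left : ∀ i → i < suc i₀ → factor i z₀ ≡ 1#
        factor-left i i≤i₀
          rewrite dec-false (z₀ ℕ.<? z₀) (ℕ.<-irrefl ≡.refl) | dec-true (z₀ ℕ.≟ z₀) ≡.refl | dec-false (i₀ ℕ.<? i)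
              (ℕ.≤⇒≯ (ℕ.≤-pred i≤i₀)) = ≡.refl

        factor-right : ∀ i → i₀ < i → factor i z₀ ≡ τ
        factor-right i i₀<i
          rewrite dec-false (z₀ ℕ.<? z₀) (ℕ.<-irrefl ≡.refl) | dec-true (z₀ ℕ.≟ z₀) ≡.refl | dec-true (i₀ ℕ.<? i) i₀<i =
              ≡.refl

      t S B : Carrier
      t = x ^ cnt u n
      S = F-all - t * F-all
      B = (ε i₀ - t * F-all) + τ * (F-all - ε i₀)

      row-below : ∀ z → z < z₀ → row z ≈ τ * S
      row-below z z<z₀ = begin
        row z                   ≈⟨ Σ<-cong n (λ i _ → *-congʳ (reflexive (factor-below i z z<z₀))) ⟩
        Σ< n (λ i → τ * e i)    ≈⟨ Σ<-*ˡ n τ e ⟩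
        τ * Σ< n e              ≈⟨ *-congˡ Σe-all ⟩
        τ * S                   ∎

      row-above : ∀ z → z₀ < z → row z ≈ S
      row-above z z₀<z = begin
        row z          ≈⟨ Σ<-cong n (λ i _ → trans (*-congʳ (reflexive (factor-above i z z₀<z))) (*-identityˡ _)) ⟩
        Σ< n e         ≈⟨ Σe-all ⟩
        S              ∎

      private
        ε-same : ε (suc i₀) ≈ ε i₀
        ε-same = begin
          ε (suc i₀)       ≈⟨ ε-step i₀ i₀<n ⟩
          ε i₀ + e i₀      ≡⟨ ≡.cong (ε i₀ +_) (e-used i₀ u[i₀]) ⟩
          ε i₀ + 0#        ≈⟨ +-identityʳ _ ⟩
          ε i₀             ∎

        row-at′ : ∀ d → d ℕ.+ suc i₀ ≤ n →
          Σ< (d ℕ.+ suc i₀) (λ i → factor i z₀ * e i) ≈ (ε i₀ - ε 0) + τ * (ε (d ℕ.+ suc i₀) - ε i₀)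
        row-at′ zero    le = begin
          Σ< (suc i₀) (λ i → factor i z₀ * e i)
            ≈⟨ Σ<-cong (suc i₀) (λ i i≤i₀ → trans (*-congʳ (reflexive (factor-left i i≤i₀))) (*-identityˡ _)) ⟩
          Σ< (suc i₀) e                             ≈⟨ solve 2 (λ a s → s := (a :+ s) :- a) refl (ε 0) (Σ< (suc i₀) e) ⟩
          (ε 0 + Σ< (suc i₀) e) - ε 0               ≈⟨ +-congʳ (Σe-lower (suc i₀) le) ⟩
          ε (suc i₀) - ε 0                          ≈⟨ +-congʳ ε-same ⟩
          ε i₀ - ε 0
            ≈⟨ solve 3 (λ a b τ → a :- b := (a :- b) :+ τ :* (a :- a)) refl (ε i₀) (ε 0) τ ⟩
          (ε i₀ - ε 0) + τ * (ε i₀ - ε i₀)          ≈⟨ +-congˡ (*-congˡ (+-congʳ ε-same)) ⟨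
          (ε i₀ - ε 0) + τ * (ε (suc i₀) - ε i₀)    ∎
        row-at′ (suc d) le = begin
          Σ< N (λ i → factor i z₀ * e i) + factor N z₀ * e N
            ≈⟨ +-cong (row-at′ d (ℕ.<⇒≤ le)) (*-congʳ (reflexive (factor-right N (ℕ.m≤n+m (suc i₀) d)))) ⟩
          (ε i₀ - ε 0) + τ * (ε N - ε i₀) + τ * e N
            ≈⟨ solve 5 (λ a b τ y w → (a :- b) :+ τ :* (y :- a) :+ τ :* w := (a :- b) :+ τ :* ((y :+ w) :- a)) refl
                (ε i₀) (ε 0) τ (ε N) (e N) ⟩
          (ε i₀ - ε 0) + τ * ((ε N + e N) - ε i₀)
            ≈⟨ +-congˡ (*-congˡ (+-congʳ (ε-step N le))) ⟨
          (ε i₀ - ε 0) + τ * (ε (suc N) - ε i₀) ∎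
          where N = d ℕ.+ suc i₀

      -- In the color of the letter read last, the descent weight sets in just above `i₀`, which
      -- cuts the telescoping sum at `ε i₀`.
      row-at : row z₀ ≈ B
      row-at = begin
        row z₀
          ≈⟨ ≡.subst (λ N → Σ< N (λ i → factor i z₀ * e i) ≈ (ε i₀ - ε 0) + τ * (ε N - ε i₀)) n≡
               (row-at′ (n ∸ suc i₀) (ℕ.≤-reflexive n≡)) ⟩
        (ε i₀ - ε 0) + τ * (ε n - ε i₀)
          ≈⟨ +-cong (+-congˡ (-‿cong ε-bottom)) (*-congˡ (+-congʳ ε-top)) ⟩
        B ∎
        where
        n≡ : n ∸ suc i₀ ℕ.+ suc i₀ ≡ n
        n≡ = ℕ.m∸n+n≡m i₀<n

      rows-below : ∀ z → z ≤ z₀ → Σ< z (λ z → t ^ z * row z) ≈ τ * (F-all - t ^ z * F-all)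
      rows-below zero    _    = solve 2 (λ τ f → :0 := τ :* (f :- :1 :* f)) refl τ F-all
      rows-below (suc z) z<z₀ = begin
        Σ< z _ + t ^ z * row z
          ≈⟨ +-cong (rows-below z (ℕ.<⇒≤ z<z₀)) (*-congˡ (row-below z z<z₀)) ⟩
        τ * (F-all - t ^ z * F-all) + t ^ z * (τ * (F-all - t * F-all))
          ≈⟨ solve 4 (λ τ f t y → τ :* (f :- y :* f) :+ y :* (τ :* (f :- t :* f)) := τ :* (f :- t :* y :* f)) refl τ
              F-all t (t ^ z) ⟩
        τ * (F-all - t ^ suc z * F-all) ∎

      -- Smaller colors always make a descent and larger ones never do, so that on either side of
      -- `z₀` the sum telescopes over the colors as well.
      rows : ∀ d → Σ< (d ℕ.+ suc z₀) (λ z → t ^ z * row z)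
                 ≈ (t ^ z₀ * (ε i₀ - τ * ε i₀) + τ * F-all) - t ^ (d ℕ.+ suc z₀) * F-all
      rows zero = begin
        Σ< z₀ _ + t ^ z₀ * row z₀
          ≈⟨ +-cong (rows-below z₀ ℕ.≤-refl) (*-congˡ row-at) ⟩
        τ * (F-all - t ^ z₀ * F-all) + t ^ z₀ * ((ε i₀ - t * F-all) + τ * (F-all - ε i₀))
          ≈⟨ solve 5 (λ τ f t y w → τ :* (f :- y :* f) :+ y :* ((w :- t :* f) :+ τ :* (f :- w)) :=
              (y :* (w :- τ :* w) :+ τ :* f) :- t :* y :* f)
               refl τ F-all t (t ^ z₀) (ε i₀) ⟩
        (t ^ z₀ * (ε i₀ - τ * ε i₀) + τ * F-all) - t ^ suc z₀ * F-all ∎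
      rows (suc d) = begin
        Σ< N _ + t ^ N * row N
          ≈⟨ +-cong (rows d) (*-congˡ (row-above N (ℕ.m≤n+m (suc z₀) d))) ⟩
        (C - t ^ N * F-all) + t ^ N * (F-all - t * F-all)
          ≈⟨ solve 4 (λ c f t y → (c :- y :* f) :+ y :* (f :- t :* f) := c :- t :* y :* f) refl C F-all t (t ^ N) ⟩
        C - t ^ suc N * F-all ∎
        where
        N = d ℕ.+ suc z₀
        C = t ^ z₀ * (ε i₀ - τ * ε i₀) + τ * F-all

    -- For `τ = t ^ r` the gain from descents and the loss after all `r` colors are the same
    -- multiple of `F-all` and cancel. Only the value at the pointer survives, in the form required
    -- by the next instance of `Claim`.
    letters-after : ∀ r i₀ z₀ (i₀<n : i₀ < n) (u[i₀] : u i₀ ≡ false) → z₀ < r →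
      let t = x ^ cnt u n in
      Σ< n (λ i → Σ< r (λ z → Letters.factor i₀ z₀ i₀<n u[i₀] (t ^ r) i z * (t ^ z * e i))) ≈ (1# - t ^ r) *
          (t ^ z₀ * ε i₀)
    letters-after r i₀ z₀ i₀<n u[i₀] z₀<r = begin
      Σ< n (λ i → Σ< r (λ z → factor i z * (t ^ z * e i)))
        ≈⟨ Σ<-swap n r _ ⟩
      Σ< r (λ z → Σ< n (λ i → factor i z * (t ^ z * e i)))
        ≈⟨ Σ<-cong r (λ z _ → trans (Σ<-cong n (λ i _ → solve 3 (λ f y w → f :* (y :* w) := y :* (f :* w)) refl
            (factor i z) (t ^ z) (e i)))
                              (Σ<-*ˡ n (t ^ z) (λ i → factor i z * e i))) ⟩
      Σ< r (λ z → t ^ z * row z)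
        ≈⟨ ≡.subst (λ R → Σ< R (λ z → t ^ z * row z) ≈ (t ^ z₀ * (ε i₀ - t ^ r * ε i₀) + t ^ r * F-all) - t ^ R * F-all)
             (ℕ.m∸n+n≡m z₀<r) (rows (r ∸ suc z₀)) ⟩
      (t ^ z₀ * (ε i₀ - t ^ r * ε i₀) + t ^ r * F-all) - t ^ r * F-all
        ≈⟨ solve 4 (λ y w τ f → (y :* (w :- τ :* w) :+ τ :* f) :- τ :* f := (:1 :- τ) :* (y :* w)) refl (t ^ z₀) (ε i₀)
            (t ^ r) F-all ⟩
      (1# - t ^ r) * (t ^ z₀ * ε i₀) ∎
      where open Letters i₀ z₀ i₀<n u[i₀] ((x ^ cnt u n) ^ r)

    letters-first : ∀ r → let t = x ^ cnt u n in
      Σ< n (λ i → Σ< r (λ z → t ^ z * e i)) ≈ (1# - t ^ r) * F-all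
    letters-first r = begin
      Σ< n (λ i → Σ< r (λ z → t ^ z * e i))        ≈⟨ Σ<-swap n r _ ⟩
      Σ< r (λ z → Σ< n (λ i → t ^ z * e i))        ≈⟨ Σ<-cong r (λ z _ → trans (Σ<-*ˡ n (t ^ z) e) (*-congˡ Σe-all)) ⟩
      Σ< r (λ z → t ^ z * (F-all - t * F-all))     ≈⟨ powers r ⟩
      (1# - t ^ r) * F-all                         ∎
      where
      t = x ^ cnt u n
      powers : ∀ r → Σ< r (λ z → t ^ z * (F-all - t * F-all)) ≈ (1# - t ^ r) * F-all
      powers zero    = solve 1 (λ f → :0 := (:1 :- :1) :* f) refl F-all
      powers (suc r) = trans (+-congʳ (powers r))
        (solve 3 (λ f t y → (:1 :- y) :* f :+ y :* (f :- t :* f) := (:1 :- t :* y) :* f) refl F-all t (t ^ r))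

run : ℕ → ℕ → List ℕ
run a zero    = []
run a (suc l) = a ∷ run (suc a) l

applyUpTo≡run : ∀ (f : ℕ → ℕ) a l → (∀ i → f i ≡ a ℕ.+ i) → applyUpTo f l ≡ run a l
applyUpTo≡run f a zero    eq = ≡.refl
applyUpTo≡run f a (suc l) eq = ≡.cong₂ _∷_ (≡.trans (eq 0) (ℕ.+-identityʳ a))
  (applyUpTo≡run (f ∘ suc) (suc a) l (λ i → ≡.trans (eq (suc i)) (ℕ.+-suc a i)))

absent : ∀ {m} (s : Vec ℕ m) {y ys} → All (y ≢_) s → ¬ (y ∷ ys ⊆ toList s)
absent (x ∷ s) (y≢x ∷ y∉s) (x ∷ʳ τ)   = absent s y∉s τ
absent (x ∷ s) (y≢x ∷ y∉s) (y≡x ∷ τ) = y≢x y≡x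

present : ∀ {m} {s : Vec ℕ m} {y} → Any (y ≡_) s → ¬ All (y ≢_) s
present (here y≡x)  (y≢x ∷ _)   = y≢x y≡x
present (there y∈s) (_   ∷ y∉s) = present y∈s y∉s

run-∈ : ∀ {q} a l → a ≤ q → q < a ℕ.+ l → q ∷ [] ⊆ run a l
run-∈ {q} a zero    a≤q q< = contradiction (ℕ.≤-trans q< (ℕ.≤-trans (ℕ.≤-reflexive (ℕ.+-identityʳ a)) a≤q))
    (ℕ.<-irrefl ≡.refl)
run-∈ {q} a (suc l) a≤q q< with a ℕ.≟ q
... | yes ≡.refl = ≡.refl ∷ minimum _
... | no  a≢q    = a ∷ʳ run-∈ (suc a) l (ℕ.≤∧≢⇒< a≤q a≢q) (≡.subst (q <_) (ℕ.+-suc a l) q<)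

run-pair : ∀ {p q} a l → a ≤ p → p < q → q < a ℕ.+ l → p ∷ q ∷ [] ⊆ run a l
run-pair {p} {q} a zero a≤p p<q q< =
  contradiction (ℕ.≤-trans q< (ℕ.≤-trans (ℕ.≤-reflexive (ℕ.+-identityʳ a)) (ℕ.≤-trans a≤p (ℕ.<⇒≤ p<q))))
      (ℕ.<-irrefl ≡.refl)
run-pair {p} {q} a (suc l) a≤p p<q q< with a ℕ.≟ p
... | yes ≡.refl = ≡.refl ∷ run-∈ (suc a) l p<q (≡.subst (q <_) (ℕ.+-suc a l) q<)
... | no  a≢p    = a ∷ʳ run-pair (suc a) l (ℕ.≤∧≢⇒< a≤p a≢p) p<q (≡.subst (q <_) (ℕ.+-suc a l) q<)

cnt-remove : ∀ {u p} n → u p ≡ true → p < n → cnt u n ≡ suc (cnt (remove p u) n)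
cnt-remove {u} {p} n up p<n = ℕ.+-cancelˡ-≡ (cnt (not ∘ u) n) _ _ (begin
  cnt (not ∘ u) n ℕ.+ cnt u n                                 ≡⟨ cnt-complement u n ⟩
  n                                                           ≡⟨ cnt-complement (remove p u) n ⟨
  cnt (not ∘ remove p u) n ℕ.+ cnt (remove p u) n
    ≡⟨ ≡.cong (ℕ._+ cnt (remove p u) n) (cnt-remove-not up n) ⟩
  bit (does (p ℕ.<? n)) ℕ.+ cnt (not ∘ u) n ℕ.+ cnt (remove p u) n
    ≡⟨ ≡.cong (λ t → bit t ℕ.+ cnt (not ∘ u) n ℕ.+ cnt (remove p u) n) (dec-true (p ℕ.<? n) p<n) ⟩
  suc (cnt (not ∘ u) n ℕ.+ cnt (remove p u) n)                ≡⟨ ℕ.+-suc _ _ ⟨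
  cnt (not ∘ u) n ℕ.+ suc (cnt (remove p u) n)                ∎)
  where open ≡-Reasoning

cnt≡0 : ∀ u n → cnt u n ≡ 0 → ∀ i → i < n → u i ≡ false
cnt≡0 u (suc n) eq i i<1+n with u n in un
... | false with i ℕ.≟ n
...   | yes ≡.refl = un
...   | no  i≢n    = cnt≡0 u n eq i (ℕ.≤∧≢⇒< (ℕ.≤-pred i<1+n) i≢n)

-- Words are read from right to left; s is the part already read and m the number of letters to come.
module Suffixes (r n a₀ k : ℕ) (c≤n : a₀ ℕ.+ k ≤ n) where

  open Labels a₀ k

  record State (m : ℕ) (u : ℕ → Bool) {j} (s : Vec (ColoredInt r n) j) : Set where
    field
      unique   : Unique ∣ s ∣
      used     : ∀ i → u i ≡ false → Any (suc i ≡_) ∣ s ∣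
      unused   : ∀ i → u i ≡ true → All (suc i ≢_) ∣ s ∣
      smaller  : ∀ i → count (ℕ._<? suc i) ∣ s ∣ ≡ cnt (not ∘ u) i
      size     : cnt u n ≡ m
      -- The unused letters of the block are a₀, …, f - 1; the others occur in s in increasing order.
      f l      : ℕ
      a₀≤f     : a₀ ≤ f
      f+l      : f ℕ.+ l ≡ a₀ ℕ.+ k
      free     : ∀ t → a₀ ≤ t → t < f → u t ≡ true
      ordered  : run (suc f) l ⊆ toList ∣ s ∣

  W : List ℕ
  W = run (suc a₀) k

  -- An obstruction to every completion. Taking uniqueness as a premise covers repeated letters,
  -- where it fails, and wrongly ordered letters of the block by a single notion.
  Bad : ∀ {j} → Vec (ColoredInt r n) j → Set
  Bad s = Unique ∣ s ∣ → ∃₂ λ p q → (p ∷ q ∷ [] ⊆ W) × Any (p ≡_) ∣ s ∣ × ¬ (p ∷ q ∷ [] ⊆ toList ∣ s ∣)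

  -- Since `p` already occurs, a word without repetitions cannot have it again further left, so the
  -- missing pair stays missing.
  bad-∷ : ∀ {j} a {s : Vec (ColoredInt r n) j} → Bad s → Bad (a ∷ s)
  bad-∷ a bad (a∉s ∷ unique) with bad unique
  ... | p , q , pq⊆W , p∈s , pq⊈s = p , q , pq⊆W , there p∈s ,
    λ { (_ ∷ʳ τ)      → pq⊈s τ
      ; (≡.refl ∷ τ) → present p∈s a∉s }

  bad-used : ∀ {m u j i z} {s : Vec (ColoredInt r n) j} → State m u s → u (toℕ i) ≡ false → Bad ((i , z) ∷ s)
  bad-used {i = i} state eq (i∉s ∷ _) = contradiction i∉s (present (State.used state (toℕ i) eq))

  -- The larger letter `q` is still to come, and it can only come to the left of `i`.
  bad-blocked : ∀ {m u j i z q} {s : Vec (ColoredInt r n) j} → State m u s →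
    u (toℕ i) ≡ true → kind (toℕ i) ≡ block → toℕ i < q → kind q ≡ block → u q ≡ true → Bad ((i , z) ∷ s)
  bad-blocked {i = i} {q = q} {s} state ui κi i<q κq uq _ =
    suc (toℕ i) , suc q , run-pair (suc a₀) k (s≤s (proj₁ (kind≡block κi))) (s≤s i<q) (s≤s (proj₂ (kind≡block κq))) ,
    here ≡.refl ,
    λ { (_ ∷ʳ τ) → absent ∣ s ∣ (unused (toℕ i) ui) τ
      ; (_ ∷ τ)  → absent ∣ s ∣ (unused q uq) τ }
    where open State state

  state-∷ : ∀ {m u j z} i {s : Vec (ColoredInt r n) j} → State (suc m) u s → u (toℕ i) ≡ true →
    (kind (toℕ i) ≡ block → passed-block (passed u (suc (toℕ i)) (n ∸ suc (toℕ i))) ≡ 0) →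
    State m (remove (toℕ i) u) ((i , z) ∷ s)
  state-∷ {m} {u} {z = z} i {s} state ui first = record
    { unique  = unused p ui ∷ unique
    ; used    = used′
    ; unused  = unused′
    ; smaller = smaller′
    ; size    = ℕ.suc-injective (≡.trans (≡.sym (cnt-remove n ui (Fin.toℕ<n i))) size)
    ; f       = proj₁ frontier
    ; l       = proj₁ (proj₂ frontier)
    ; a₀≤f    = proj₁ (proj₂ (proj₂ frontier))
    ; f+l     = proj₁ (proj₂ (proj₂ (proj₂ frontier)))
    ; free    = proj₁ (proj₂ (proj₂ (proj₂ (proj₂ frontier))))
    ; ordered = proj₂ (proj₂ (proj₂ (proj₂ (proj₂ frontier))))
    }
    where
    open State state
    p : ℕ
    p = toℕ i

    used′ : ∀ j → remove p u j ≡ false → Any (suc j ≡_) ∣ (i , z) ∷ s ∣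
    used′ j eq with j ℕ.≟ p
    ... | yes ≡.refl = here ≡.refl
    ... | no  j≢p    = there (used j (≡.trans (≡.sym (remove-≢ u j≢p)) eq))

    unused′ : ∀ j → remove p u j ≡ true → All (suc j ≢_) ∣ (i , z) ∷ s ∣
    unused′ j eq with j ℕ.≟ p
    ... | yes ≡.refl with () ← ≡.trans (≡.sym (remove-≡ p u)) eq
    ... | no  j≢p    = (j≢p ∘ ℕ.suc-injective) ∷ unused j (≡.trans (≡.sym (remove-≢ u j≢p)) eq)

    smaller′ : ∀ j → count (ℕ._<? suc j) ∣ (i , z) ∷ s ∣ ≡ cnt (not ∘ remove p u) j
    smaller′ j = ≡.trans (head (does (p ℕ.<? j))) (≡.sym (cnt-remove-not ui j))
      where
      head : ∀ t → (if t then suc else id) (count (ℕ._<? suc j) ∣ s ∣) ≡ bit t ℕ.+ cnt (not ∘ u) j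
      head true  = ≡.cong suc (smaller j)
      head false = smaller j

    Frontier : Set
    Frontier = ∃₂ λ f l → a₀ ≤ f × f ℕ.+ l ≡ a₀ ℕ.+ k × (∀ t → a₀ ≤ t → t < f → remove p u t ≡ true) × run (suc f) l ⊆
        toList ∣ (i , z) ∷ s ∣

    same : (∀ t → a₀ ≤ t → t < f → t ≢ p) → Frontier
    same ≢p = f , l , a₀≤f , f+l ,
      (λ t a₀≤t t<f → ≡.trans (remove-≢ u (≢p t a₀≤t t<f)) (free t a₀≤t t<f)) , suc p ∷ʳ ordered

    p<f : p < a₀ ℕ.+ k → p < f
    p<f p<c with p ℕ.<? f
    ... | yes p<f = p<f
    ... | no  p≮f = contradiction
      (⊆-trans (run-∈ (suc f) l (s≤s (ℕ.≮⇒≥ p≮f)) (s≤s (≡.subst (p <_) (≡.sym f+l) p<c))) ordered)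
      (absent ∣ s ∣ (unused p ui))

    p-last : kind p ≡ block → suc p ≡ f
    p-last κ with suc p ℕ.≟ f
    ... | yes eq = eq
    ... | no  ≢f = contradiction (free (suc p) (ℕ.m≤n⇒m≤1+n (proj₁ (kind≡block κ))) 1+p<f)
      (no-block-passed u (suc p) (n ∸ suc p) (first κ) (suc p) ℕ.≤-refl
        (≡.subst (suc p <_) (≡.sym (ℕ.m∸n+n≡m (Fin.toℕ<n i))) (ℕ.<-≤-trans 1+p<c c≤n))
        (kind-block (ℕ.m≤n⇒m≤1+n (proj₁ (kind≡block κ))) 1+p<c))
      where
      1+p<f : suc p < f
      1+p<f = ℕ.≤∧≢⇒< (p<f (proj₂ (kind≡block κ))) ≢f
      1+p<c : suc p < a₀ ℕ.+ k
      1+p<c = ℕ.<-≤-trans 1+p<f (≡.subst (f ≤_) f+l (ℕ.m≤m+n f l))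

    frontier : Frontier
    frontier with kindView p
    ... | left p<a₀ _  = same (λ t a₀≤t _ t≡p → ℕ.<⇒≱ p<a₀ (≡.subst (a₀ ≤_) t≡p a₀≤t))
    ... | right c≤p _  = same (λ t _ t<f t≡p →
            ℕ.<⇒≱ (ℕ.<-≤-trans t<f (≡.subst (f ≤_) f+l (ℕ.m≤m+n f l))) (≡.subst (a₀ ℕ.+ k ≤_) (≡.sym t≡p) c≤p))
    ... | block a₀≤p p<c κ = p , suc l , a₀≤p ,
            ≡.trans (ℕ.+-suc p l) (≡.trans (≡.cong (ℕ._+ l) (p-last κ)) f+l) ,
            (λ t a₀≤t t<p → ≡.trans (remove-≢ u (ℕ.<⇒≢ t<p)) (free t a₀≤t (ℕ.<-trans t<p (p<f p<c)))) ,
            ≡.refl ∷ ≡.subst (λ g → run (suc g) l ⊆ toList ∣ s ∣) (≡.sym (p-last κ)) ordered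

  state-[] : State n fresh []
  state-[] = record
    { unique  = []
    ; used    = λ _ ()
    ; unused  = λ _ _ → []
    ; smaller = λ i → ≡.sym (cnt-fresh i)
    ; size    = ≡.trans (≡.cong (ℕ._+ cnt fresh n) (≡.sym (cnt-fresh n))) (cnt-complement fresh n)
    ; f       = a₀ ℕ.+ k
    ; l       = 0
    ; a₀≤f    = ℕ.m≤m+n a₀ k
    ; f+l     = ℕ.+-identityʳ _
    ; free    = λ _ _ _ → ≡.refl
    ; ordered = []
    }

  W⊆ : ∀ {u j} {s : Vec (ColoredInt r n) j} → State 0 u s → W ⊆ toList ∣ s ∣
  W⊆ {u} {s = s} state with State.f state ℕ.≟ a₀
  ... | yes eq = ≡.subst₂ (λ g m → run (suc g) m ⊆ toList ∣ s ∣) eq l≡k ordered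
    where
    open State state
    l≡k : l ≡ k
    l≡k = ℕ.+-cancelˡ-≡ a₀ l k (≡.trans (≡.cong (ℕ._+ l) (≡.sym eq)) f+l)
  ... | no f≢a₀ = contradiction (≡.trans (≡.sym (free a₀ ℕ.≤-refl a₀<f)) (cnt≡0 u n size a₀ a₀<n)) (λ ())
    where
    open State state
    a₀<f : a₀ < f
    a₀<f = ℕ.≤∧≢⇒< a₀≤f (f≢a₀ ∘ ≡.sym)
    a₀<n : a₀ < n
    a₀<n = ℕ.<-≤-trans a₀<f (ℕ.≤-trans (≡.subst (f ≤_) f+l (ℕ.m≤m+n f l)) c≤n)

-- The signed sum over words

module Words {c ℓ} (A : CommutativeRing c ℓ)
  (x : CommutativeRing.Carrier A) (v : ℕ → CommutativeRing.Carrier A) (v-inverse : Reciprocals A x v)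
  (r n a₀ k : ℕ) (c≤n : a₀ ℕ.+ k ≤ n) where

  open CommutativeRing A hiding (zero)
  open RawSemiringDefinitions (Semiring.rawSemiring semiring) using (_^_)
  open IntegerSolver A
  open Signs A
  open GeometricSums A using (1^)
  open FiniteSums A
  open LevelSum A x v v-inverse using (F)
  open ClosedForms A x v v-inverse using (Y)
  open Labels a₀ k
  open Scan A x v v-inverse a₀ k
  open Suffixes r n a₀ k c≤n
  open SetoidReasoning setoid
  open Exp semiring using (^-homo-*; ^-assocʳ)
  open CommutativeExp commutativeSemiring using (^-distrib-*)

  Letter : Set
  Letter = ColoredInt r n

  letters : List Letter
  letters = cartesianProduct (allFin n) (allFin r)

  -- s is the part of the word from position m + 1 onwards.
  term : ∀ {j} → ℕ → Vec Letter j → Carrier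
  term m s = sg (inv ∣ s ∣) * x ^ (r ℕ.* majFrom (suc m) s ℕ.+ col s)

  unique? : ∀ {j} (s : Vec Letter j) → Dec (Unique ∣ s ∣)
  unique? s = AllPairs.allPairs? (λ x y → ¬? (x ℕ.≟ y)) ∣ s ∣

  W′ : List ℕ
  W′ = applyUpTo (suc a₀ ℕ.+_) (suc (a₀ ℕ.+ k) ∸ suc a₀)

  W′≡W : W′ ≡ W
  W′≡W = ≡.trans (≡.cong (applyUpTo (suc a₀ ℕ.+_)) (ℕ.m+n∸m≡n a₀ k))
      (applyUpTo≡run (suc a₀ ℕ.+_) (suc a₀) k (λ _ → ≡.refl))

  -- Both filters of `H` become part of the summand, so that the letters of a word are summed over
  -- independently.
  restricted : ∀ {j} → Vec Letter j → Carrier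
  restricted s = if does (unique? s) then (if does (W′ ⊆? toList ∣ s ∣) then term 0 s else 0#) else 0#

  prefixes : ∀ m {j} → Vec Letter j → Carrier
  prefixes = Σ-prefix letters restricted

  prefixes-bad : ∀ m {j} {s : Vec Letter j} → Bad s → prefixes m s ≈ 0#
  prefixes-bad (suc m) bad = Σ-zero letters (λ a → prefixes-bad m (bad-∷ a bad))
  prefixes-bad zero {s = s} bad with unique? s
  ... | no _ = refl
  ... | yes unique with W′ ⊆? toList ∣ s ∣
  ...   | no _  = refl
  ...   | yes τ with p , q , pq⊆W , _ , pq⊈s ← bad unique =
    contradiction (⊆-trans pq⊆W (≡.subst (_⊆ toList ∣ s ∣) W′≡W τ)) pq⊈s

  prefixes-full : ∀ {u j} {s : Vec Letter j} → State 0 u s → prefixes 0 s ≡ term 0 s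
  prefixes-full {s = s} state
    rewrite dec-true (unique? s) (State.unique state)
          | dec-true (W′ ⊆? toList ∣ s ∣) (≡.subst (_⊆ toList ∣ s ∣) (≡.sym W′≡W) (W⊆ state)) = ≡.refl

  scan-used : ∀ u p P → (∀ i → i < p → u i ≡ false) → scan u p P ≡ weight P
  scan-used u zero    P eq = ≡.refl
  scan-used u (suc p) P eq = ≡.trans (scan-false u p P (eq p ℕ.≤-refl))
      (scan-used u p P (λ i i<p → eq i (ℕ.m<n⇒m<1+n i<p)))

  passed-used : ∀ u p d → (∀ i → i < d ℕ.+ p → u i ≡ false) → passed u p d ≡ ∅
  passed-used u p zero    eq = ≡.refl
  passed-used u p (suc d) eq rewrite eq p (s≤s (ℕ.m≤n+m p d)) =
    passed-used u (suc p) d (λ i i< → eq i (≡.subst (i <_) (ℕ.+-suc d p) i<))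

  private
    ε-used : ∀ u p → p < n → cnt u n ≡ 0 → Telescope.ε n u p ≈ 1#
    ε-used u p p<n none = begin
      scan u p (passed u p (n ∸ p))
        ≡⟨ ≡.cong (scan u p) (passed-used u p (n ∸ p) (λ i i< → all i (≡.subst (i <_) (ℕ.m∸n+n≡m (ℕ.<⇒≤ p<n)) i<))) ⟩
      scan u p ∅                     ≡⟨ scan-used u p ∅ (λ i i<p → all i (ℕ.<-trans i<p p<n)) ⟩
      1# * 1#                        ≈⟨ *-identityˡ 1# ⟩
      1#                             ∎
      where
      all : ∀ i → i < n → u i ≡ false
      all = cnt≡0 u n none

  -- Dividing by Y r m, with t = xᵐ, turns the sum over the rest of the word into a partial sum of F: the
  -- pointer to the label of the last letter read sweeps once through all labels for each color.
  Claim : ℕ → Set _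
  Claim m = ∀ {j} (s : Vec Letter j) i z u → State m u ((i , z) ∷ s) →
    prefixes m ((i , z) ∷ s) ≈
    κ u n * term m ((i , z) ∷ s) * Y r m * ((x ^ cnt u n) ^ toℕ z * Telescope.ε n u (toℕ i))

  claim-zero : Claim zero
  claim-zero s i z u state = begin
    prefixes 0 ((i , z) ∷ s)          ≡⟨ prefixes-full state ⟩
    term 0 ((i , z) ∷ s)              ≈⟨ solve 1 (λ t → t := :1 :* t :* :1 :* (:1 :* :1)) refl (term 0 ((i , z) ∷ s)) ⟩
    1# * term 0 ((i , z) ∷ s) * 1# * (1# * 1#)
      ≈⟨ *-cong (*-congʳ (*-congʳ (κ-used u n (cnt≡0 u n size))))
           (*-cong (trans (reflexive (≡.cong (λ m → (x ^ m) ^ toℕ z) size)) (1^ (toℕ z)))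
               (ε-used u (toℕ i) (Fin.toℕ<n i) size)) ⟨
    κ u n * term 0 ((i , z) ∷ s) * 1# * ((x ^ cnt u n) ^ toℕ z * Telescope.ε n u (toℕ i)) ∎
    where open State state

  module Step {m} (claim : Claim m) {j} (s : Vec Letter j) u (state : State (suc m) u s) where

    open State state
    open Telescope n u

    C : Carrier
    C = κ u n * term (suc m) s * Y r m

    -- `w` is the descent weight between the new letter and the word behind it. Keeping it abstract
    -- lets the first letter read, where it is 1, share this step with all later ones.
    module _ (i : Fin n) (z : Fin r) (w : Carrier)
      (maj : x ^ (r ℕ.* majFrom (suc m) ((i , z) ∷ s)) ≈ w * x ^ (r ℕ.* majFrom (suc (suc m)) s)) where

      private
        p = toℕ i
        a = (i , z)
        P = above (suc p)
        u′ = remove p u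
        t = x ^ cnt u n
        t′ = x ^ cnt u′ n

        none : ∀ y → y ≈ 0# → prefixes m (a ∷ s) ≈ 0# → prefixes m (a ∷ s) ≈ C * (w * (t ^ toℕ z * y))
        none y y≈0 bad = begin
          prefixes m (a ∷ s)            ≈⟨ bad ⟩
          0#                            ≈⟨ solve 3 (λ C w t → :0 := C :* (w :* (t :* :0))) refl C w (t ^ toℕ z) ⟩
          C * (w * (t ^ toℕ z * 0#))    ≈⟨ *-congˡ (*-congˡ (*-congˡ y≈0)) ⟨
          C * (w * (t ^ toℕ z * y))     ∎

        term-∷ : term m (a ∷ s) ≈ sg (cnt (not ∘ u) p) * (w * x ^ toℕ z) * term (suc m) s
        term-∷ = begin
          sg (count (ℕ._<? suc p) ∣ s ∣ ℕ.+ inv ∣ s ∣) * x ^ (r ℕ.* M₁ ℕ.+ (toℕ z ℕ.+ col s))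
            ≈⟨ *-cong (sg-+ (count (ℕ._<? suc p) ∣ s ∣) (inv ∣ s ∣))
                (trans (^-homo-* x (r ℕ.* M₁) _) (*-congˡ (^-homo-* x (toℕ z) (col s)))) ⟩
          sg (count (ℕ._<? suc p) ∣ s ∣) * sg (inv ∣ s ∣) * (x ^ (r ℕ.* M₁) * (x ^ toℕ z * x ^ col s))
            ≈⟨ *-cong (*-congʳ (reflexive (≡.cong sg (smaller p)))) (*-congʳ maj) ⟩
          sg (cnt (not ∘ u) p) * sg (inv ∣ s ∣) * (w * x ^ (r ℕ.* M₂) * (x ^ toℕ z * x ^ col s))
            ≈⟨ solve 6 (λ g i w m z c → g :* i :* (w :* m :* (z :* c)) := g :* (w :* z) :* (i :* (m :* c))) refl _ _ _ _
                _ _ ⟩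
          sg (cnt (not ∘ u) p) * (w * x ^ toℕ z) * (sg (inv ∣ s ∣) * (x ^ (r ℕ.* M₂) * x ^ col s))
            ≈⟨ *-congˡ (*-congˡ (^-homo-* x (r ℕ.* M₂) (col s))) ⟨
          sg (cnt (not ∘ u) p) * (w * x ^ toℕ z) * term (suc m) s ∎
          where
          M₁ = majFrom (suc m) (a ∷ s)
          M₂ = majFrom (suc (suc m)) s

        -- `κ-remove` turns the sign of the new inversions into the sign of the scan, and the color
        -- contributes `x ^ z` itself and `t′ ^ z` through `claim`, together `t ^ z`.
        fresh-letter : u p ≡ true → (kind p ≡ block → passed-block P ≡ 0) →
                       prefixes m (a ∷ s) ≈ C * (w * (t ^ toℕ z * (sg (total P) * scan u p P)))
        fresh-letter up first = begin
          prefixes m (a ∷ s)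
            ≈⟨ claim s i z u′ (state-∷ i state up first) ⟩
          κ u′ n * term m (a ∷ s) * Y r m * (t′ ^ toℕ z * Telescope.ε n u′ p)
            ≈⟨ *-cong (*-congʳ (*-congˡ term-∷)) (*-congˡ (reflexive ε-removed)) ⟩
          κ u′ n * (sg (cnt (not ∘ u) p) * (w * x ^ toℕ z) * term (suc m) s) * Y r m * (t′ ^ toℕ z * scan u p P)
            ≈⟨ solve 8 (λ K g w X T y t e → K :* (g :* (w :* X) :* T) :* y :* (t :* e) := (g :* K) :*
                (T :* y :* (w :* ((X :* t) :* e)))) refl
                 (κ u′ n) (sg (cnt (not ∘ u) p)) w (x ^ toℕ z) (term (suc m) s) (Y r m) (t′ ^ toℕ z) (scan u p P) ⟩
          (sg (cnt (not ∘ u) p) * κ u′ n) * (term (suc m) s * Y r m * (w * ((x ^ toℕ z * t′ ^ toℕ z) * scan u p P)))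
            ≈⟨ *-cong κ-eq (*-congˡ (*-congˡ (*-congʳ powers))) ⟩
          (κ u n * sg (total P)) * (term (suc m) s * Y r m * (w * (t ^ toℕ z * scan u p P)))
            ≈⟨ solve 7 (λ K g T y w t e → (K :* g) :* (T :* y :* (w :* (t :* e))) := (K :* T :* y) :*
                (w :* (t :* (g :* e)))) refl
                 (κ u n) (sg (total P)) (term (suc m) s) (Y r m) w (t ^ toℕ z) (scan u p P) ⟩
          C * (w * (t ^ toℕ z * (sg (total P) * scan u p P))) ∎
          where
          κ-eq : sg (cnt (not ∘ u) p) * κ u′ n ≈ κ u n * sg (total P)
          κ-eq = ≡.subst (λ N → sg (cnt (not ∘ u) p) * κ u′ N ≈ κ u N * sg (total P)) (ℕ.m∸n+n≡m (Fin.toℕ<n i))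
              (κ-remove u p (n ∸ suc p) up)

          powers : x ^ toℕ z * t′ ^ toℕ z ≈ t ^ toℕ z
          powers = begin
            x ^ toℕ z * t′ ^ toℕ z   ≈⟨ ^-distrib-* x t′ (toℕ z) ⟨
            (x * t′) ^ toℕ z         ≡⟨ ≡.cong (λ m → (x ^ m) ^ toℕ z) (cnt-remove n up (Fin.toℕ<n i)) ⟨
            t ^ toℕ z                ∎

          ε-removed : Telescope.ε n u′ p ≡ scan u p P
          ε-removed = ≡.trans (≡.cong (scan u′ p) passed-removed) (scan-cong p P (λ i i<p → remove-≢ u (ℕ.<⇒≢ i<p)))
            where
            passed-removed : passed u′ p (n ∸ p) ≡ P
            passed-removed = ≡.trans (Telescope.above-suc n u′ p (Fin.toℕ<n i))
              (≡.trans (≡.cong (λ t → bumpIf t p (passed u′ (suc p) (n ∸ suc p))) (remove-≡ p u))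
                (passed-cong (suc p) (n ∸ suc p) (λ i p<i → remove-≢ u (ℕ.<⇒≢ p<i ∘ ≡.sym))))

        -- A letter of the block read too early contributes 0 on both sides: by `bad-blocked` on the
        -- left and by `emit` on the right.
        cases : ∀ κp → kind p ≡ κp → ∀ J → passed-block P ≡ J → u p ≡ true →
                prefixes m (a ∷ s) ≈ C * (w * (t ^ toℕ z * emit κp P (sg (total P) * scan u p P)))
        cases left  κp J       eJ up = fresh-letter up (λ κ → contradiction (≡.trans (≡.sym κp) κ) λ ())
        cases right κp J       eJ up = fresh-letter up (λ κ → contradiction (≡.trans (≡.sym κp) κ) λ ())
        cases block κp zero    eJ up = trans (fresh-letter up (λ _ → eJ))
            (*-congˡ (*-congˡ (*-congˡ (reflexive (≡.sym (emit-first P {sg (total P) * scan u p P} eJ))))))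
          where
          emit-first : ∀ P {y} → passed-block P ≡ 0 → emit block P y ≡ y
          emit-first (_ , zero , _) _ = ≡.refl
        cases block κp (suc J) eJ up with q , p<q , κq , uq ← block-passed u (suc p) (n ∸ suc p) eJ =
          none _ (reflexive (emit-later P {sg (total P) * scan u p P} eJ))
              (prefixes-bad m (bad-blocked {z = z} state up κp p<q κq uq))
          where
          emit-later : ∀ P {y J} → passed-block P ≡ suc J → emit block P y ≡ 0#
          emit-later (_ , suc _ , _) _ = ≡.refl

      prefixes-∷ : prefixes m (a ∷ s) ≈ C * (w * (t ^ toℕ z * e p))
      prefixes-∷ with u p in up
      ... | false = none _ refl (prefixes-bad m (bad-used {z = z} state up))
      ... | true  = cases (kind p) ≡.refl (passed-block P) ≡.refl up

    prefixes-suc : ∀ (f : ℕ → ℕ → Carrier) →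
      (∀ i z → x ^ (r ℕ.* majFrom (suc m) ((i , z) ∷ s)) ≈ f (toℕ i) (toℕ z) * x ^ (r ℕ.* majFrom (suc (suc m)) s)) →
      prefixes (suc m) s ≈ C * Σ< n (λ i → Σ< r (λ z → f i z * ((x ^ cnt u n) ^ z * e i)))
    prefixes-suc f maj = begin
      Σ[ letters ] (λ a → prefixes m (a ∷ s))
        ≈⟨ Σ-cartesianProductWith _,_ (allFin n) (allFin r) _ ⟩
      Σ[ allFin n ] (λ i → Σ[ allFin r ] (λ z → prefixes m ((i , z) ∷ s)))
        ≈⟨ Σ-allFin n (λ i → Σ-allFin r (λ z → prefixes-∷ i z (f (toℕ i) (toℕ z)) (maj i z))) ⟩
      Σ< n (λ i → Σ< r (λ z → C * (f i z * ((x ^ cnt u n) ^ z * e i))))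
        ≈⟨ Σ<-cong n (λ i _ → Σ<-*ˡ r C _) ⟩
      Σ< n (λ i → C * Σ< r (λ z → f i z * ((x ^ cnt u n) ^ z * e i)))
        ≈⟨ Σ<-*ˡ n C _ ⟩
      C * Σ< n (λ i → Σ< r (λ z → f i z * ((x ^ cnt u n) ^ z * e i))) ∎

    Y-suc : (1# - (x ^ cnt u n) ^ r) * Y r m ≈ Y r (suc m)
    Y-suc = *-congʳ (+-congˡ (-‿cong (trans (^-assocʳ x (cnt u n) r) (reflexive (≡.cong (λ M → x ^ (M ℕ.* r)) size)))))

  claim-suc : ∀ m → Claim m → Claim (suc m)
  claim-suc m claim s i₀ z₀ u state = begin
    prefixes (suc m) ((i₀ , z₀) ∷ s)
      ≈⟨ prefixes-suc factor maj ⟩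
    C * Σ< n (λ i → Σ< r (λ z → factor i z * (t ^ z * e i)))
      ≈⟨ *-congˡ (letters-after r (toℕ i₀) (toℕ z₀) (Fin.toℕ<n i₀) u[i₀] (Fin.toℕ<n z₀)) ⟩
    C * ((1# - t ^ r) * (t ^ toℕ z₀ * ε (toℕ i₀)))
      ≈⟨ solve 4 (λ K y w z → K :* y :* (w :* z) := K :* (w :* y) :* z) refl (κ u n * term (suc m) ((i₀ , z₀) ∷ s))
          (Y r m) (1# - t ^ r) (t ^ toℕ z₀ * ε (toℕ i₀)) ⟩
    κ u n * term (suc m) ((i₀ , z₀) ∷ s) * ((1# - t ^ r) * Y r m) * (t ^ toℕ z₀ * ε (toℕ i₀))
      ≈⟨ *-congʳ (*-congˡ Y-suc) ⟩
    κ u n * term (suc m) ((i₀ , z₀) ∷ s) * Y r (suc m) * (t ^ toℕ z₀ * ε (toℕ i₀)) ∎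
    where
    open State state
    open Step claim ((i₀ , z₀) ∷ s) u state
    open Telescope n u
    t : Carrier
    t = x ^ cnt u n

    u[i₀] : u (toℕ i₀) ≡ false
    u[i₀] with u (toℕ i₀) in eq
    ... | false = ≡.refl
    ... | true with (≢ ∷ _) ← unused (toℕ i₀) eq = contradiction ≡.refl ≢

    open Letters (toℕ i₀) (toℕ z₀) (Fin.toℕ<n i₀) u[i₀] (t ^ r) using (factor; precedes)

    precedes≡ : ∀ i z → does ((i₀ , z₀) ≺? (i , z)) ≡ precedes (toℕ i) (toℕ z)
    precedes≡ i z = ≡.cong (λ d → does (toℕ z ℕ.<? toℕ z₀) ∨ (d ∧ does (toℕ i₀ ℕ.<? toℕ i)))
      (does-⇔ (mk⇔ (≡.cong toℕ) Fin.toℕ-injective) (z₀ Fin.≟ z) (toℕ z₀ ℕ.≟ toℕ z))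

    maj : ∀ i z → x ^ (r ℕ.* majFrom (suc m) ((i , z) ∷ (i₀ , z₀) ∷ s)) ≈
          factor (toℕ i) (toℕ z) * x ^ (r ℕ.* majFrom (suc (suc m)) ((i₀ , z₀) ∷ s))
    maj i z = begin
      x ^ (r ℕ.* ((if does ((i₀ , z₀) ≺? (i , z)) then suc m else 0) ℕ.+ M))
        ≡⟨ ≡.cong (λ d → x ^ (r ℕ.* ((if d then suc m else 0) ℕ.+ M))) (precedes≡ i z) ⟩
      x ^ (r ℕ.* ((if precedes (toℕ i) (toℕ z) then suc m else 0) ℕ.+ M))
        ≈⟨ descent (precedes (toℕ i) (toℕ z)) ⟩
      factor (toℕ i) (toℕ z) * x ^ (r ℕ.* M) ∎
      where
      M = majFrom (suc (suc m)) ((i₀ , z₀) ∷ s)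
      descent : ∀ d → x ^ (r ℕ.* ((if d then suc m else 0) ℕ.+ M)) ≈ (if d then t ^ r else 1#) * x ^ (r ℕ.* M)
      descent false = sym (*-identityˡ _)
      descent true  = begin
        x ^ (r ℕ.* (suc m ℕ.+ M))
          ≡⟨ ≡.cong (x ^_) (≡.trans (ℕ.*-distribˡ-+ r (suc m) M) (≡.cong (ℕ._+ r ℕ.* M) (ℕ.*-comm r (suc m)))) ⟩
        x ^ (suc m ℕ.* r ℕ.+ r ℕ.* M)            ≈⟨ ^-homo-* x (suc m ℕ.* r) (r ℕ.* M) ⟩
        x ^ (suc m ℕ.* r) * x ^ (r ℕ.* M)        ≈⟨ *-congʳ (^-assocʳ x (suc m) r) ⟨
        (x ^ suc m) ^ r * x ^ (r ℕ.* M)          ≡⟨ ≡.cong (λ M′ → (x ^ M′) ^ r * x ^ (r ℕ.* M)) size ⟨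
        t ^ r * x ^ (r ℕ.* M)                    ∎

  claim : ∀ m → Claim m
  claim zero    = claim-zero
  claim (suc m) = claim-suc m (claim m)

  -- The rightmost letter has no neighbour to its right, so there is neither a descent weight nor a
  -- pointer, and the full series `F` appears.
  prefixes-all : ∀ m → suc m ≡ n → prefixes n [] ≈ Y r n * F (n ∸ (a₀ ℕ.+ k)) k a₀
  prefixes-all m ≡.refl = begin
    prefixes (suc m) []
      ≈⟨ prefixes-suc (λ _ _ → 1#) (λ i z → sym (*-identityˡ _)) ⟩
    C * Σ< n (λ i → Σ< r (λ z → 1# * ((x ^ cnt fresh n) ^ z * e i)))
      ≈⟨ *-congˡ (trans (Σ<-cong n (λ i _ → Σ<-cong r (λ z _ → *-identityˡ _))) (letters-first r)) ⟩
    C * ((1# - (x ^ cnt fresh n) ^ r) * F-all)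
      ≈⟨ *-congʳ (*-congʳ (trans (*-cong (κ-fresh n) one) (*-identityˡ 1#))) ⟩
    1# * Y r m * ((1# - (x ^ cnt fresh n) ^ r) * F-all)
      ≈⟨ solve 3 (λ y w f → :1 :* y :* (w :* f) := (w :* y) :* f) refl (Y r m) (1# - (x ^ cnt fresh n) ^ r) F-all ⟩
    ((1# - (x ^ cnt fresh n) ^ r) * Y r m) * F-all
      ≈⟨ *-cong Y-suc (reflexive (≡.cong F′ (≡.trans (≡.cong (remaining fresh) (≡.sym (ℕ.m∸n+n≡m c≤n)))
          (remaining-fresh (n ∸ (a₀ ℕ.+ k)))))) ⟩
    Y r n * F (n ∸ (a₀ ℕ.+ k)) k a₀ ∎
    where
    open Step (claim m) [] fresh state-[]
    open Telescope n fresh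
    one : term (suc m) [] ≈ 1#
    one = trans (*-identityˡ _) (reflexive (≡.cong (x ^_) (≡.trans (ℕ.+-identityʳ _) (ℕ.*-zeroʳ r))))

  Σ-H : 0 < n → Σ[ H r n (suc a₀) (a₀ ℕ.+ k) ] (λ π → sg (inv ∣ π ∣) * x ^ fmaj π) ≈ Y r n * F (n ∸ (a₀ ℕ.+ k)) k a₀
  Σ-H 0<n = begin
    Σ[ H r n (suc a₀) (a₀ ℕ.+ k) ] (term 0)
      ≈⟨ Σ-filter (contains? (suc a₀) (a₀ ℕ.+ k)) (G r n) (term 0) ⟩
    Σ[ G r n ] (λ π → if does (contains? (suc a₀) (a₀ ℕ.+ k) π) then term 0 π else 0#)
      ≈⟨ Σ-filter isColoredPermutation? (vectors letters n) _ ⟩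
    Σ[ vectors letters n ] restricted
      ≈⟨ Σ-vectors letters n restricted ⟩
    prefixes n []
      ≈⟨ prefixes-all (ℕ.pred n) (ℕ.suc-pred n {{ℕ.>-nonZero 0<n}}) ⟩
    Y r n * F (n ∸ (a₀ ℕ.+ k)) k a₀ ∎

-- The ring of formal power series

module PowerSeries {c ℓ} (R : CommutativeRing c ℓ) where

  private module R = CommutativeRing R
  open R using (Carrier)
  open SetoidReasoning R.setoid
  open CommutativeSemigroupProperties R.+-commutativeSemigroup using (interchange; x∙yz≈y∙xz)
  open RingProperties R.ring using (-0#≈0#)

  Series : Set c
  Series = ℕ → Carrier

  infix  4 _≋_
  infixl 6 _+_
  infixl 7 _*_

  _≋_ : Series → Series → Set ℓ
  f ≋ g = ∀ i → f i R.≈ g i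

  _+_ : Series → Series → Series
  (f + g) i = f i R.+ g i

  -_ : Series → Series
  (- f) i = R.- f i

  -- Convolution, written with the recursion of the polynomial product so that `coeff-*` is a direct
  -- induction.
  _*_ : Series → Series → Series
  (f * g) zero    = f 0 R.* g 0
  (f * g) (suc i) = f 0 R.* g (suc i) R.+ (f ∘ suc * g) i

  ι : Carrier → Series
  ι a zero    = a
  ι a (suc i) = R.0#

  0ˢ 1ˢ : Series
  0ˢ i = R.0#
  1ˢ   = ι R.1#

  *-cong : ∀ {f f′ g g′} → f ≋ f′ → g ≋ g′ → f * g ≋ f′ * g′
  *-cong p q zero    = R.*-cong (p 0) (q 0)
  *-cong p q (suc i) = R.+-cong (R.*-cong (p 0) (q (suc i))) (*-cong (p ∘ suc) q i)

  *-distribʳ-+ : ∀ h f g → (f + g) * h ≋ f * h + g * h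
  *-distribʳ-+ h f g zero    = R.distribʳ _ _ _
  *-distribʳ-+ h f g (suc i) = R.trans (R.+-cong (R.distribʳ _ _ _) (*-distribʳ-+ h (f ∘ suc) (g ∘ suc) i))
      (interchange _ _ _ _)

  zeroˡ : ∀ g → 0ˢ * g ≋ 0ˢ
  zeroˡ g zero    = R.zeroˡ _
  zeroˡ g (suc i) = R.trans (R.+-cong (R.zeroˡ _) (zeroˡ g i)) (R.+-identityˡ _)

  ι-* : ∀ a g i → (ι a * g) i R.≈ a R.* g i
  ι-* a g zero    = R.refl
  ι-* a g (suc i) = R.trans (R.+-congˡ (zeroˡ g i)) (R.+-identityʳ _)

  scale-* : ∀ a f g i → ((λ j → a R.* f j) * g) i R.≈ a R.* (f * g) i
  scale-* a f g zero    = R.*-assoc _ _ _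
  scale-* a f g (suc i) = R.trans (R.+-cong (R.*-assoc _ _ _) (scale-* a (f ∘ suc) g i)) (R.sym (R.distribˡ _ _ _))

  -- Splits off the other end of the convolution; commutativity exchanges the two ends.
  *-suc : ∀ f g i → (f * g) (suc i) R.≈ f (suc i) R.* g 0 R.+ (f * (g ∘ suc)) i
  *-suc f g zero    = R.+-comm _ _
  *-suc f g (suc i) = R.trans (R.+-congˡ (*-suc (f ∘ suc) g i)) (x∙yz≈y∙xz _ _ _)

  *-comm : ∀ f g → f * g ≋ g * f
  *-comm f g zero    = R.*-comm _ _
  *-comm f g (suc i) = R.trans (R.+-cong (R.*-comm _ _) (*-comm (f ∘ suc) g i)) (R.sym (*-suc g f i))

  *-assoc : ∀ f g h → (f * g) * h ≋ f * (g * h)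
  *-assoc f g h zero    = R.*-assoc _ _ _
  *-assoc f g h (suc i) = begin
    f 0 R.* g 0 R.* h (suc i) R.+ (((λ j → f 0 R.* g (suc j)) + f ∘ suc * g) * h) i
      ≈⟨ R.+-cong (R.*-assoc _ _ _) (*-distribʳ-+ h _ _ i) ⟩
    f 0 R.* (g 0 R.* h (suc i)) R.+ (((λ j → f 0 R.* g (suc j)) * h) i R.+ ((f ∘ suc * g) * h) i)
      ≈⟨ R.+-congˡ (R.+-cong (scale-* (f 0) (g ∘ suc) h i) (*-assoc (f ∘ suc) g h i)) ⟩
    f 0 R.* (g 0 R.* h (suc i)) R.+ (f 0 R.* (g ∘ suc * h) i R.+ (f ∘ suc * (g * h)) i)
      ≈⟨ R.+-assoc _ _ _ ⟨
    f 0 R.* (g 0 R.* h (suc i)) R.+ f 0 R.* (g ∘ suc * h) i R.+ (f ∘ suc * (g * h)) i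
      ≈⟨ R.+-congʳ (R.distribˡ _ _ _) ⟨
    f 0 R.* (g * h) (suc i) R.+ (f ∘ suc * (g * h)) i ∎

  *-identityˡ : ∀ f → 1ˢ * f ≋ f
  *-identityˡ f i = R.trans (ι-* R.1# f i) (R.*-identityˡ _)

  commutativeRing : CommutativeRing c ℓ
  commutativeRing = record
    { Carrier = Series
    ; _≈_ = _≋_
    ; _+_ = _+_
    ; _*_ = _*_
    ; -_  = -_
    ; 0#  = 0ˢ
    ; 1#  = 1ˢ
    ; isCommutativeRing = record
      { isRing = record
        { +-isAbelianGroup = record
          { isGroup = record
            { isMonoid = record
              { isSemigroup = record
                { isMagma = record
                  { isEquivalence = record
                    { refl  = λ i → R.refl
                    ; sym   = λ p i → R.sym (p i)
                    ; trans = λ p q i → R.trans (p i) (q i)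
                    }
                  ; ∙-cong = λ p q i → R.+-cong (p i) (q i)
                  }
                ; assoc = λ f g h i → R.+-assoc _ _ _
                }
              ; identity = (λ f i → R.+-identityˡ _) , (λ f i → R.+-identityʳ _)
              }
            ; inverse = (λ f i → R.-‿inverseˡ _) , (λ f i → R.-‿inverseʳ _)
            ; ⁻¹-cong = λ p i → R.-‿cong (p i)
            }
          ; comm = λ f g i → R.+-comm _ _
          }
        ; *-cong     = *-cong
        ; *-assoc    = *-assoc
        ; *-identity = *-identityˡ , (λ f i → R.trans (*-comm f 1ˢ i) (*-identityˡ f i))
        ; distrib    = (λ f g h i → R.trans (*-comm f (g + h) i)
            (R.trans (*-distribʳ-+ f g h i) (R.+-cong (*-comm g f i) (*-comm h f i))))
                     , *-distribʳ-+
        }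
      ; *-comm = *-comm
      }
    }

  ι-homo-* : ∀ a b → ι (a R.* b) ≋ ι a * ι b
  ι-homo-* a b zero    = R.refl
  ι-homo-* a b (suc i) = R.sym (R.trans (ι-* a (ι b) (suc i)) (R.zeroʳ a))

  ι-homo-‿ : ∀ a → ι (R.- a) ≋ - ι a
  ι-homo-‿ a zero    = R.refl
  ι-homo-‿ a (suc i) = R.sym -0#≈0#

  ι-cong : ∀ {a b} → a R.≈ b → ι a ≋ ι b
  ι-cong a≈b zero    = a≈b
  ι-cong a≈b (suc i) = R.refl

  module Geometric (s : Series) (s₀≈0 : s 0 R.≈ R.0#) where

    approximant : ℕ → Series
    approximant zero    = 0ˢ
    approximant (suc N) = 1ˢ + s * approximant N

    -- 1 / (1 - s); the i-th coefficient of 1 + s + ⋯ + sᴺ is constant for N ≥ i.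
    inverse : Series
    inverse i = approximant (suc i) i

    *-local : ∀ t f g i → (∀ j → j ≤ i → f j R.≈ g j) → (t * f) i R.≈ (t * g) i
    *-local t f g zero    p = R.*-congˡ (p 0 z≤n)
    *-local t f g (suc i) p = R.+-cong (R.*-congˡ (p (suc i) ℕ.≤-refl))
        (*-local (t ∘ suc) f g i (λ j j≤i → p j (ℕ.m≤n⇒m≤1+n j≤i)))

    vanish : ∀ a → s 0 R.* a R.≈ R.0#
    vanish a = R.trans (R.*-congʳ s₀≈0) (R.zeroˡ a)

    -- As `s` has no constant term, coefficient `i` of a product with `s` sees only coefficients
    -- below `i`. This makes the approximants stabilize.
    s*-local : ∀ f g i → (∀ j → j < i → f j R.≈ g j) → (s * f) i R.≈ (s * g) i
    s*-local f g zero    p = R.trans (vanish (f 0)) (R.sym (vanish (g 0)))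
    s*-local f g (suc i) p = R.+-cong
      (R.trans (vanish (f (suc i))) (R.sym (vanish (g (suc i)))))
      (*-local (s ∘ suc) f g i (λ j j≤i → p j (s≤s j≤i)))

    approximant-stable : ∀ N i → i < N → approximant N i R.≈ approximant (suc N) i
    approximant-stable (suc N) i (s≤s i≤N) =
      R.+-congˡ (s*-local (approximant N) (approximant (suc N)) i
          (λ j j<i → approximant-stable N j (ℕ.<-≤-trans j<i i≤N)))

    approximant≈inverse : ∀ N i → i < N → approximant N i R.≈ inverse i
    approximant≈inverse (suc N) i i<1+N with i ℕ.≟ N
    ... | yes ≡.refl = R.refl
    ... | no  i≢N    = R.trans (R.sym (approximant-stable N i i<N)) (approximant≈inverse N i i<N)
      where
      i<N : i < N
      i<N = ℕ.≤∧≢⇒< (ℕ.≤-pred i<1+N) i≢N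

    inverse-unfold : inverse ≋ 1ˢ + s * inverse
    inverse-unfold i = R.+-congˡ (s*-local (approximant i) inverse i (approximant≈inverse i))

    inverse-correct : (1ˢ + - s) * inverse ≋ 1ˢ
    inverse-correct = S.begin
      (1ˢ + - s) * inverse
          S.≈⟨ solve 2 (λ s g → (:1 :- s) :* g := g :- s :* g) (λ i → R.refl) s inverse ⟩
      inverse + - (s * inverse)                         S.≈⟨ (λ i → R.+-congʳ (inverse-unfold i)) ⟩
      (1ˢ + s * inverse) + - (s * inverse)
          S.≈⟨ solve 1 (λ y → (:1 :+ y) :- y := :1) (λ i → R.refl) (s * inverse) ⟩
      1ˢ                                                S.∎
      where
      module S = SetoidReasoning (CommutativeRing.setoid commutativeRing)
      open IntegerSolver commutativeRing

-- From polynomials to power series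

module Coefficients {c ℓ₁ ℓ₂} (𝕂 : HeytingField c ℓ₁ ℓ₂) where

  R : CommutativeRing c ℓ₁
  R = record { isCommutativeRing = HeytingField.isCommutativeRing 𝕂 }

  private module R = CommutativeRing R

  module P = RationalFunctions 𝕂
  open P using (Poly; coeff; const; q)
  open PowerSeries R using (ι; ι-homo-*; ι-homo-‿; ι-cong) renaming (commutativeRing to 𝔸)
  open CommutativeRing 𝔸 hiding (zero)
  open RawSemiringDefinitions (Semiring.rawSemiring semiring) using (_^_; sum; product)
  open SetoidReasoning setoid
  open Signs 𝔸 using (sg)
  open GeometricSums 𝔸 using (geo; geo-cong; 1^)
  open FiniteSums 𝔸 using (Σ[_])
  open Exp semiring using (^-congˡ; ^-homo-*; ^-assocʳ)
  open CommutativeExp commutativeSemiring using (^-distrib-*)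

  open RawSemiringDefinitions (Semiring.rawSemiring R.semiring) using () renaming (_^_ to _^ᴷ_)

  coeff-+ : ∀ p s → coeff (p P.+ s) ≈ coeff p + coeff s
  coeff-+ []      s       i       = R.sym (R.+-identityˡ _)
  coeff-+ (a ∷ p) []      i       = R.sym (R.+-identityʳ _)
  coeff-+ (a ∷ p) (b ∷ s) zero    = R.refl
  coeff-+ (a ∷ p) (b ∷ s) (suc i) = coeff-+ p s i

  coeff-map : ∀ a s i → coeff (List.map (a R.*_) s) i R.≈ a R.* coeff s i
  coeff-map a []      i       = R.sym (R.zeroʳ a)
  coeff-map a (b ∷ s) zero    = R.refl
  coeff-map a (b ∷ s) (suc i) = coeff-map a s i

  coeff-* : ∀ p s → coeff (p P.* s) ≈ coeff p * coeff s
  coeff-* []      s i       = R.sym (zeroˡ (coeff s) i)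
  coeff-* (a ∷ p) s zero    = R.trans (coeff-+ (List.map (a R.*_) s) _ 0) (R.trans (R.+-identityʳ _) (coeff-map a s 0))
  coeff-* (a ∷ p) s (suc i) = R.trans (coeff-+ (List.map (a R.*_) s) _ (suc i))
      (R.+-cong (coeff-map a s (suc i)) (coeff-* p s i))

  coeff-‿ : ∀ p → coeff (P.- p) ≈ - coeff p
  coeff-‿ []      i       = R.sym (RingProperties.-0#≈0# R.ring)
  coeff-‿ (a ∷ p) zero    = R.refl
  coeff-‿ (a ∷ p) (suc i) = coeff-‿ p i

  coeff-const : ∀ a → coeff (const a) ≈ ι a
  coeff-const a zero    = R.refl
  coeff-const a (suc i) = R.refl

  coeff-^ : ∀ p n → coeff (p P.^ n) ≈ coeff p ^ n
  coeff-^ p zero    = coeff-const R.1#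
  coeff-^ p (suc n) = trans (coeff-* p (p P.^ n)) (*-congˡ {coeff p} (coeff-^ p n))

  coeff-sum : ∀ m (f : Fin m → Poly) → coeff (P.sum f) ≈ sum (coeff ∘ f)
  coeff-sum zero    f i = R.refl
  coeff-sum (suc m) f   = trans (coeff-+ (f Fin.zero) _) (+-congˡ {coeff (f Fin.zero)} (coeff-sum m (f ∘ Fin.suc)))

  coeff-product : ∀ m (f : Fin m → Poly) → coeff (P.product f) ≈ product (coeff ∘ f)
  coeff-product zero    f = coeff-const R.1#
  coeff-product (suc m) f = trans (coeff-* (f Fin.zero) _)
      (*-congˡ {coeff (f Fin.zero)} (coeff-product m (f ∘ Fin.suc)))

  coeff-Σ : ∀ {b} {B : Set b} (bs : List B) (f : B → Poly) →
            coeff (List.foldr P._+_ P.0# (List.map f bs)) ≈ Σ[ bs ] (coeff ∘ f)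
  coeff-Σ []       f i = R.refl
  coeff-Σ (b ∷ bs) f   = trans (coeff-+ (f b) _) (+-congˡ {coeff (f b)} (coeff-Σ bs f))

  ι-^ : ∀ a n → ι (a ^ᴷ n) ≈ ι a ^ n
  ι-^ a zero    = refl
  ι-^ a (suc n) = trans (ι-homo-* a (a ^ᴷ n)) (*-congˡ {ι a} (ι-^ a n))

  ι-sg : ∀ n → ι ((R.- R.1#) ^ᴷ n) ≈ sg n
  ι-sg n = trans (ι-^ (R.- R.1#) n) (^-congˡ n (ι-homo-‿ R.1#))

  coeff-[] : ∀ m p → coeff (P.[ m ]⟨ p ⟩) ≈ geo m (coeff p)
  coeff-[] m p = trans (coeff-sum m (λ i → p P.^ toℕ i)) (MonoidSum.sum-cong-≋ +-monoid {m} (λ i → coeff-^ p (toℕ i)))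

  product-cong : ∀ m {f g : Fin m → Carrier} → (∀ i → f i ≈ g i) → product f ≈ product g
  product-cong m = MonoidSum.sum-cong-≋ *-monoid {m}

  module _ (ζ : R.Carrier) (h : ℕ) where

    Q x : Carrier
    Q = coeff q
    x = ι ζ ^ h * Q

    x₀≈0 : x 0 R.≈ R.0#
    x₀≈0 = R.zeroʳ _

    coeff-±ζq : ∀ e → coeff (P.±ζq ζ h e) ≈ sg e * x
    coeff-±ζq e = begin
      coeff (const a P.* q)                                 ≈⟨ coeff-* (const a) q ⟩
      coeff (const a) * Q                                   ≈⟨ *-congʳ {Q} (coeff-const a) ⟩
      ι a * Q                                               ≈⟨ *-congʳ {Q} (ι-homo-* ((R.- R.1#) ^ᴷ e) (ζ ^ᴷ h)) ⟩
      ι ((R.- R.1#) ^ᴷ e) * ι (ζ ^ᴷ h) * Q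
        ≈⟨ *-congʳ {Q} (*-cong {ι ((R.- R.1#) ^ᴷ e)} {sg e} (ι-sg e) (ι-^ ζ h)) ⟩
      sg e * ι ζ ^ h * Q                                    ≈⟨ *-assoc (sg e) (ι ζ ^ h) Q ⟩
      sg e * x                                              ∎
      where
      a : R.Carrier
      a = (R.- R.1#) ^ᴷ e R.* ζ ^ᴷ h

    v : ℕ → Carrier
    v j = PowerSeries.Geometric.inverse R (x ^ suc j) (R.trans (R.*-congʳ x₀≈0) (R.zeroˡ _))

    v-inverse : ∀ j → (1# - x ^ suc j) * v j ≈ 1#
    v-inverse j = PowerSeries.Geometric.inverse-correct R (x ^ suc j) (R.trans (R.*-congʳ x₀≈0) (R.zeroˡ _))

    open ClosedForms 𝔸 x v v-inverse

    coeff-numerator : ∀ r n → coeff (P.numerator ζ h r n) ≈ Num r n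
    coeff-numerator r n = trans
      (coeff-product n (λ j → P.[ suc (toℕ j) ℕ.* r ]⟨ P.±ζq ζ h (toℕ j) ⟩))
      (product-cong n (λ j → trans (coeff-[] (suc (toℕ j) ℕ.* r) _) (geo-cong (suc (toℕ j) ℕ.* r) (coeff-±ζq (toℕ j)))))

    coeff-denominator : ∀ k → coeff (P.denominator ζ h k) ≈ Den k
    coeff-denominator k = trans
      (coeff-product k (λ j → P.[ suc (toℕ j) ]⟨ P.±ζq ζ h (toℕ j) ⟩))
      (product-cong k (λ j → trans (coeff-[] (suc (toℕ j)) _) (geo-cong (suc (toℕ j)) (coeff-±ζq (toℕ j)))))

    module _ {r} (ζ^r≈1 : ζ ^ᴷ r R.≈ R.1#) where

      -- `fmaj` is congruent to `col` modulo `r`. Hence the character value and the power of q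
      -- combine into a single power of x.
      ζ-fmaj : ∀ {n} (π : ColoredWord r n) → (ι ζ ^ h) ^ fmaj π ≈ ι ζ ^ (h ℕ.* col π)
      ζ-fmaj π = begin
        (ι ζ ^ h) ^ (r ℕ.* majF π ℕ.+ col π)                  ≈⟨ ^-assocʳ (ι ζ) h _ ⟩
        ι ζ ^ (h ℕ.* (r ℕ.* majF π ℕ.+ col π))                ≡⟨ ≡.cong (ι ζ ^_) (regroup h r (majF π) (col π)) ⟩
        ι ζ ^ (r ℕ.* (h ℕ.* majF π) ℕ.+ h ℕ.* col π)          ≈⟨ ^-homo-* (ι ζ) (r ℕ.* (h ℕ.* majF π)) (h ℕ.* col π) ⟩
        ι ζ ^ (r ℕ.* (h ℕ.* majF π)) * ι ζ ^ (h ℕ.* col π)    ≈⟨ *-congʳ {ι ζ ^ (h ℕ.* col π)} root ⟩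
        1# * ι ζ ^ (h ℕ.* col π)                              ≈⟨ *-identityˡ (ι ζ ^ (h ℕ.* col π)) ⟩
        ι ζ ^ (h ℕ.* col π)                                   ∎
        where
        regroup : ∀ h r m c → h ℕ.* (r ℕ.* m ℕ.+ c) ≡ r ℕ.* (h ℕ.* m) ℕ.+ h ℕ.* c
        regroup = solve-∀
        root : ι ζ ^ (r ℕ.* (h ℕ.* majF π)) ≈ 1#
        root = begin
          ι ζ ^ (r ℕ.* (h ℕ.* majF π))       ≈⟨ ^-assocʳ (ι ζ) r _ ⟨
          (ι ζ ^ r) ^ (h ℕ.* majF π)         ≈⟨ ^-congˡ (h ℕ.* majF π) (trans (sym (ι-^ ζ r)) (ι-cong ζ^r≈1)) ⟩
          1# ^ (h ℕ.* majF π)                ≈⟨ 1^ (h ℕ.* majF π) ⟩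
          1#                                 ∎

      coeff-monomial : ∀ {n} (π : ColoredWord r n) →
        coeff (const (P.χ ζ (R.- R.1#) h π) P.* q P.^ fmaj π) ≈ sg (inv ∣ π ∣) * x ^ fmaj π
      coeff-monomial π = begin
        coeff (const a P.* q P.^ fmaj π)                        ≈⟨ coeff-* (const a) (q P.^ fmaj π) ⟩
        coeff (const a) * coeff (q P.^ fmaj π)
          ≈⟨ *-cong {coeff (const a)} {ι a} (coeff-const a) (coeff-^ q (fmaj π)) ⟩
        ι a * Q ^ fmaj π
          ≈⟨ *-congʳ {Q ^ fmaj π} (ι-homo-* ((R.- R.1#) ^ᴷ inv ∣ π ∣) (ζ ^ᴷ (h ℕ.* col π))) ⟩
        ι ((R.- R.1#) ^ᴷ inv ∣ π ∣) * ι (ζ ^ᴷ (h ℕ.* col π)) * Q ^ fmaj π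
          ≈⟨ *-congʳ {Q ^ fmaj π} (*-cong {ι ((R.- R.1#) ^ᴷ inv ∣ π ∣)} {sg (inv ∣ π ∣)} (ι-sg (inv ∣ π ∣))
              (trans (ι-^ ζ (h ℕ.* col π)) (sym (ζ-fmaj π)))) ⟩
        sg (inv ∣ π ∣) * (ι ζ ^ h) ^ fmaj π * Q ^ fmaj π
          ≈⟨ *-assoc (sg (inv ∣ π ∣)) ((ι ζ ^ h) ^ fmaj π) (Q ^ fmaj π) ⟩
        sg (inv ∣ π ∣) * ((ι ζ ^ h) ^ fmaj π * Q ^ fmaj π)
          ≈⟨ *-congˡ {sg (inv ∣ π ∣)} (^-distrib-* (ι ζ ^ h) Q (fmaj π)) ⟨
        sg (inv ∣ π ∣) * x ^ fmaj π                             ∎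
        where
        a : R.Carrier
        a = P.χ ζ (R.- R.1#) h π

      module _ (n a₀ k : ℕ) (c≤n : a₀ ℕ.+ k ≤ n) (0<n : 0 < n) where

        a : ℕ
        a = n ∸ (a₀ ℕ.+ k)

        n≡ : a ℕ.+ a₀ ℕ.+ k ≡ n
        n≡ = ≡.trans (ℕ.+-assoc a a₀ k) (ℕ.m∸n+n≡m c≤n)

        sm : Poly
        sm = P.signedMahonian ζ h (H r n (suc a₀) (a₀ ℕ.+ k))

        coeff-sm : coeff sm ≈ Num r n * ZF a k a₀
        coeff-sm = begin
          coeff sm
            ≈⟨ coeff-Σ (H r n (suc a₀) (a₀ ℕ.+ k)) _ ⟩
          Σ[ H r n (suc a₀) (a₀ ℕ.+ k) ] _
            ≈⟨ FiniteSums.Σ-cong 𝔸 (H r n (suc a₀) (a₀ ℕ.+ k)) coeff-monomial ⟩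
          Σ[ H r n (suc a₀) (a₀ ℕ.+ k) ] (λ π → sg (inv ∣ π ∣) * x ^ fmaj π)
            ≈⟨ Words.Σ-H 𝔸 x v v-inverse r n a₀ k c≤n 0<n ⟩
          Y r n * LevelSum.F 𝔸 x v v-inverse a k a₀
            ≈⟨ *-congʳ {LevelSum.F 𝔸 x v v-inverse a k a₀} (Num-Z r n) ⟨
          Num r n * Z n * LevelSum.F 𝔸 x v v-inverse a k a₀
            ≈⟨ *-assoc (Num r n) (Z n) (LevelSum.F 𝔸 x v v-inverse a k a₀) ⟩
          Num r n * (Z n * LevelSum.F 𝔸 x v v-inverse a k a₀)
            ≡⟨ ≡.cong (λ N → Num r n * (Z N * LevelSum.F 𝔸 x v v-inverse a k a₀)) n≡ ⟨
          Num r n * ZF a k a₀ ∎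

        -- Equality of fractions is an equation between the coefficients of two products, hence one
        -- between series. The trailing factor 1 is the denominator of `fromPoly`.
        cross-multiplied : ∀ k′ (p : Poly) → ZF a k a₀ * Den k′ ≈ coeff p →
          P.fromPoly sm P.≃ P.quotient ζ h r n k′ P.· p
        cross-multiplied k′ p eq = begin
          coeff (sm P.* P.denominator ζ h k′)
            ≈⟨ coeff-* sm (P.denominator ζ h k′) ⟩
          coeff sm * coeff (P.denominator ζ h k′)
            ≈⟨ *-cong {coeff sm} coeff-sm (coeff-denominator k′) ⟩
          Num r n * ZF a k a₀ * Den k′
            ≈⟨ *-assoc (Num r n) (ZF a k a₀) (Den k′) ⟩
          Num r n * (ZF a k a₀ * Den k′)
            ≈⟨ *-cong {Num r n} (sym (coeff-numerator r n)) eq ⟩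
          coeff (P.numerator ζ h r n) * coeff p
            ≈⟨ coeff-* (P.numerator ζ h r n) p ⟨
          coeff (P.numerator ζ h r n P.* p)
            ≈⟨ *-identityʳ (coeff (P.numerator ζ h r n P.* p)) ⟨
          coeff (P.numerator ζ h r n P.* p) * 1#
            ≈⟨ *-congˡ {coeff (P.numerator ζ h r n P.* p)} (coeff-const R.1#) ⟨
          coeff (P.numerator ζ h r n P.* p) * coeff P.1#
            ≈⟨ coeff-* (P.numerator ζ h r n P.* p) P.1# ⟨
          coeff (P.numerator ζ h r n P.* p P.* P.1#) ∎

        odd-case : Odd k → P.fromPoly sm P.≃ P.quotient ζ h r n k
        odd-case o = begin
          coeff (sm P.* P.denominator ζ h k)
            ≈⟨ cross-multiplied k P.1# (trans (ZF-odd o a a₀) (sym (coeff-const R.1#))) ⟩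
          coeff (P.numerator ζ h r n P.* P.1# P.* P.1#)  ≈⟨ coeff-* (P.numerator ζ h r n P.* P.1#) P.1# ⟩
          coeff (P.numerator ζ h r n P.* P.1#) * coeff P.1#
            ≈⟨ *-congˡ {coeff (P.numerator ζ h r n P.* P.1#)} (coeff-const R.1#) ⟩
          coeff (P.numerator ζ h r n P.* P.1#) * 1#      ≈⟨ *-identityʳ (coeff (P.numerator ζ h r n P.* P.1#)) ⟩
          coeff (P.numerator ζ h r n P.* P.1#)           ∎

        coeff-top : coeff (P.[ suc k ]⟨ P.±ζq ζ h n ⟩) ≈ geo (suc k) (sg (a ℕ.+ a₀ ℕ.+ k) * x)
        coeff-top = begin
          coeff (P.[ suc k ]⟨ P.±ζq ζ h n ⟩)          ≈⟨ coeff-[] (suc k) (P.±ζq ζ h n) ⟩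
          geo (suc k) (coeff (P.±ζq ζ h n))           ≈⟨ geo-cong (suc k) (coeff-±ζq n) ⟩
          geo (suc k) (sg n * x)                      ≡⟨ ≡.cong (λ N → geo (suc k) (sg N * x)) n≡ ⟨
          geo (suc k) (sg (a ℕ.+ a₀ ℕ.+ k) * x)       ∎

        even-even-case : Even k → Even a → P.fromPoly sm P.≃ P.quotient ζ h r n (suc k) P.· P.[ suc k ]⟨ P.±ζq ζ h n ⟩
        even-even-case e e′ = cross-multiplied (suc k) _ (trans (ZF-even-even e e′ a₀) (sym coeff-top))

        even-odd-case : Even k → Odd a → P.fromPoly sm P.≃
          P.quotient ζ h r n (suc k) P.· (P.1# P.+ P.1# P.+ P.- P.[ suc k ]⟨ P.±ζq ζ h n ⟩)
        even-odd-case e o = cross-multiplied (suc k) _ (trans (ZF-even-odd e o a₀) (sym (begin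
          coeff (P.1# P.+ P.1# P.+ P.- g)         ≈⟨ coeff-+ (P.1# P.+ P.1#) (P.- g) ⟩
          coeff (P.1# P.+ P.1#) + coeff (P.- g)
            ≈⟨ +-cong {coeff (P.1# P.+ P.1#)} (trans (coeff-+ P.1# P.1#)
                (+-cong {coeff P.1#} (coeff-const R.1#) (coeff-const R.1#)))
                (trans (coeff-‿ g) (-‿cong {coeff g} coeff-top)) ⟩
          1# + 1# - geo (suc k) (sg (a ℕ.+ a₀ ℕ.+ k) * x) ∎)))
          where
          g : Poly
          g = P.[ suc k ]⟨ P.±ζq ζ h n ⟩

theorem2p5 : ∀ {c ℓ₁ ℓ₂} (𝕂 : HeytingField c ℓ₁ ℓ₂) →
    let open RationalFunctions 𝕂 in
    ∀ (r n h k b : ℕ) (ζ : HeytingField.Carrier 𝕂) →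
    1 ≤ r → 1 ≤ n → IsPrimitiveRoot r ζ → h < r →
    1 ≤ k → k ≤ n ∸ 1 → k ≤ b → b ≤ n →
    let lhs = fromPoly (signedMahonian ζ h (H r n (suc (b ∸ k)) b)) in
    (k % 2 ≡ 1 →
    lhs ≃ quotient ζ h r n k)
    ×
    (k % 2 ≡ 0 → (n ∸ b) % 2 ≡ 0 →
    lhs ≃ quotient ζ h r n (suc k) · [ suc k ]⟨ ±ζq ζ h n ⟩)
    ×
    (k % 2 ≡ 0 → (n ∸ b) % 2 ≡ 1 →
    lhs ≃ quotient ζ h r n (suc k) · (1# + 1# + - [ suc k ]⟨ ±ζq ζ h n ⟩))
theorem2p5 𝕂 r n h k b ζ 1≤r 1≤n (ζ^r≈1 , _) h<r 1≤k k≤n-1 k≤b b≤n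
  -- Replaces b by `a₀ + k`: the labels b - k + 1, ..., b counted from 1 are a₀, ..., a₀ + k - 1
  -- counted from 0.
  with b ∸ k | ℕ.m∸n+n≡m k≤b
... | a₀ | ≡.refl =
  (λ k-odd → C.odd-case ζ h ζ^r≈1 n a₀ k b≤n 1≤n (%2≡1⇒odd k k-odd)) ,
  (λ k-even a-even → C.even-even-case ζ h ζ^r≈1 n a₀ k b≤n 1≤n (%2≡0⇒even k k-even) (%2≡0⇒even _ a-even)) ,
  (λ k-even a-odd → C.even-odd-case ζ h ζ^r≈1 n a₀ k b≤n 1≤n (%2≡0⇒even k k-even) (%2≡1⇒odd _ a-odd))
  where module C = Coefficients 𝕂
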